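{- Let $q \geq 1$ be an integer and let $\epsilon \in [\frac{1}{11},\frac{1}{2})$ be a real number. Let $p$ be a prime satisfying $$ p\equiv 1\pmod{q}, \qquad \log\log p > \frac{\log 6.83}{\frac{1}{2}-\epsilon} \qquad \text{and} \qquad \frac{\phi(p-1)}{p-1}\leq\frac{1}{2}-\epsilon . $$ Then there exists an integer $g$ satisfying $1 < g < p-1$ and $\gcd\left(g,\frac{p-1}{q}\right)=1$ such that $g$ is a QNRNP modulo $p$. In particular, when $q=1$, there exists an integer $g$ with $1<g<p-1$ and $\gcd(g,p-1)=1$ such that $g$ is a QNRNP modulo $p$.
   Context: For an odd prime $p$, a primitive root modulo $p$ is an integer whose class generates the cyclic group $(\mathbb{Z}/p\mathbb{Z})^*$. An integer is called a QNRNP modulo $p$ if it is a quadratic non-residue modulo $p$ (in particular coprime to $p$) which is not a primitive root modulo $p$. Here $\phi$ is Euler's totient function and $\log$ is the natural logarithm. -}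

module Defs where

open import Data.Nat.Base as ℕ using (ℕ; zero; suc; z≤n; s≤s)
import Data.Nat.Properties as ℕₚ
open import Data.Nat.Coprimality using (coprime?)
open import Data.Nat.Primality using (Prime; prime)
open import Data.Integer.Base as ℤ using (ℤ; +_; 1ℤ)
import Data.Integer.Properties as ℤₚ
open import Data.Integer.Divisibility using (_∣_)
open import Data.Integer.GCD using (gcd)
open import Data.List.Base using (length; filter; map; upTo)
open import Data.Rational.Base
open import Data.Rational.Properties
import Data.Rational.Unnormalised.Base as ℚᵘᵇ
import Data.Rational.Unnormalised.Properties as ℚᵘ
open import Data.Rational.Solver using (module +-*-Solver)
open import Data.Product.Base using (Σ; ∃; _×_; _,_; proj₁; proj₂)
open import Data.Sum.Base using (inj₁; inj₂)
open import Relation.Nullary using (¬_; yes; no; contradiction)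
open import Relation.Binary.PropositionalEquality
  using (_≡_; refl; sym; trans; cong; cong₂; subst; subst₂)
open +-*-Solver using (solve; _:+_; _:*_; _:-_; :-_; _:=_; con)

fromℕ : ℕ → ℚ
fromℕ n = + n / 1

-- The reciprocal, totalised by inv 0 = 0 so that it can be applied to
-- every term of a sequence that is only eventually nonzero.
inv : ℚ → ℚ
inv p with p ≟ 0ℚ
... | yes _  = 0ℚ
... | no p≢0 = (1/ p) {{≢-nonZero p≢0}}

Σ[<_] : ℕ → (ℕ → ℚ) → ℚ
Σ[< zero  ] f = 0ℚ
Σ[< suc n ] f = Σ[< n ] f + f n

-- Left Riemann sum of f from a to b with n equal steps, where r = 1/n.
-- If b < a the steps are negative, as in the oriented integral.
leftSum : (ℚ → ℚ) → (a b : ℚ) → (n : ℕ) → (r : ℚ) → ℚ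
leftSum f a b n r = Σ[< n ] (λ k → f (a + fromℕ k * ((b - a) * r)) * ((b - a) * r))

riemannSum : (ℚ → ℚ) → (a b : ℚ) → (n : ℕ) → .{{ℕ.NonZero n}} → ℚ
riemannSum f a b n = leftSum f a b n (+ 1 / n)

IsCauchy : (ℕ → ℚ) → Set
IsCauchy s = ∀ δ → 0ℚ < δ →
  ∃ λ N → ∀ m n → N ℕ.≤ m → N ℕ.≤ n → ∣ s m - s n ∣ ≤ δ

record ℝ : Set where
  constructor mkℝ
  field
    seq    : ℕ → ℚ
    cauchy : IsCauchy seq

open ℝ public

infix 4 _≤ℝ_ _<ℝ_

_≤ℝ_ : ℝ → ℝ → Set
x ≤ℝ y = ∀ δ → 0ℚ < δ → ∃ λ N → ∀ n → N ℕ.≤ n → seq x n ≤ seq y n + δ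

_<ℝ_ : ℝ → ℝ → Set
x <ℝ y = ∃ λ δ → 0ℚ < δ × ∃ λ N → ∀ n → N ℕ.≤ n → seq x n + δ ≤ seq y n

*-mono : ∀ {a b c d} → 0ℚ ≤ a → a ≤ b → 0ℚ ≤ c → c ≤ d → a * c ≤ b * d
*-mono {a} {b} {c} {d} 0≤a a≤b 0≤c c≤d = ≤-trans
  (*-monoʳ-≤-nonNeg c {{nonNegative 0≤c}} a≤b)
  (*-monoˡ-≤-nonNeg b {{nonNegative (≤-trans 0≤a a≤b)}} c≤d)

0≤* : ∀ {a b} → 0ℚ ≤ a → 0ℚ ≤ b → 0ℚ ≤ a * b
0≤* {a} {b} 0≤a 0≤b = *-mono {0ℚ} {a} {0ℚ} {b} ≤-refl 0≤a ≤-refl 0≤b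

0<* : ∀ {a b} → 0ℚ < a → 0ℚ < b → 0ℚ < a * b
0<* {a} {b} 0<a 0<b =
  positive⁻¹ (a * b) {{pos*pos⇒pos a {{positive 0<a}} b {{positive 0<b}}}}

0≤+ : ∀ {a b} → 0ℚ ≤ a → 0ℚ ≤ b → 0ℚ ≤ a + b
0≤+ = +-mono-≤

0<1 : 0ℚ < 1ℚ
0<1 = positive⁻¹ 1ℚ

0<½ : 0ℚ < ½
0<½ = positive⁻¹ ½

≤⇒0≤- : ∀ {a b} → a ≤ b → 0ℚ ≤ b - a
≤⇒0≤- {a} {b} a≤b = subst (_≤ b - a) (+-inverseʳ a) (+-monoˡ-≤ (- a) a≤b)

0≤-⇒≤ : ∀ {a b} → 0ℚ ≤ b - a → a ≤ b
0≤-⇒≤ {a} {b} 0≤ = subst₂ _≤_ (+-identityˡ a)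
  (solve 2 (λ a b → (b :- a) :+ a := b) refl a b) (+-monoˡ-≤ a 0≤)

p≤∣p∣ : ∀ p → p ≤ ∣ p ∣
p≤∣p∣ p with ≤-total 0ℚ p
... | inj₁ 0≤p = ≤-reflexive (sym (0≤p⇒∣p∣≡p 0≤p))
... | inj₂ p≤0 = ≤-trans p≤0 (0≤∣p∣ p)

∣-∣-swap : ∀ p q → ∣ p - q ∣ ≡ ∣ q - p ∣
∣-∣-swap p q = trans (sym (∣-p∣≡∣p∣ (p - q)))
  (cong ∣_∣ (solve 2 (λ p q → :- (p :- q) := q :- p) refl p q))

∣-∣-split : ∀ a b c → ∣ a - c ∣ ≤ ∣ a - b ∣ + ∣ b - c ∣
∣-∣-split a b c = subst (λ z → ∣ z ∣ ≤ ∣ a - b ∣ + ∣ b - c ∣)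
  (solve 3 (λ a b c → (a :- b) :+ (b :- c) := a :- c) refl a b c)
  (∣p+q∣≤∣p∣+∣q∣ (a - b) (b - c))

half+half : ∀ δ → ½ * δ + ½ * δ ≡ δ
half+half δ = trans (sym (*-distribʳ-+ δ ½ ½)) (*-identityˡ δ)

inv-* : ∀ {p} → 0ℚ < p → p * inv p ≡ 1ℚ
inv-* {p} 0<p with p ≟ 0ℚ
... | yes refl = contradiction 0<p (<-irrefl refl)
... | no p≢0   = *-inverseʳ p {{≢-nonZero p≢0}}

inv-pos : ∀ {p} → 0ℚ < p → 0ℚ < inv p
inv-pos {p} 0<p with p ≟ 0ℚ
... | yes refl = contradiction 0<p (<-irrefl refl)
... | no p≢0   = positive⁻¹ _ {{1/pos⇒pos p {{positive 0<p}}}}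

inv-anti : ∀ {a p} → 0ℚ < a → a ≤ p → inv p ≤ inv a
inv-anti {a} {p} 0<a a≤p = subst₂ _≤_
  (trans (solve 3 (λ a i j → a :* (i :* j) := (a :* i) :* j) refl a (inv a) (inv p))
    (trans (cong (_* inv p) (inv-* 0<a)) (*-identityˡ _)))
  (trans (solve 3 (λ p i j → p :* (i :* j) := (p :* j) :* i) refl p (inv a) (inv p))
    (trans (cong (_* inv a) (inv-* 0<p)) (*-identityˡ _)))
  (*-monoʳ-≤-nonNeg (inv a * inv p)
    {{nonNegative (<⇒≤ (0<* (inv-pos 0<a) (inv-pos 0<p)))}} a≤p)
  where 0<p = <-≤-trans 0<a a≤p

inv-diff : ∀ {p q} → 0ℚ < p → 0ℚ < q → inv p - inv q ≡ (q - p) * (inv p * inv q)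
inv-diff {p} {q} 0<p 0<q = sym (trans
  (solve 4 (λ p q i j → (q :- p) :* (i :* j) := (q :* j) :* i :- (p :* i) :* j)
    refl p q (inv p) (inv q))
  (cong₂ _-_ (trans (cong (_* inv p) (inv-* 0<q)) (*-identityˡ (inv p)))
             (trans (cong (_* inv q) (inv-* 0<p)) (*-identityˡ (inv q)))))

∣*inv²∣≤ : ∀ {A p q} z → 0ℚ < A → A ≤ p → A ≤ q →
           ∣ z * (inv p * inv q) ∣ ≤ ∣ z ∣ * (inv A * inv A)
∣*inv²∣≤ {A} {p} {q} z 0<A A≤p A≤q = subst (_≤ ∣ z ∣ * (inv A * inv A))
  (sym (trans (∣p*q∣≡∣p∣*∣q∣ z _) (cong (∣ z ∣ *_) (0≤p⇒∣p∣≡p (0≤* 0≤i 0≤j)))))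
  (*-mono (0≤∣p∣ z) ≤-refl (0≤* 0≤i 0≤j)
    (*-mono 0≤i (inv-anti 0<A A≤p) 0≤j (inv-anti 0<A A≤q)))
  where
  0≤i = <⇒≤ (inv-pos (<-≤-trans 0<A A≤p))
  0≤j = <⇒≤ (inv-pos (<-≤-trans 0<A A≤q))

inv-lip : ∀ {A p q} → 0ℚ < A → A ≤ p → A ≤ q →
          ∣ inv p - inv q ∣ ≤ ∣ p - q ∣ * (inv A * inv A)
inv-lip {A} {p} {q} 0<A A≤p A≤q = subst₂ (λ u v → ∣ u ∣ ≤ v * (inv A * inv A))
  (sym (inv-diff (<-≤-trans 0<A A≤p) (<-≤-trans 0<A A≤q)))
  (∣-∣-swap q p) (∣*inv²∣≤ (q - p) 0<A A≤p A≤q)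

fromℕ-mono : ∀ {m n} → m ℕ.≤ n → fromℕ m ≤ fromℕ n
fromℕ-mono {m} {n} m≤n = toℚᵘ-cancel-≤
  (ℚᵘ.≤-respˡ-≃ (ℚᵘ.≃-sym (toℚᵘ-fromℚᵘ (ℚᵘᵇ.mkℚᵘ (+ m) 0)))
  (ℚᵘ.≤-respʳ-≃ (ℚᵘ.≃-sym (toℚᵘ-fromℚᵘ (ℚᵘᵇ.mkℚᵘ (+ n) 0)))
    (ℚᵘᵇ.*≤* (ℤₚ.*-monoʳ-≤-nonNeg (+ 1) (ℤ.+≤+ m≤n)))))

0≤fromℕ : ∀ n → 0ℚ ≤ fromℕ n
0≤fromℕ n = fromℕ-mono {0} {n} z≤n

fromℕ-+ : ∀ m n → fromℕ (m ℕ.+ n) ≡ fromℕ m + fromℕ n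
fromℕ-+ m n = toℚᵘ-injective
  (ℚᵘ.≃-trans (toℚᵘ-fromℚᵘ (ℚᵘᵇ.mkℚᵘ (+ (m ℕ.+ n)) 0))
  (ℚᵘ.≃-trans (ℚᵘᵇ.*≡* (cong (ℤ._* + 1) (cong₂ ℤ._+_ (sym (ℤₚ.*-identityʳ (+ m))) (sym (ℤₚ.*-identityʳ (+ n))))))
  (ℚᵘ.≃-sym (ℚᵘ.≃-trans (toℚᵘ-homo-+ (fromℕ m) (fromℕ n))
    (ℚᵘ.+-cong (toℚᵘ-fromℚᵘ (ℚᵘᵇ.mkℚᵘ (+ m) 0)) (toℚᵘ-fromℚᵘ (ℚᵘᵇ.mkℚᵘ (+ n) 0)))))))

fromℕ-suc : ∀ n → fromℕ (suc n) ≡ fromℕ n + 1ℚ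
fromℕ-suc n = trans (cong fromℕ (ℕₚ.+-comm 1 n)) (fromℕ-+ n 1)

fromℕ-* : ∀ m n → fromℕ (m ℕ.* n) ≡ fromℕ m * fromℕ n
fromℕ-* zero    n = sym (*-zeroˡ (fromℕ n))
fromℕ-* (suc m) n = trans (fromℕ-+ n (m ℕ.* n)) (trans
  (cong (λ z → fromℕ n + z) (fromℕ-* m n)) (sym (trans
  (cong (_* fromℕ n) (fromℕ-suc m))
  (solve 2 (λ m n → (m :+ con 1ℚ) :* n := n :+ m :* n) refl (fromℕ m) (fromℕ n)))))

fromℕ*1/ : ∀ n → fromℕ (suc n) * (+ 1 / suc n) ≡ 1ℚ
fromℕ*1/ n = toℚᵘ-injective
  (ℚᵘ.≃-trans (toℚᵘ-homo-* (fromℕ (suc n)) (+ 1 / suc n))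
  (ℚᵘ.≃-trans (ℚᵘ.*-cong (toℚᵘ-fromℚᵘ (ℚᵘᵇ.mkℚᵘ (+ suc n) 0)) (toℚᵘ-fromℚᵘ (ℚᵘᵇ.mkℚᵘ (+ 1) n)))
  (ℚᵘᵇ.*≡* (trans (ℤₚ.*-identityʳ _) (trans (ℤₚ.*-identityʳ (+ suc n))
    (sym (trans (ℤₚ.*-identityˡ _) (cong +_ (ℕₚ.*-identityˡ (suc n))))))))))

0<1/ : ∀ n → 0ℚ < + 1 / suc n
0<1/ n = positive⁻¹ (+ 1 / suc n) {{normalize-pos 1 (suc n)}}

i≤∣i∣ : ∀ i → i ℤ.≤ + ℤ.∣ i ∣
i≤∣i∣ (+ n)      = ℤₚ.≤-refl
i≤∣i∣ ℤ.-[1+ n ] = ℤ.-≤+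

archimedean : ∀ q → ∃ λ N → q ≤ fromℕ N
archimedean q@(mkℚ i d _) = ℤ.∣ i ∣ , toℚᵘ-cancel-≤
  (ℚᵘ.≤-respʳ-≃ (ℚᵘ.≃-sym (toℚᵘ-fromℚᵘ (ℚᵘᵇ.mkℚᵘ (+ ℤ.∣ i ∣) 0)))
    (ℚᵘᵇ.*≤* (ℤₚ.≤-trans (ℤₚ.≤-reflexive (ℤₚ.*-identityʳ i))
      (ℤₚ.≤-trans (i≤∣i∣ i)
      (ℤₚ.≤-trans (ℤ.+≤+ (ℕₚ.m≤m*n ℤ.∣ i ∣ (suc d)))
        (ℤₚ.≤-reflexive (ℤₚ.pos-* ℤ.∣ i ∣ (suc d))))))))

Σ-cong : ∀ n {f g} → (∀ k → f k ≡ g k) → Σ[< n ] f ≡ Σ[< n ] g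
Σ-cong zero    f≗g = refl
Σ-cong (suc n) f≗g = cong₂ _+_ (Σ-cong n f≗g) (f≗g n)

Σ-const : ∀ n c → Σ[< n ] (λ _ → c) ≡ fromℕ n * c
Σ-const zero    c = sym (*-zeroˡ c)
Σ-const (suc n) c = trans (cong (_+ c) (Σ-const n c)) (sym (trans
  (cong (_* c) (fromℕ-suc n))
  (solve 2 (λ n c → (n :+ con 1ℚ) :* c := n :* c :+ c) refl (fromℕ n) c)))

Σ-split : ∀ m n f → Σ[< m ℕ.+ n ] f ≡ Σ[< m ] f + Σ[< n ] (λ j → f (m ℕ.+ j))
Σ-split m zero    f = trans (cong (λ z → Σ[< z ] f) (ℕₚ.+-identityʳ m)) (sym (+-identityʳ _))
Σ-split m (suc n) f = trans (cong (λ z → Σ[< z ] f) (ℕₚ.+-suc m n))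
  (trans (cong (_+ f (m ℕ.+ n)) (Σ-split m n f))
         (+-assoc (Σ[< m ] f) (Σ[< n ] (λ j → f (m ℕ.+ j))) (f (m ℕ.+ n))))

Σ-* : ∀ n m f → Σ[< n ℕ.* m ] f ≡ Σ[< n ] (λ k → Σ[< m ] (λ j → f (k ℕ.* m ℕ.+ j)))
Σ-* zero    m f = refl
Σ-* (suc n) m f = trans (cong (λ z → Σ[< z ] f) (ℕₚ.+-comm m (n ℕ.* m)))
  (trans (Σ-split (n ℕ.* m) m f)
         (cong (_+ Σ[< m ] (λ j → f (n ℕ.* m ℕ.+ j))) (Σ-* n m f)))

Σ-dist : ∀ n {f g B} → (∀ k → k ℕ.< n → ∣ f k - g k ∣ ≤ B) →
         ∣ Σ[< n ] f - Σ[< n ] g ∣ ≤ fromℕ n * B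
Σ-dist zero    {B = B} _ = ≤-reflexive (sym (*-zeroˡ B))
Σ-dist (suc n) {f} {g} {B} h = subst₂ _≤_
  (cong ∣_∣ (solve 4 (λ s t a b → (s :- t) :+ (a :- b) := (s :+ a) :- (t :+ b))
    refl (Σ[< n ] f) (Σ[< n ] g) (f n) (g n)))
  (sym (trans (cong (_* B) (fromℕ-suc n))
    (solve 2 (λ n c → (n :+ con 1ℚ) :* c := n :* c :+ c) refl (fromℕ n) B)))
  (≤-trans (∣p+q∣≤∣p∣+∣q∣ (Σ[< n ] f - Σ[< n ] g) (f n - g n))
    (+-mono-≤ (Σ-dist n (λ k k<n → h k (ℕₚ.m<n⇒m<1+n k<n))) (h n ℕₚ.≤-refl)))

Σ-lower : ∀ n {f B} → (∀ k → k ℕ.< n → B ≤ f k) → fromℕ n * B ≤ Σ[< n ] f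
Σ-lower zero    {B = B} _ = ≤-reflexive (*-zeroˡ B)
Σ-lower (suc n) {f} {B} h = subst (_≤ Σ[< n ] f + f n)
  (sym (trans (cong (_* B) (fromℕ-suc n))
    (solve 2 (λ n c → (n :+ con 1ℚ) :* c := n :* c :+ c) refl (fromℕ n) B)))
  (+-mono-≤ (Σ-lower n (λ k k<n → h k (ℕₚ.m<n⇒m<1+n k<n))) (h n ℕₚ.≤-refl))

node : ℚ → ℚ → ℕ → ℚ
node x r k = 1ℚ + fromℕ k * ((x - 1ℚ) * r)

node-≥ : ∀ {A x r} n k → 0ℚ ≤ r → fromℕ n * r ≡ 1ℚ → k ℕ.≤ n →
         A ≤ 1ℚ → A ≤ x → A ≤ node x r k
node-≥ {A} {x} {r} n k 0≤r nr≡1 k≤n A≤1 A≤x = subst₂ _≤_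
  (solve 2 (λ A c → (con 1ℚ :- c) :* A :+ c :* A := A) refl A c)
  (solve 3 (λ x k r → (con 1ℚ :- k :* r) :* con 1ℚ :+ (k :* r) :* x
                      := con 1ℚ :+ k :* ((x :- con 1ℚ) :* r)) refl x (fromℕ k) r)
  (+-mono-≤ (*-monoˡ-≤-nonNeg (1ℚ - c) {{nonNegative (≤⇒0≤- c≤1)}} A≤1)
            (*-monoˡ-≤-nonNeg c {{nonNegative (0≤* (0≤fromℕ k) 0≤r)}} A≤x))
  where
  c = fromℕ k * r
  c≤1 : c ≤ 1ℚ
  c≤1 = subst (c ≤_) nr≡1 (*-monoʳ-≤-nonNeg r {{nonNegative 0≤r}} (fromℕ-mono k≤n))

leftSum-lip : ∀ {A x y r} n → 0ℚ ≤ r → fromℕ n * r ≡ 1ℚ →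
              0ℚ < A → A ≤ 1ℚ → A ≤ x → A ≤ y →
              ∣ leftSum inv 1ℚ x n r - leftSum inv 1ℚ y n r ∣ ≤ ∣ x - y ∣ * (inv A * inv A)
leftSum-lip {A} {x} {y} {r} n 0≤r nr≡1 0<A A≤1 A≤x A≤y =
  subst (∣ leftSum inv 1ℚ x n r - leftSum inv 1ℚ y n r ∣ ≤_) total (Σ-dist n term)
  where
  C = inv A * inv A
  total : fromℕ n * ((∣ x - y ∣ * r) * C) ≡ ∣ x - y ∣ * C
  total = trans (solve 4 (λ n d r C → n :* ((d :* r) :* C) := (n :* r) :* (d :* C))
                   refl (fromℕ n) ∣ x - y ∣ r C)
                (trans (cong (_* (∣ x - y ∣ * C)) nr≡1) (*-identityˡ _))
  term : ∀ k → k ℕ.< n →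
    ∣ inv (node x r k) * ((x - 1ℚ) * r) - inv (node y r k) * ((y - 1ℚ) * r) ∣
      ≤ (∣ x - y ∣ * r) * C
  term k k<n = subst₂ _≤_ (cong ∣_∣ (sym eq))
    (cong (_* C) (trans (∣p*q∣≡∣p∣*∣q∣ (x - y) r) (cong (∣ x - y ∣ *_) (0≤p⇒∣p∣≡p 0≤r))))
    (∣*inv²∣≤ ((x - y) * r) 0<A A≤t A≤u)
    where
    A≤t = node-≥ {x = x} n k 0≤r nr≡1 (ℕₚ.<⇒≤ k<n) A≤1 A≤x
    A≤u = node-≥ {x = y} n k 0≤r nr≡1 (ℕₚ.<⇒≤ k<n) A≤1 A≤y
    t = node x r k
    u = node y r k
    i = inv t
    j = inv u
    h = (x - 1ℚ) * r
    g = (y - 1ℚ) * r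
    -- i h - j g = (u j) i h - (t i) j g = (u h - t g) i j = (h - g) i j
    eq : i * h - j * g ≡ ((x - y) * r) * (i * j)
    eq = trans
      (cong₂ _-_
        (trans (sym (*-identityˡ (i * h))) (cong (_* (i * h)) (sym (inv-* (<-≤-trans 0<A A≤u)))))
        (trans (sym (*-identityˡ (j * g))) (cong (_* (j * g)) (sym (inv-* (<-≤-trans 0<A A≤t))))))
      (solve 6 (λ x y r k i j →
        ((con 1ℚ :+ k :* ((y :- con 1ℚ) :* r)) :* j) :* (i :* ((x :- con 1ℚ) :* r))
        :- ((con 1ℚ :+ k :* ((x :- con 1ℚ) :* r)) :* i) :* (j :* ((y :- con 1ℚ) :* r))
        := ((x :- y) :* r) :* (i :* j)) refl x y r (fromℕ k) i j)

leftSum-refine : ∀ {A x r s E} n m → 0ℚ ≤ r → fromℕ n * r ≡ 1ℚ → 0ℚ ≤ s → fromℕ m * s ≡ 1ℚ →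
                 0ℚ < A → A ≤ 1ℚ → A ≤ x → ∣ x - 1ℚ ∣ ≤ E →
                 ∣ leftSum inv 1ℚ x n r - leftSum inv 1ℚ x (n ℕ.* m) (r * s) ∣
                   ≤ r * (E * E * (inv A * inv A))
leftSum-refine {A} {x} {r} {s} {E} n m 0≤r nr≡1 0≤s ms≡1 0<A A≤1 A≤x d≤E =
  subst₂ (λ u v → ∣ u - v ∣ ≤ r * (E * E * C))
    (Σ-cong n coarse) (sym (Σ-* n m fine))
    (subst (∣ Σ[< n ] (λ k → Σ[< m ] (c k)) - Σ[< n ] (λ k → Σ[< m ] (e k)) ∣ ≤_) total
      (Σ-dist n (λ k k<n → Σ-dist m {c k} {e k} (λ j j<m → term k j k<n j<m))))
  where
  C = inv A * inv A
  D = x - 1ℚ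
  fine : ℕ → ℚ
  fine l = inv (node x (r * s) l) * (D * (r * s))
  c e : ℕ → ℕ → ℚ
  c k _ = inv (node x r k) * (D * (r * s))
  e k j = fine (k ℕ.* m ℕ.+ j)
  coarse : ∀ k → Σ[< m ] (λ _ → inv (node x r k) * (D * (r * s))) ≡ inv (node x r k) * (D * r)
  coarse k = trans (Σ-const m _) (trans
    (solve 5 (λ m i D r s → m :* (i :* (D :* (r :* s))) := (m :* s) :* (i :* (D :* r)))
      refl (fromℕ m) (inv (node x r k)) D r s)
    (trans (cong (_* (inv (node x r k) * (D * r))) ms≡1) (*-identityˡ _)))
  0≤rs = 0≤* 0≤r 0≤s
  0≤E = ≤-trans (0≤∣p∣ D) d≤E
  0≤i = <⇒≤ (inv-pos 0<A)
  B = ((E * r) * C) * (E * (r * s))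
  total : fromℕ n * (fromℕ m * B) ≡ r * (E * E * C)
  total = trans
    (solve 6 (λ n m E r s C → n :* (m :* (((E :* r) :* C) :* (E :* (r :* s))))
        := (n :* r) :* (m :* s) :* (r :* (E :* E :* C))) refl (fromℕ n) (fromℕ m) E r s C)
    (trans (cong₂ (λ u v → u * v * (r * (E * E * C))) nr≡1 ms≡1)
      (solve 1 (λ z → con 1ℚ :* con 1ℚ :* z := z) refl (r * (E * E * C))))
  nm≡1 : fromℕ (n ℕ.* m) * (r * s) ≡ 1ℚ
  nm≡1 = trans (cong (_* (r * s)) (fromℕ-* n m)) (trans
    (solve 4 (λ n m r s → (n :* m) :* (r :* s) := (n :* r) :* (m :* s)) refl (fromℕ n) (fromℕ m) r s)
    (cong₂ _*_ nr≡1 ms≡1))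
  term : ∀ k j → k ℕ.< n → j ℕ.< m →
    ∣ inv (node x r k) * (D * (r * s)) - fine (k ℕ.* m ℕ.+ j) ∣ ≤ B
  term k j k<n j<m = subst (_≤ B) (cong ∣_∣ (sym factor)) (subst (_≤ B)
    (sym (∣p*q∣≡∣p∣*∣q∣ (inv t - inv u) (D * (r * s))))
    (*-mono (0≤∣p∣ (inv t - inv u))
      (≤-trans (inv-lip 0<A A≤t A≤u)
        (*-monoʳ-≤-nonNeg C {{nonNegative (0≤* 0≤i 0≤i)}} t-u))
      (0≤∣p∣ (D * (r * s)))
      (abs* 0≤rs)))
    where
    l = k ℕ.* m ℕ.+ j
    t = node x r k
    u = node x (r * s) l
    l≤nm : l ℕ.≤ n ℕ.* m
    l≤nm = ℕₚ.≤-trans (ℕₚ.+-monoʳ-≤ (k ℕ.* m) (ℕₚ.<⇒≤ j<m))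
      (ℕₚ.≤-trans (ℕₚ.≤-reflexive (ℕₚ.+-comm (k ℕ.* m) m)) (ℕₚ.*-monoˡ-≤ m k<n))
    A≤t = node-≥ {x = x} n k 0≤r nr≡1 (ℕₚ.<⇒≤ k<n) A≤1 A≤x
    A≤u = node-≥ {x = x} (n ℕ.* m) l 0≤rs nm≡1 l≤nm A≤1 A≤x
    abs* : ∀ {z} → 0ℚ ≤ z → ∣ D * z ∣ ≤ E * z
    abs* {z} 0≤z = subst (_≤ E * z)
      (sym (trans (∣p*q∣≡∣p∣*∣q∣ D z) (cong (∣ D ∣ *_) (0≤p⇒∣p∣≡p 0≤z))))
      (*-monoʳ-≤-nonNeg z {{nonNegative 0≤z}} d≤E)
    factor : inv t * (D * (r * s)) - inv u * (D * (r * s)) ≡ (inv t - inv u) * (D * (r * s))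
    factor = solve 3 (λ a b c → a :* c :- b :* c := (a :- b) :* c) refl (inv t) (inv u) (D * (r * s))
    -- u - t = j D r s, where j s ≤ m s = 1
    u-t : u - t ≡ D * (r * (fromℕ j * s))
    u-t = trans
      (cong (λ z → (1ℚ + z * (D * (r * s))) - t)
        (trans (fromℕ-+ (k ℕ.* m) j) (cong (_+ fromℕ j) (fromℕ-* k m))))
      (trans
        (solve 6 (λ k m j D r s →
          (con 1ℚ :+ (k :* m :+ j) :* (D :* (r :* s))) :- (con 1ℚ :+ k :* (D :* r))
          := (k :* (D :* r)) :* (m :* s) :- (k :* (D :* r)) :* con 1ℚ :+ D :* (r :* (j :* s)))
          refl (fromℕ k) (fromℕ m) (fromℕ j) D r s)
        (trans (cong (λ z → (fromℕ k * (D * r)) * z - (fromℕ k * (D * r)) * 1ℚ + D * (r * (fromℕ j * s))) ms≡1)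
          (solve 2 (λ a b → a :* con 1ℚ :- a :* con 1ℚ :+ b := b) refl (fromℕ k * (D * r)) (D * (r * (fromℕ j * s))))))
    js≤1 : fromℕ j * s ≤ 1ℚ
    js≤1 = subst (fromℕ j * s ≤_) ms≡1
      (*-monoʳ-≤-nonNeg s {{nonNegative 0≤s}} (fromℕ-mono (ℕₚ.<⇒≤ j<m)))
    t-u : ∣ t - u ∣ ≤ E * r
    t-u = subst (_≤ E * r) (trans (cong ∣_∣ (sym u-t)) (∣-∣-swap u t))
      (≤-trans (abs* (0≤* 0≤r (0≤* (0≤fromℕ j) 0≤s)))
        (*-monoˡ-≤-nonNeg E {{nonNegative 0≤E}}
          (subst (r * (fromℕ j * s) ≤_) (*-identityʳ r) (*-monoˡ-≤-nonNeg r {{nonNegative 0≤r}} js≤1))))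

leftSum-comm : ∀ x r s n m → leftSum inv 1ℚ x (n ℕ.* m) (r * s) ≡ leftSum inv 1ℚ x (m ℕ.* n) (s * r)
leftSum-comm x r s n m = cong₂ (leftSum inv 1ℚ x) (ℕₚ.*-comm n m) (*-comm r s)

eventually-bounded : ∀ {s} → IsCauchy s → ∃ λ B → 0ℚ < B × ∃ λ N → ∀ n → N ℕ.≤ n → ∣ s n ∣ ≤ B
eventually-bounded {s} cs with cs 1ℚ 0<1
... | N , close = ∣ s N ∣ + 1ℚ ,
  <-≤-trans 0<1 (subst (_≤ ∣ s N ∣ + 1ℚ) (+-identityˡ 1ℚ) (+-monoˡ-≤ 1ℚ (0≤∣p∣ (s N)))) ,
  N , λ n N≤n → subst (λ z → ∣ z ∣ ≤ ∣ s N ∣ + 1ℚ)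
    (solve 2 (λ a b → a :+ (b :- a) := b) refl (s N) (s n))
    (≤-trans (∣p+q∣≤∣p∣+∣q∣ (s N) (s n - s N))
      (+-monoʳ-≤ ∣ s N ∣ (close n N N≤n ℕₚ.≤-refl)))

fromℚ : ℚ → ℝ
fromℚ q = mkℝ (λ _ → q) λ δ 0<δ → 0 , λ _ _ _ _ →
  subst (_≤ δ) (cong ∣_∣ (sym (+-inverseʳ q))) (<⇒≤ 0<δ)

0ℝ 1ℝ : ℝ
0ℝ = fromℚ 0ℚ
1ℝ = fromℚ 1ℚ

infixl 6 _-ℝ_
infixl 7 _*ℝ_ _÷ℝ_[_]

_-ℝ_ : ℝ → ℝ → ℝ
x -ℝ y = mkℝ (λ n → seq x n - seq y n) cauchy-
  where
  cauchy- : IsCauchy (λ n → seq x n - seq y n)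
  cauchy- δ 0<δ with cauchy x (½ * δ) (0<* 0<½ 0<δ) | cauchy y (½ * δ) (0<* 0<½ 0<δ)
  ... | M , hx | N , hy = M ℕ.⊔ N , λ m n m≥ n≥ → subst₂ _≤_
    (cong ∣_∣ (solve 4 (λ a b c d → (a :- b) :- (c :- d) := (a :- c) :- (b :- d))
      refl (seq x m) (seq x n) (seq y m) (seq y n)))
    (half+half δ)
    (≤-trans (∣p-q∣≤∣p∣+∣q∣ (seq x m - seq x n) (seq y m - seq y n))
      (+-mono-≤ (hx m n (ℕₚ.m⊔n≤o⇒m≤o M N m≥) (ℕₚ.m⊔n≤o⇒m≤o M N n≥))
                (hy m n (ℕₚ.m⊔n≤o⇒n≤o M N m≥) (ℕₚ.m⊔n≤o⇒n≤o M N n≥))))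

halve : ∀ δ → 0ℚ < δ → ∃ λ h → 0ℚ < h × h + h ≡ δ
halve δ 0<δ = ½ * δ , 0<* {½} {δ} 0<½ 0<δ , half+half δ

*-dist : ∀ {a b c d B C h} → 0ℚ < B → 0ℚ < C → ∣ a ∣ ≤ B → ∣ d ∣ ≤ C →
         ∣ a - c ∣ ≤ h * inv C → ∣ b - d ∣ ≤ h * inv B → ∣ a * b - c * d ∣ ≤ h + h
*-dist {a} {b} {c} {d} {B} {C} {h} 0<B 0<C a≤B d≤C a-c b-d = subst₂ _≤_
  (cong ∣_∣ (solve 4 (λ a b c d → a :* (b :- d) :+ d :* (a :- c) := a :* b :- c :* d)
    refl a b c d))
  (cong₂ _+_ (cancel B 0<B) (cancel C 0<C))
  (≤-trans (∣p+q∣≤∣p∣+∣q∣ (a * (b - d)) (d * (a - c)))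
    (+-mono-≤ (part a (b - d) a≤B b-d) (part d (a - c) d≤C a-c)))
  where
  cancel : ∀ D → 0ℚ < D → D * (h * inv D) ≡ h
  cancel D 0<D = trans
    (solve 3 (λ D h i → D :* (h :* i) := h :* (D :* i)) refl D h (inv D))
    (trans (cong (h *_) (inv-* 0<D)) (*-identityʳ h))
  part : ∀ a b {u v} → ∣ a ∣ ≤ u → ∣ b ∣ ≤ v → ∣ a * b ∣ ≤ u * v
  part a b {u} {v} a≤u b≤v = subst (_≤ u * v) (sym (∣p*q∣≡∣p∣*∣q∣ a b))
    (*-mono (0≤∣p∣ a) a≤u (0≤∣p∣ b) b≤v)

max₄ : (a b c d : ℕ) → ℕ
max₄ a b c d = (a ℕ.⊔ b) ℕ.⊔ (c ℕ.⊔ d)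

max₄-≥₁ : ∀ a b c d {n} → max₄ a b c d ℕ.≤ n → a ℕ.≤ n
max₄-≥₁ a b c d h = ℕₚ.m⊔n≤o⇒m≤o a b (ℕₚ.m⊔n≤o⇒m≤o (a ℕ.⊔ b) (c ℕ.⊔ d) h)

max₄-≥₂ : ∀ a b c d {n} → max₄ a b c d ℕ.≤ n → b ℕ.≤ n
max₄-≥₂ a b c d h = ℕₚ.m⊔n≤o⇒n≤o a b (ℕₚ.m⊔n≤o⇒m≤o (a ℕ.⊔ b) (c ℕ.⊔ d) h)

max₄-≥₃ : ∀ a b c d {n} → max₄ a b c d ℕ.≤ n → c ℕ.≤ n
max₄-≥₃ a b c d h = ℕₚ.m⊔n≤o⇒m≤o c d (ℕₚ.m⊔n≤o⇒n≤o (a ℕ.⊔ b) (c ℕ.⊔ d) h)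

max₄-≥₄ : ∀ a b c d {n} → max₄ a b c d ℕ.≤ n → d ℕ.≤ n
max₄-≥₄ a b c d h = ℕₚ.m⊔n≤o⇒n≤o c d (ℕₚ.m⊔n≤o⇒n≤o (a ℕ.⊔ b) (c ℕ.⊔ d) h)

_*ℝ_ : ℝ → ℝ → ℝ
x *ℝ y = mkℝ (λ n → seq x n * seq y n) cauchy*
  where
  cauchy* : IsCauchy (λ n → seq x n * seq y n)
  cauchy* δ 0<δ = N , λ m n N≤m N≤n → ≤-trans
    (*-dist {seq x m} {seq y m} {seq x n} {seq y n} {B} {C} {h} 0<B 0<C
      (bx m (≥₁ N≤m)) (by n (≥₂ N≤n)) (hx m n (≥₃ N≤m) (≥₃ N≤n)) (hy m n (≥₄ N≤m) (≥₄ N≤n)))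
    (≤-reflexive h+h≡δ)
    where
    halves = halve δ 0<δ
    h = proj₁ halves
    0<h = proj₁ (proj₂ halves)
    h+h≡δ = proj₂ (proj₂ halves)
    bounded-x = eventually-bounded {seq x} (cauchy x)
    bounded-y = eventually-bounded {seq y} (cauchy y)
    B = proj₁ bounded-x
    C = proj₁ bounded-y
    0<B = proj₁ (proj₂ bounded-x)
    0<C = proj₁ (proj₂ bounded-y)
    bx = proj₂ (proj₂ (proj₂ bounded-x))
    by = proj₂ (proj₂ (proj₂ bounded-y))
    close-x = cauchy x (h * inv C) (0<* {h} {inv C} 0<h (inv-pos {C} 0<C))
    close-y = cauchy y (h * inv B) (0<* {h} {inv B} 0<h (inv-pos {B} 0<B))
    hx = proj₂ close-x
    hy = proj₂ close-y
    N₁ = proj₁ (proj₂ (proj₂ bounded-x))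
    N₂ = proj₁ (proj₂ (proj₂ bounded-y))
    N₃ = proj₁ close-x
    N₄ = proj₁ close-y
    N = max₄ N₁ N₂ N₃ N₄
    ≥₁ = max₄-≥₁ N₁ N₂ N₃ N₄
    ≥₂ = max₄-≥₂ N₁ N₂ N₃ N₄
    ≥₃ = max₄-≥₃ N₁ N₂ N₃ N₄
    ≥₄ = max₄-≥₄ N₁ N₂ N₃ N₄

0<seq : ∀ {x} → 0ℝ <ℝ x → ∃ λ A → 0ℚ < A × ∃ λ N → ∀ n → N ℕ.≤ n → A ≤ seq x n
0<seq {x} (A , 0<A , N , h) = A , 0<A , N , λ n N≤n →
  subst (_≤ seq x n) (+-identityˡ A) (h n N≤n)

recip : (x : ℝ) → 0ℝ <ℝ x → ℝ
recip x 0<x = mkℝ (λ n → inv (seq x n)) cauchy⁻¹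
  where
  cauchy⁻¹ : IsCauchy (λ n → inv (seq x n))
  cauchy⁻¹ δ 0<δ with 0<seq {x} 0<x
  ... | A , 0<A , M , lo with cauchy x (δ * (A * A)) (0<* 0<δ (0<* 0<A 0<A))
  ... | N , hx = M ℕ.⊔ N , λ m n m≥ n≥ → ≤-trans
    (inv-lip 0<A (lo m (ℕₚ.m⊔n≤o⇒m≤o M N m≥)) (lo n (ℕₚ.m⊔n≤o⇒m≤o M N n≥)))
    (≤-trans
      (*-monoʳ-≤-nonNeg (inv A * inv A) {{nonNegative (<⇒≤ (0<* (inv-pos 0<A) (inv-pos 0<A)))}}
        (hx m n (ℕₚ.m⊔n≤o⇒n≤o M N m≥) (ℕₚ.m⊔n≤o⇒n≤o M N n≥)))
      (≤-reflexive (trans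
        (solve 3 (λ d a i → (d :* (a :* a)) :* (i :* i) := d :* ((a :* i) :* (a :* i)))
          refl δ A (inv A))
        (trans (cong (λ z → δ * (z * z)) (inv-* 0<A)) (*-identityʳ δ)))))

_÷ℝ_[_] : ℝ → (y : ℝ) → 0ℝ <ℝ y → ℝ
x ÷ℝ y [ 0<y ] = x *ℝ recip y 0<y

0<⊓ : ∀ {a b} → 0ℚ < a → 0ℚ < b → 0ℚ < a ⊓ b
0<⊓ {a} {b} 0<a 0<b with ⊓-sel a b
... | inj₁ eq = subst (0ℚ <_) (sym eq) 0<a
... | inj₂ eq = subst (0ℚ <_) (sym eq) 0<b

cancel-square : ∀ h A → 0ℚ < A → (h * (A * A)) * (inv A * inv A) ≡ h
cancel-square h A 0<A = trans
  (solve 3 (λ h a i → (h :* (a :* a)) :* (i :* i) := h :* ((a :* i) :* (a :* i))) refl h A (inv A))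
  (trans (cong (λ z → h * (z * z)) (inv-* 0<A)) (*-identityʳ h))

1/n*K≤ : ∀ {K η} n → 0ℚ < η → K * inv η ≤ fromℕ (suc n) → (+ 1 / suc n) * K ≤ η
1/n*K≤ {K} {η} n 0<η K/η≤n = subst₂ _≤_
  (trans (solve 4 (λ r k i e → r :* ((k :* i) :* e) := (r :* k) :* (e :* i)) refl r K (inv η) η)
    (trans (cong ((r * K) *_) (inv-* 0<η)) (*-identityʳ (r * K))))
  (trans (solve 3 (λ r n e → r :* (n :* e) := (n :* r) :* e) refl r (fromℕ (suc n)) η)
    (trans (cong (_* η) (fromℕ*1/ n)) (*-identityˡ η)))
  (*-monoˡ-≤-nonNeg r {{nonNegative (<⇒≤ (0<1/ n))}}
    (*-monoʳ-≤-nonNeg η {{nonNegative (<⇒≤ 0<η)}} K/η≤n))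
  where r = + 1 / suc n

-- log x is the integral of 1/t from 1 to x: its n-th approximation is the
-- left Riemann sum with n + 1 equal steps and endpoint the n-th
-- approximation of x.
log : (x : ℝ) → 0ℝ <ℝ x → ℝ
log x 0<x = mkℝ s cauchy-log
  where
  s : ℕ → ℚ
  s n = riemannSum inv 1ℚ (seq x n) (suc n)

  cauchy-log : IsCauchy s
  cauchy-log δ 0<δ = N , bound
    where
    halves = halve δ 0<δ
    h = proj₁ halves
    0<h = proj₁ (proj₂ halves)
    quarters = halve h 0<h
    η = proj₁ quarters
    0<η = proj₁ (proj₂ quarters)
    positive-x = 0<seq {x} 0<x
    A = proj₁ positive-x ⊓ 1ℚ
    0<A : 0ℚ < A
    0<A = 0<⊓ (proj₁ (proj₂ positive-x)) 0<1
    A≤1 : A ≤ 1ℚ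
    A≤1 = p⊓q≤q (proj₁ positive-x) 1ℚ
    A≤ : ∀ n → proj₁ (proj₂ (proj₂ positive-x)) ℕ.≤ n → A ≤ seq x n
    A≤ n n≥ = ≤-trans (p⊓q≤p (proj₁ positive-x) 1ℚ) (proj₂ (proj₂ (proj₂ positive-x)) n n≥)
    C = inv A * inv A
    0≤C : 0ℚ ≤ C
    0≤C = <⇒≤ (0<* {inv A} {inv A} (inv-pos {A} 0<A) (inv-pos {A} 0<A))
    bounded = eventually-bounded {seq (x -ℝ 1ℝ)} (cauchy (x -ℝ 1ℝ))
    E = proj₁ bounded
    K = E * E * C
    close = cauchy x (h * (A * A)) (0<* {h} {A * A} 0<h (0<* {A} {A} 0<A 0<A))
    large = archimedean (K * inv η)
    N₁ = proj₁ (proj₂ (proj₂ positive-x))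
    N₂ = proj₁ (proj₂ (proj₂ bounded))
    N₃ = proj₁ close
    N₄ = proj₁ large
    N = max₄ N₁ N₂ N₃ N₄

    small : ∀ n → N₄ ℕ.≤ n → (+ 1 / suc n) * K ≤ η
    small n n≥ = 1/n*K≤ {K} {η} n 0<η (≤-trans (proj₂ large) (fromℕ-mono (ℕₚ.m≤n⇒m≤1+n n≥)))

    bound : ∀ m n → N ℕ.≤ m → N ℕ.≤ n → ∣ s m - s n ∣ ≤ δ
    bound m n m≥ n≥ = ≤-trans (∣-∣-split (s m) (S y) (s n))
      (≤-trans
        (+-mono-≤ step₁ (≤-trans (∣-∣-split (S y) T (s n)) (+-mono-≤ step₂ step₃)))
        (≤-reflexive (trans (cong (λ z → h + z) (proj₂ (proj₂ quarters))) (proj₂ (proj₂ halves)))))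
      where
      r = + 1 / suc m
      q = + 1 / suc n
      y = seq x n
      S : ℚ → ℚ
      S z = leftSum inv 1ℚ z (suc m) r
      T = leftSum inv 1ℚ y (suc m ℕ.* suc n) (r * q)
      A≤y : A ≤ y
      A≤y = A≤ n (max₄-≥₁ N₁ N₂ N₃ N₄ n≥)
      y≤E : ∣ y - 1ℚ ∣ ≤ E
      y≤E = proj₂ (proj₂ (proj₂ bounded)) n (max₄-≥₂ N₁ N₂ N₃ N₄ n≥)
      0≤r : 0ℚ ≤ r
      0≤r = <⇒≤ (0<1/ m)
      0≤q : 0ℚ ≤ q
      0≤q = <⇒≤ (0<1/ n)
      step₁ : ∣ s m - S y ∣ ≤ h
      step₁ = ≤-trans
        (leftSum-lip {A} {seq x m} {y} {r} (suc m) 0≤r (fromℕ*1/ m) 0<A A≤1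
          (A≤ m (max₄-≥₁ N₁ N₂ N₃ N₄ m≥)) A≤y)
        (≤-trans
          (*-monoʳ-≤-nonNeg C {{nonNegative 0≤C}}
            (proj₂ close m n (max₄-≥₃ N₁ N₂ N₃ N₄ m≥) (max₄-≥₃ N₁ N₂ N₃ N₄ n≥)))
          (≤-reflexive (cancel-square h A 0<A)))
      step₂ : ∣ S y - T ∣ ≤ η
      step₂ = ≤-trans
        (leftSum-refine {A} {y} {r} {q} {E} (suc m) (suc n) 0≤r (fromℕ*1/ m) 0≤q (fromℕ*1/ n)
          0<A A≤1 A≤y y≤E)
        (small m (max₄-≥₄ N₁ N₂ N₃ N₄ m≥))
      step₃ : ∣ T - s n ∣ ≤ η
      step₃ = ≤-trans (≤-reflexive (trans (∣-∣-swap T (s n))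
          (cong (λ z → ∣ s n - z ∣) (leftSum-comm y r q (suc m) (suc n)))))
        (≤-trans
          (leftSum-refine {A} {y} {q} {r} {E} (suc n) (suc m) 0≤q (fromℕ*1/ n) 0≤r (fromℕ*1/ m)
            0<A A≤1 A≤y y≤E)
          (small n (max₄-≥₄ N₁ N₂ N₃ N₄ n≥)))

<⇒0<- : ∀ {x y} → x <ℝ y → 0ℝ <ℝ y -ℝ x
<⇒0<- {x} {y} (δ , 0<δ , N , h) = δ , 0<δ , N , λ n N≤n → 0≤-⇒≤ (subst (0ℚ ≤_)
  (solve 3 (λ a b d → b :- (a :+ d) := (b :- a) :- (con 0ℚ :+ d)) refl (seq x n) (seq y n) δ)
  (≤⇒0≤- (h n N≤n)))

0<log : ∀ x (0<x : 0ℝ <ℝ x) → 1ℝ <ℝ x → 0ℝ <ℝ log x 0<x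
0<log x 0<x (δ , 0<δ , N , h) = δ * inv (1ℚ + δ) , 0<* 0<δ (inv-pos 0<1+δ) , N ,
  λ n N≤n → subst (_≤ seq (log x 0<x) n) (sym (+-identityˡ _)) (lower n (h n N≤n))
  where
  0<1+δ : 0ℚ < 1ℚ + δ
  0<1+δ = +-mono-< 0<1 0<δ
  lower : ∀ n → 1ℚ + δ ≤ seq x n → δ * inv (1ℚ + δ) ≤ riemannSum inv 1ℚ (seq x n) (suc n)
  lower n 1+δ≤y = ≤-trans δ/[1+δ]≤ (subst (_≤ riemannSum inv 1ℚ y (suc n)) total (Σ-lower (suc n) term))
    where
    y = seq x n
    r = + 1 / suc n
    d = y - 1ℚ
    0≤r = <⇒≤ (0<1/ n)
    0<y = <-≤-trans 0<1+δ 1+δ≤y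
    0≤d : 0ℚ ≤ d
    0≤d = ≤⇒0≤- (≤-trans (subst (_≤ 1ℚ + δ) (+-identityʳ 1ℚ) (+-monoʳ-≤ 1ℚ (<⇒≤ 0<δ))) 1+δ≤y)
    total : fromℕ (suc n) * (inv y * (d * r)) ≡ inv y * d
    total = trans (solve 4 (λ n i d r → n :* (i :* (d :* r)) := (n :* r) :* (i :* d))
        refl (fromℕ (suc n)) (inv y) d r)
      (trans (cong (_* (inv y * d)) (fromℕ*1/ n)) (*-identityˡ _))
    term : ∀ k → k ℕ.< suc n → inv y * (d * r) ≤ inv (node y r k) * (d * r)
    term k k<n = *-monoʳ-≤-nonNeg (d * r) {{nonNegative (0≤* 0≤d 0≤r)}} (inv-anti {node y r k} {y}
      (<-≤-trans 0<1 (subst (_≤ node y r k) (+-identityʳ 1ℚ)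
        (+-monoʳ-≤ 1ℚ (0≤* (0≤fromℕ k) (0≤* 0≤d 0≤r)))))
      (0≤-⇒≤ {node y r k} {y} (subst (0ℚ ≤_) gap (0≤* 0≤d (≤⇒0≤- kr≤1)))))
      where
      kr≤1 : fromℕ k * r ≤ 1ℚ
      kr≤1 = subst (fromℕ k * r ≤_) (fromℕ*1/ n)
        (*-monoʳ-≤-nonNeg r {{nonNegative 0≤r}} (fromℕ-mono (ℕₚ.<⇒≤ k<n)))
      gap : d * (1ℚ - fromℕ k * r) ≡ y - node y r k
      gap = solve 3 (λ y k r → (y :- con 1ℚ) :* (con 1ℚ :- k :* r)
                            := y :- (con 1ℚ :+ k :* ((y :- con 1ℚ) :* r))) refl y (fromℕ k) r
    -- (y - 1)/y = 1 - 1/y, which increases with y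
    δ/[1+δ]≤ : δ * inv (1ℚ + δ) ≤ inv y * d
    δ/[1+δ]≤ = subst₂ _≤_ lhs rhs (+-monoʳ-≤ 1ℚ (neg-antimono-≤ (inv-anti 0<1+δ 1+δ≤y)))
      where
      lhs : 1ℚ - inv (1ℚ + δ) ≡ δ * inv (1ℚ + δ)
      lhs = trans (cong (_- inv (1ℚ + δ)) (sym (inv-* 0<1+δ)))
        (solve 2 (λ d i → (con 1ℚ :+ d) :* i :- i := d :* i) refl δ (inv (1ℚ + δ)))
      rhs : 1ℚ - inv y ≡ inv y * d
      rhs = trans (cong (_- inv y) (sym (inv-* 0<y)))
        (solve 2 (λ y i → y :* i :- i := i :* (y :- con 1ℚ)) refl y (inv y))

fromℚ-< : ∀ {p q} → p < q → fromℚ p <ℝ fromℚ q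
fromℚ-< {p} {q} p<q = q - p , subst (_< q - p) (+-inverseʳ p) (+-monoˡ-< (- p) p<q) , 0 ,
  λ _ _ → ≤-reflexive (solve 2 (λ p q → p :+ (q :- p) := q) refl p q)

infix 4 _≡_[mod_]

_≡_[mod_] : ℤ → ℤ → ℤ → Set
a ≡ b [mod n ] = n ∣ a ℤ.- b

-- The class of a lies in the unit group of ℤ/p.
IsUnitMod : ℕ → ℤ → Set
IsUnitMod p a = gcd a (+ p) ≡ 1ℤ

-- The unit group is finite, so natural powers of g exhaust the subgroup
-- that its class generates.
IsPrimitiveRoot : ℕ → ℤ → Set
IsPrimitiveRoot p g = IsUnitMod p g ×
  (∀ a → IsUnitMod p a → ∃ λ (k : ℕ) → (g ℤ.^ k) ≡ a [mod + p ])

IsQuadraticNonResidue : ℕ → ℤ → Set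
IsQuadraticNonResidue p g = IsUnitMod p g × ¬ (∃ λ (x : ℤ) → (x ℤ.* x) ≡ g [mod + p ])

IsQNRNP : ℕ → ℤ → Set
IsQNRNP p g = IsQuadraticNonResidue p g × ¬ IsPrimitiveRoot p g

-- The number of k with 1 ≤ k ≤ n that are coprime to n.
φ : ℕ → ℕ
φ n = length (filter (λ k → coprime? k n) (map suc (upTo n)))

prime⇒2≤ : ∀ {p} → Prime p → 2 ℕ.≤ p
prime⇒2≤ {p} (prime _) = ℕ.nonTrivial⇒n>1 p

φ[p-1]/[p-1] : ∀ p → Prime p → ℚ
φ[p-1]/[p-1] p p-prime =
  (+ φ (p ℕ.∸ 1) / (p ℕ.∸ 1)) {{ℕ.>-nonZero (ℕₚ.m<n⇒0<n∸m (prime⇒2≤ p-prime))}}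

1<fromℕ-prime : ∀ p → Prime p → 1ℝ <ℝ fromℚ (fromℕ p)
1<fromℕ-prime p p-prime = 1ℚ , 0<1 , 0 , λ _ _ → fromℕ-mono (prime⇒2≤ p-prime)

0<fromℕ-prime : ∀ p → Prime p → 0ℝ <ℝ fromℚ (fromℕ p)
0<fromℕ-prime p p-prime = fromℚ-< (<-≤-trans 0<1 (fromℕ-mono (ℕₚ.<⇒≤ (prime⇒2≤ p-prime))))

logPrime : ∀ p → Prime p → ℝ
logPrime p p-prime = log (fromℚ (fromℕ p)) (0<fromℕ-prime p p-prime)

loglogPrime : ∀ p → Prime p → ℝ
loglogPrime p p-prime = log (logPrime p p-prime)
  (0<log (fromℚ (fromℕ p)) (0<fromℕ-prime p p-prime) (1<fromℕ-prime p p-prime))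

log-6·83 : ℝ
log-6·83 = log (fromℚ (+ 683 / 100)) (fromℚ-< (positive⁻¹ (+ 683 / 100)))

module Submission where

-- Write n = p - 1 and let r be an odd prime divisor of n. If y is not a square mod p and z is a
-- unit, then g = (y z²)^r is not a square either, and g^(n/r) = 1, so g is a QNRNP. It is therefore
-- enough to find such a g in [1, n) coprime to n, and coprimality to n implies coprimality to (p-1)/q.
--
-- The elements y^r z^(2r) form a coset C of a subgroup of index 2r. For a set X of N residues, affine
-- maps being pairwise independent, the counts |C ∩ (uX + v)| have small variance over all (u, v). If
-- X + X + 1 missed C, then so would u X + u (x + 1) for every u = w^(2r) and x ∈ X, which contradicts
-- the variance bound as soon as n² N² > (2r)² p³. For X take the x < n/2 with x mod ℓ < ⌊ℓ/2⌋ for all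
-- primes ℓ | n (or a reflection): then X + X + 1 consists of integers coprime to n, and N is at least
-- n / (4 · 3^w), w being the number of odd prime divisors of n.
--
-- The bound on φ(n)/n forces Σ 1/ℓ > 1/12 over the odd prime divisors, hence some r ≤ 12 w, and
-- n ≥ (w + 2)! makes N large enough once n ≥ 2^128. The latter follows from the bound on log log p,
-- of which only the case ε = 1/11 is needed.

open import Data.Nat.Base as ℕ using (ℕ; zero; suc; z≤n; s≤s)
import Data.Nat.Properties as ℕₚ
import Data.Nat.Divisibility as ℕ∣
open import Data.Nat.Primality using (Prime)
open import Data.Nat.Tactic.RingSolver using () renaming (solve-∀ to ℕ-solve-∀)
open import Data.Product.Base using (Σ; ∃; _×_; _,_; proj₁; proj₂)
open import Data.Sum.Base using (_⊎_; inj₁; inj₂)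
open import Relation.Nullary using (¬_; Dec; yes; no; contradiction)
open import Relation.Nullary.Decidable using (toWitness)
open import Relation.Binary.PropositionalEquality hiding ([_])

-- The second moment over affine maps takes the place of character sum estimates: C enters only
-- through the numbers of solutions z of c z^e = t with e = 2r, and their variance rests on z^e = u
-- having at most e roots. The price is an average over all (u, v), while the claim concerns only u
-- = 1 and v = y + 1. Invariance of C under multiplication by e-th powers pays it: one failure
-- spreads to at least n N / e pairs (u, v), each off the mean by n N / p, whereas the total of the
-- squared deviations is at most N p n e. Hence (n N / e) (n N / p)² ≤ N p n e, which is n² N² ≤ e²
-- p³.
--
-- The shift in X + X + 1 lets the prime 2 be treated like the others: the cut-off ⌊2/2⌋ = 1 makes x
-- and y even, so x + y + 1 is odd. The bound x < n/2 keeps x + y + 1 below n, so the sieved integer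
-- itself is the wanted g, not merely a representative of its class.
--
-- The number 12 comes from φ(n)/n ≤ 9/22 < 5/12: the odd primes have to account for more than 1/2 -
-- 5/12 = 1/12.

module NumberTheory where

  open import Defs using (φ; prime⇒2≤; IsUnitMod; IsPrimitiveRoot; IsQNRNP)
  open import Data.Nat.Base using (NonZero; _!; ⌊_/2⌋; ⌈_/2⌉)
  open import Data.Nat.Coprimality as Coprimality using (Coprime; coprime?; coprime⇒gcd≡1; gcd≡1⇒coprime; prime⇒coprime)
  open import Data.Nat.DivMod using (m≡m%n+[m/n]*n; m%n<n)
  import Data.Nat.GCD as ℕGCD
  open import Data.Nat.ListAction using (product)
  open import Data.Nat.ListAction.Properties using (∈⇒∣product)
  open import Data.Nat.Primality using (prime; prime?; prime[2]; euclidsLemma; prime⇒nonZero; prime⇒irreducible)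
  open import Data.Nat.Primality.Factorisation using (factorise; factorisationHasAllPrimeFactors)
  open import Data.Integer.Base hiding (NonZero; suc; pred)
  open import Data.Integer.Properties
  open import Data.Integer.DivMod using (_%ℕ_; _/ℕ_; n%ℕd<d; a≡a%ℕn+[a/ℕn]*n)
  import Data.Integer.Divisibility.Signed as ℤ∣
  open import Data.Integer.Tactic.RingSolver using (solve-∀)
  open import Data.Fin.Base as Fin using (Fin; toℕ; fromℕ<; punchOut)
  import Data.Fin.Properties as Finₚ
  open import Data.Fin.Permutation using (permutation; reverse)
  open import Data.List.Base using (List; []; _∷_; length; replicate; map; filter; applyUpTo)
  import Data.List.Properties as Listₚ
  open import Data.List.Relation.Unary.All as All using (All; []; _∷_)
  import Data.List.Relation.Unary.All.Properties as Allₚ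
  open import Data.List.Relation.Unary.AllPairs as AllPairs using (AllPairs; []; _∷_)
  import Data.List.Relation.Unary.AllPairs.Properties as AllPairsₚ
  open import Data.List.Relation.Unary.Any as Any using (Any; here; there)
  open import Data.List.Membership.Propositional using (_∈_; find; lose)
  import Data.List.Membership.Propositional.Properties as ∈ₚ
  open import Function.Base using (_∘_)
  open import Function.Definitions using (Injective)
  open import Relation.Nullary.Decidable using (decidable-stable; _×-dec_; ¬?)
  open import Level using (Level)
  open import Algebra.Bundles using (CommutativeMonoid)
  import Algebra.Properties.CommutativeMonoid.Sum as MonoidSum
  import Algebra.Properties.Semiring.Sum

  -- Permutations of finite sets and congruences.

  module ℤSum = Algebra.Properties.Semiring.Sum (+-*-semiring)
  module ℤProduct = MonoidSum *-1-commutativeMonoid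

  -- A missed value could be punched out of the codomain, leaving an injection into a smaller set.
  injective⇒surjective : ∀ {n} {π : Fin n → Fin n} → Injective _≡_ _≡_ π → ∀ t → ∃ λ i → π i ≡ t
  injective⇒surjective {suc n} {π} inj t with Finₚ.any? (λ i → π i Finₚ.≟ t)
  ... | yes hit = hit
  ... | no miss = contradiction (Finₚ.injective⇒≤ punch-inj) ℕₚ.1+n≰n
    where
    punch-inj : Injective _≡_ _≡_ (λ i → punchOut {i = t} {π i} (λ eq → miss (i , sym eq)))
    punch-inj {i} {j} eq = inj (Finₚ.punchOut-injective {i = t} _ _ eq)

  module _ {c ℓ : Level} (M : CommutativeMonoid c ℓ) where
    open CommutativeMonoid M using (Carrier; _≈_)
    open MonoidSum M using (sum; sum-permute)

    sum-injection : ∀ {n} (π : Fin n → Fin n) → Injective _≡_ _≡_ π →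
                    (f : Fin n → Carrier) → sum f ≈ sum (λ i → f (π i))
    sum-injection π inj f = sum-permute f (permutation π (λ t → proj₁ (onto t)) (λ t → proj₂ (onto t))
      (λ i → inj (proj₂ (onto (π i)))))
      where onto = injective⇒surjective inj

  infix 4 _≈[_]_ _≈[_]?_

  -- The quotient is a field, so that matching on `by k refl` substitutes the congruence and turns
  -- each closure property into a ring identity.
  record _≈[_]_ (a : ℤ) (m : ℕ) (b : ℤ) : Set where
    constructor by
    field
      quotient : ℤ
      equality : a ≡ b + quotient * + m

  ≡⇒≈ : ∀ {m a b} → a ≡ b → a ≈[ m ] b
  ≡⇒≈ {b = b} refl = by 0ℤ (sym (+-identityʳ b))

  ≈-sym : ∀ {m a b} → a ≈[ m ] b → b ≈[ m ] a
  ≈-sym {m} {b = b} (by k refl) = by (- k) (solve b k (+ m))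
    where
    solve : ∀ b k m → b ≡ (b + k * m) + - k * m
    solve = solve-∀

  ≈-trans : ∀ {m a b c} → a ≈[ m ] b → b ≈[ m ] c → a ≈[ m ] c
  ≈-trans {m} {c = c} (by k refl) (by l refl) = by (k + l) (eq c k l (+ m))
    where
    eq : ∀ c k l m → (c + l * m) + k * m ≡ c + (k + l) * m
    eq = solve-∀

  ≈-+ : ∀ {m a b c d} → a ≈[ m ] b → c ≈[ m ] d → a + c ≈[ m ] b + d
  ≈-+ {m} {b = b} {d = d} (by k refl) (by l refl) = by (k + l) (eq b d k l (+ m))
    where
    eq : ∀ b d k l m → (b + k * m) + (d + l * m) ≡ (b + d) + (k + l) * m
    eq = solve-∀

  ≈-* : ∀ {m a b c d} → a ≈[ m ] b → c ≈[ m ] d → a * c ≈[ m ] b * d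
  ≈-* {m} {b = b} {d = d} (by k refl) (by l refl) = by (k * d + b * l + k * l * + m) (eq b d k l (+ m))
    where
    eq : ∀ b d k l m → (b + k * m) * (d + l * m) ≡ b * d + (k * d + b * l + k * l * m) * m
    eq = solve-∀

  ≈-*ˡ : ∀ {m c d} a → c ≈[ m ] d → a * c ≈[ m ] a * d
  ≈-*ˡ a = ≈-* {a = a} (≡⇒≈ refl)

  ≈-*ʳ : ∀ {m c d} a → c ≈[ m ] d → c * a ≈[ m ] d * a
  ≈-*ʳ a h = ≈-* {c = a} h (≡⇒≈ refl)

  ≈-+ˡ : ∀ {m c d} a → c ≈[ m ] d → a + c ≈[ m ] a + d
  ≈-+ˡ a = ≈-+ {a = a} (≡⇒≈ refl)

  ≈-+ʳ : ∀ {m c d} a → c ≈[ m ] d → c + a ≈[ m ] d + a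
  ≈-+ʳ a h = ≈-+ {c = a} h (≡⇒≈ refl)

  ≈-^ : ∀ {m a b} k → a ≈[ m ] b → a ^ k ≈[ m ] b ^ k
  ≈-^ zero    h = ≡⇒≈ refl
  ≈-^ (suc k) h = ≈-* h (≈-^ k h)

  ≈-cancel-+ʳ : ∀ {m a b} c → a + c ≈[ m ] b + c → a ≈[ m ] b
  ≈-cancel-+ʳ {m} {a} {b} c (by k eq) = by k (trans (l a c) (trans (cong (_- c) eq) (r b c k (+ m))))
    where
    l : ∀ a c → a ≡ (a + c) - c
    l = solve-∀
    r : ∀ b c k m → ((b + c) + k * m) - c ≡ b + k * m
    r = solve-∀

  ≈⇒-≈0 : ∀ {m a b} → a ≈[ m ] b → a - b ≈[ m ] 0ℤ
  ≈⇒-≈0 {m} {b = b} (by k refl) = by k (eq b k (+ m))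
    where
    eq : ∀ b k m → (b + k * m) - b ≡ 0ℤ + k * m
    eq = solve-∀

  -≈0⇒≈ : ∀ {m a b} → a - b ≈[ m ] 0ℤ → a ≈[ m ] b
  -≈0⇒≈ {m} {a} {b} h = ≈-cancel-+ʳ (- b) (≈-trans h (≡⇒≈ (sym (+-inverseʳ b))))

  ≈0⇔∣ : ∀ {m a} → (a ≈[ m ] 0ℤ → + m ℤ∣.∣ a) × (+ m ℤ∣.∣ a → a ≈[ m ] 0ℤ)
  ≈0⇔∣ {m} {a} = (λ { (by k eq) → ℤ∣.divides k (trans eq (+-identityˡ _)) }) ,
                 (λ { (ℤ∣.divides k eq) → by k (trans eq (sym (+-identityˡ _))) })

  ≈0⇒∣ᵤ : ∀ {m a} → a ≈[ m ] 0ℤ → m ℕ∣.∣ ∣ a ∣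
  ≈0⇒∣ᵤ h = ℤ∣.∣⇒∣ᵤ (proj₁ ≈0⇔∣ h)

  ∣ᵤ⇒≈0 : ∀ {m a} → m ℕ∣.∣ ∣ a ∣ → a ≈[ m ] 0ℤ
  ∣ᵤ⇒≈0 {m} {a} h = proj₂ ≈0⇔∣ (ℤ∣.∣ᵤ⇒∣ {+ m} {a} h)

  opaque
    _≈[_]?_ : ∀ a m b → Dec (a ≈[ m ] b)
    a ≈[ m ]? b with + m ℤ∣.∣? (a - b)
    ... | yes m∣ = yes (-≈0⇒≈ (proj₂ ≈0⇔∣ m∣))
    ... | no  m∤ = no (λ h → m∤ (proj₁ ≈0⇔∣ (≈⇒-≈0 h)))

  %ℕ-≈ : ∀ a m .{{_ : NonZero m}} → a ≈[ m ] + (a %ℕ m)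
  %ℕ-≈ a m = by (a /ℕ m) (a≡a%ℕn+[a/ℕn]*n a m)

  ≈⇒≡ : ∀ {m i j} → i ℕ.< m → j ℕ.< m → + i ≈[ m ] + j → i ≡ j
  ≈⇒≡ {m} {i} {j} i<m j<m h with ∣ i ⊖ j ∣ in eq
  ... | zero  = +-injective (m≡n+0 (∣i∣≡0⇒i≡0 eq))
    where
    m≡n+0 : i ⊖ j ≡ 0ℤ → + i ≡ + j
    m≡n+0 e = i-j≡0⇒i≡j (+ i) (+ j) (trans ([+m]-[+n]≡m⊖n i j) e)
  ... | suc d = contradiction
    (ℕ∣.∣⇒≤ (subst (m ℕ∣.∣_) (trans (cong ∣_∣ ([+m]-[+n]≡m⊖n i j)) eq) (≈0⇒∣ᵤ (≈⇒-≈0 h))))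
    (ℕₚ.<⇒≱ (subst (ℕ._< m) eq (ℕₚ.≤-<-trans (∣m⊝n∣≤m⊔n i j) (ℕₚ.⊔-lub i<m j<m))))

  euclid : ∀ {p a b} → Prime p → a * b ≈[ p ] 0ℤ → a ≈[ p ] 0ℤ ⊎ b ≈[ p ] 0ℤ
  euclid {p} {a} {b} p-prime h with euclidsLemma ∣ a ∣ ∣ b ∣ p-prime (subst (p ℕ∣.∣_) (abs-* a b) (≈0⇒∣ᵤ h))
  ... | inj₁ p∣a = inj₁ (∣ᵤ⇒≈0 p∣a)
  ... | inj₂ p∣b = inj₂ (∣ᵤ⇒≈0 p∣b)

  ≈-cancel-*ˡ : ∀ {p a b c} → Prime p → ¬ a ≈[ p ] 0ℤ → a * b ≈[ p ] a * c → b ≈[ p ] c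
  ≈-cancel-*ˡ {p} {a} {b} {c} p-prime a≉0 h
    with euclid {a = a} p-prime (≈-trans (≡⇒≈ (eq a b c)) (≈⇒-≈0 h))
    where
    eq : ∀ a b c → a * (b - c) ≡ a * b - a * c
    eq = solve-∀
  ... | inj₁ a≈0 = contradiction a≈0 a≉0
  ... | inj₂ b-c≈0 = -≈0⇒≈ b-c≈0

  ≉0-* : ∀ {p a b} → Prime p → ¬ a ≈[ p ] 0ℤ → ¬ b ≈[ p ] 0ℤ → ¬ a * b ≈[ p ] 0ℤ
  ≉0-* {a = a} p-prime a≉0 b≉0 h with euclid {a = a} p-prime h
  ... | inj₁ a≈0 = a≉0 a≈0
  ... | inj₂ b≈0 = b≉0 b≈0

  ≉0-^ : ∀ {p a} k → Prime p → ¬ a ≈[ p ] 0ℤ → ¬ a ^ k ≈[ p ] 0ℤ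
  ≉0-^ {p} zero p-prime@(prime _) a≉0 h =
    contradiction (ℕ∣.∣1⇒≡1 (≈0⇒∣ᵤ h)) (ℕₚ.>⇒≢ (ℕ.nonTrivial⇒n>1 p))
  ≉0-^ (suc k) p-prime a≉0 = ≉0-* p-prime a≉0 (≉0-^ k p-prime a≉0)

  0<k<m⇒≉0 : ∀ {m k} → 0 ℕ.< k → k ℕ.< m → ¬ + k ≈[ m ] 0ℤ
  0<k<m⇒≉0 {m} {suc k} 0<k k<m h = contradiction (≈⇒≡ k<m (ℕₚ.<-trans 0<k k<m) h) λ ()

  -- Finite integer sums, their reindexing, and indicators.

  opaque
    ∑ : ℕ → (ℕ → ℤ) → ℤ
    ∑ n f = ℤSum.sum {n} (λ i → f (toℕ i))

    ∑-zero : ∀ f → ∑ 0 f ≡ 0ℤ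
    ∑-zero f = refl

    ∑-suc : ∀ n f → ∑ (suc n) f ≡ f 0 + ∑ n (f ∘ suc)
    ∑-suc n f = refl

    ∑-cong : ∀ n {f g} → (∀ k → k ℕ.< n → f k ≡ g k) → ∑ n f ≡ ∑ n g
    ∑-cong n h = ℤSum.sum-cong-≗ {n} (λ i → h (toℕ i) (Finₚ.toℕ<n i))

    ∑-mono : ∀ n {f g} → (∀ k → k ℕ.< n → f k ≤ g k) → ∑ n f ≤ ∑ n g
    ∑-mono zero    h = ≤-refl
    ∑-mono (suc n) h = +-mono-≤ (h 0 (s≤s z≤n)) (∑-mono n (λ k k<n → h (suc k) (s≤s k<n)))

    ∑-distrib-+ : ∀ n f g → ∑ n (λ k → f k + g k) ≡ ∑ n f + ∑ n g
    ∑-distrib-+ n f g = ℤSum.∑-distrib-+ {n} (f ∘ toℕ) (g ∘ toℕ)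

    *-distribˡ-∑ : ∀ n c f → ∑ n (λ k → c * f k) ≡ c * ∑ n f
    *-distribˡ-∑ n c f = sym (ℤSum.*-distribˡ-sum {n} c (f ∘ toℕ))

    *-distribʳ-∑ : ∀ n c f → ∑ n (λ k → f k * c) ≡ ∑ n f * c
    *-distribʳ-∑ n c f = sym (ℤSum.*-distribʳ-sum {n} c (f ∘ toℕ))

    ∑-comm : ∀ m n (f : ℕ → ℕ → ℤ) → ∑ m (λ i → ∑ n (f i)) ≡ ∑ n (λ j → ∑ m (λ i → f i j))
    ∑-comm m n f = ℤSum.∑-comm {m} {n} (λ i j → f (toℕ i) (toℕ j))

  ∑-const : ∀ n c → ∑ n (λ _ → c) ≡ + n * c
  ∑-const zero    c = trans (∑-zero _) (sym (*-zeroˡ c))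
  ∑-const (suc n) c = trans (∑-suc n _) (trans (cong (λ z → c + z) (∑-const n c)) (sym (suc-* (+ n) c)))

  ∑-0 : ∀ n → ∑ n (λ _ → 0ℤ) ≡ 0ℤ
  ∑-0 n = trans (∑-const n 0ℤ) (*-zeroʳ (+ n))

  ∑-nonNeg : ∀ n {f} → (∀ k → k ℕ.< n → 0ℤ ≤ f k) → 0ℤ ≤ ∑ n f
  ∑-nonNeg n {f} h = subst (_≤ ∑ n f) (∑-0 n) (∑-mono n h)

  ∑-split : ∀ m n f → ∑ (m ℕ.+ n) f ≡ ∑ m f + ∑ n (λ k → f (m ℕ.+ k))
  ∑-split zero    n f = sym (trans (cong (_+ ∑ n f) (∑-zero f)) (+-identityˡ _))
  ∑-split (suc m) n f = trans (∑-suc (m ℕ.+ n) f) (trans (cong (λ z → f 0 + z) (∑-split m n (f ∘ suc)))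
    (trans (sym (+-assoc (f 0) _ _)) (cong (_+ ∑ n (λ k → f (suc m ℕ.+ k))) (sym (∑-suc m f)))))

  ∑-blocks : ∀ n m f → ∑ (n ℕ.* m) f ≡ ∑ n (λ k → ∑ m (λ j → f (k ℕ.* m ℕ.+ j)))
  ∑-blocks zero    m f = trans (∑-zero f) (sym (∑-zero _))
  ∑-blocks (suc n) m f = trans (∑-split m (n ℕ.* m) f) (trans (cong (λ z → ∑ m f + z)
    (trans (∑-blocks n m (λ k → f (m ℕ.+ k)))
      (∑-cong n (λ k _ → ∑-cong m (λ j _ → cong f (sym (ℕₚ.+-assoc m (k ℕ.* m) j)))))))
    (sym (∑-suc n _)))

  Periodic : ℕ → (ℤ → ℤ) → Set
  Periodic m f = ∀ {a b} → a ≈[ m ] b → f a ≡ f b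

  InjectiveMod : ℕ → (ℕ → ℤ) → Set
  InjectiveMod m σ = ∀ {i j} → i ℕ.< m → j ℕ.< m → σ i ≈[ m ] σ j → i ≡ j

  module _ (m : ℕ) .{{_ : NonZero m}} {σ : ℕ → ℤ} (inj : InjectiveMod m σ) where

    residue : Fin m → Fin m
    residue i = fromℕ< (n%ℕd<d (σ (toℕ i)) m)

    residue-≈ : ∀ i → σ (toℕ i) ≈[ m ] + toℕ (residue i)
    residue-≈ i = ≈-trans (%ℕ-≈ (σ (toℕ i)) m) (≡⇒≈ (cong +_ (sym (Finₚ.toℕ-fromℕ< (n%ℕd<d (σ (toℕ i)) m)))))

    residue-injective : Injective _≡_ _≡_ residue
    residue-injective {i} {j} eq = Finₚ.toℕ-injective (inj (Finₚ.toℕ<n i) (Finₚ.toℕ<n j)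
      (≈-trans (residue-≈ i) (≈-trans (≡⇒≈ (cong (+_ ∘ toℕ) eq)) (≈-sym (residue-≈ j)))))

  opaque
    unfolding ∑

    -- Reduced modulo m, σ is an injection of the m residues into themselves, hence a permutation;
    -- periodicity makes f blind to the reduction.
    ∑-reindex : ∀ m {f σ} → Periodic m f → InjectiveMod m σ → ∑ m (f ∘ σ) ≡ ∑ m (f ∘ +_)
    ∑-reindex zero _ _ = refl
    ∑-reindex m@(suc _) {f} {σ} per inj = trans
      (ℤSum.sum-cong-≗ {m} (λ i → per (residue-≈ m {σ} inj i)))
      (sym (sum-injection +-0-commutativeMonoid (residue m {σ} inj) (residue-injective m {σ} inj) (f ∘ +_ ∘ toℕ)))

  ∑-affine : ∀ {p a f} → Prime p → ¬ a ≈[ p ] 0ℤ → Periodic p f → ∀ c → ∑ p (λ k → f (a * + k + c)) ≡ ∑ p (f ∘ +_)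
  ∑-affine {p} {a} p-prime a≉0 per c = ∑-reindex p per
    (λ i<p j<p h → ≈⇒≡ i<p j<p (≈-cancel-*ˡ {a = a} p-prime a≉0 (≈-cancel-+ʳ c h)))

  ∑-translate : ∀ {m f} → Periodic m f → ∀ c → ∑ m (λ k → f (+ k + c)) ≡ ∑ m (f ∘ +_)
  ∑-translate {m} per c = ∑-reindex m per (λ i<m j<m h → ≈⇒≡ i<m j<m (≈-cancel-+ʳ c h))

  ∑-+-periodic : ∀ {m f} → Periodic m f → ∀ k → ∑ (k ℕ.* m) (f ∘ +_) ≡ + k * ∑ m (f ∘ +_)
  ∑-+-periodic {m} {f} per k = trans (∑-blocks k m (f ∘ +_)) (trans
    (∑-cong k (λ i _ → ∑-cong m (λ j _ → per {+ (i ℕ.* m ℕ.+ j)} {+ j} (by (+ i) (eq i j)))))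
    (∑-const k _))
    where
    eq : ∀ i j → + (i ℕ.* m ℕ.+ j) ≡ + j + + i * + m
    eq i j = trans (cong +_ (ℕₚ.+-comm (i ℕ.* m) j)) (cong (λ z → + j + z) (pos-* i m))

  [_] : ∀ {P : Set} → Dec P → ℤ
  [ yes _ ] = 1ℤ
  [ no  _ ] = 0ℤ

  []-cong : ∀ {P Q : Set} (P? : Dec P) (Q? : Dec Q) → (P → Q) → (Q → P) → [ P? ] ≡ [ Q? ]
  []-cong (yes _) (yes _) _ _ = refl
  []-cong (no _)  (no _)  _ _ = refl
  []-cong (yes p) (no ¬q) f _ = contradiction (f p) ¬q
  []-cong (no ¬p) (yes q) _ g = contradiction (g q) ¬p

  []-nonNeg : ∀ {P : Set} (P? : Dec P) → 0ℤ ≤ [ P? ]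
  []-nonNeg (yes _) = +≤+ z≤n
  []-nonNeg (no _)  = +≤+ z≤n

  []-true : ∀ {P : Set} (P? : Dec P) → P → [ P? ] ≡ 1ℤ
  []-true (yes _) _ = refl
  []-true (no ¬p) p = contradiction p ¬p

  []-false : ∀ {P : Set} (P? : Dec P) → ¬ P → [ P? ] ≡ 0ℤ
  []-false (yes p) ¬p = contradiction p ¬p
  []-false (no _) _ = refl

  ∑-δ : ∀ n t → t ℕ.< n → (f : ℕ → ℤ) → ∑ n (λ k → [ k ℕₚ.≟ t ] * f k) ≡ f t
  ∑-δ (suc n) zero t<n f = begin
    ∑ (suc n) (λ k → [ k ℕₚ.≟ 0 ] * f k) ≡⟨ ∑-suc n _ ⟩
    1ℤ * f 0 + ∑ n (λ k → 0ℤ * f (suc k)) ≡⟨ cong₂ _+_ (*-identityˡ (f 0)) (∑-cong n (λ k _ → *-zeroˡ (f (suc k)))) ⟩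
    f 0 + ∑ n (λ _ → 0ℤ)                  ≡⟨ cong (λ z → f 0 + z) (∑-0 n) ⟩
    f 0 + 0ℤ                              ≡⟨ +-identityʳ (f 0) ⟩
    f 0                                   ∎
    where open ≡-Reasoning
  ∑-δ (suc n) (suc t) (s≤s t<n) f = begin
    ∑ (suc n) (λ k → [ k ℕₚ.≟ suc t ] * f k) ≡⟨ ∑-suc n _ ⟩
    0ℤ * f 0 + ∑ n (λ k → [ suc k ℕₚ.≟ suc t ] * f (suc k)) ≡⟨ cong₂ _+_ (*-zeroˡ (f 0)) (∑-cong n (λ k _ →
      cong (_* f (suc k)) ([]-cong (suc k ℕₚ.≟ suc t) (k ℕₚ.≟ t) ℕₚ.suc-injective (cong suc)))) ⟩
    0ℤ + ∑ n (λ k → [ k ℕₚ.≟ t ] * f (suc k)) ≡⟨ +-identityˡ _ ⟩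
    ∑ n (λ k → [ k ℕₚ.≟ t ] * f (suc k))      ≡⟨ ∑-δ n t t<n (f ∘ suc) ⟩
    f (suc t)                                 ∎
    where open ≡-Reasoning

  -- Roots of polynomials, Fermat's theorem and a quadratic non-residue modulo p.

  1≉0 : ∀ {p} → Prime p → ¬ 1ℤ ≈[ p ] 0ℤ
  1≉0 p-prime@(prime _) h = contradiction (ℕ∣.∣1⇒≡1 (≈0⇒∣ᵤ h)) (ℕₚ.>⇒≢ (ℕ.nonTrivial⇒n>1 _))

  -- The monic polynomial with lower coefficients cs, constant term first.
  eval : List ℤ → ℤ → ℤ
  eval []       x = 1ℤ
  eval (c ∷ cs) x = x * eval cs x + c

  -- Synthetic division of c ∷ cs by x - a; the quotient does not depend on c.
  deflate : ℤ → List ℤ → List ℤ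
  deflate a []       = []
  deflate a (c ∷ cs) = eval (c ∷ cs) a ∷ deflate a cs

  length-deflate : ∀ a cs → length (deflate a cs) ≡ length cs
  length-deflate a []       = refl
  length-deflate a (c ∷ cs) = cong suc (length-deflate a cs)

  eval-deflate : ∀ a c cs x → eval (c ∷ cs) x ≡ eval (c ∷ cs) a + (x - a) * eval (deflate a cs) x
  eval-deflate a c [] x = eq a c x
    where
    eq : ∀ a c x → x * 1ℤ + c ≡ (a * 1ℤ + c) + (x - a) * 1ℤ
    eq = solve-∀
  eval-deflate a c (d ∷ cs) x = trans
    (cong (λ z → x * z + c) (eval-deflate a d cs x))
    (eq a c x (eval (d ∷ cs) a) (eval (deflate a cs) x))
    where
    eq : ∀ a c x P Q → x * (P + (x - a) * Q) + c ≡ (a * P + c) + (x - a) * (x * Q + P)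
    eq = solve-∀

  roots : ℕ → List ℤ → ℤ
  roots p cs = ∑ p (λ k → [ eval cs (+ k) ≈[ p ]? 0ℤ ])

  -- Lagrange's theorem. Dividing out a root t writes the polynomial as (x - t) times a quotient,
  -- and p being prime, every root other than t is a root of the quotient.
  roots≤degree : ∀ {p} → Prime p → ∀ d cs → length cs ≡ d → roots p cs ≤ + d
  roots≤degree {p} p-prime d cs len with Finₚ.any? {p} (λ i → eval cs (+ toℕ i) ≈[ p ]? 0ℤ)
  ... | no none = subst (_≤ + d) (sym (trans (∑-cong p no-root) (∑-0 p))) (+≤+ z≤n)
    where
    no-root : ∀ k → k ℕ.< p → [ eval cs (+ k) ≈[ p ]? 0ℤ ] ≡ 0ℤ
    no-root k k<p = []-false (eval cs (+ k) ≈[ p ]? 0ℤ) (λ h →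
      none (fromℕ< k<p , subst (λ k → eval cs (+ k) ≈[ p ] 0ℤ) (sym (Finₚ.toℕ-fromℕ< k<p)) h))
  roots≤degree {p} p-prime zero [] refl | yes (i , root) = contradiction root (1≉0 p-prime)
  roots≤degree {p} p-prime (suc d) (c ∷ cs) len | yes (i , root) = begin
    roots p (c ∷ cs) ≤⟨ ∑-mono p (λ k k<p → bound k k<p) ⟩
    ∑ p (λ k → [ k ℕₚ.≟ t ] * 1ℤ + [ eval Q (+ k) ≈[ p ]? 0ℤ ]) ≡⟨ ∑-distrib-+ p _ _ ⟩
    ∑ p (λ k → [ k ℕₚ.≟ t ] * 1ℤ) + roots p Q ≡⟨ cong (_+ roots p Q) (∑-δ p t (Finₚ.toℕ<n i) (λ _ → 1ℤ)) ⟩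
    1ℤ + roots p Q ≤⟨ +-monoʳ-≤ 1ℤ (roots≤degree p-prime d Q (trans (length-deflate (+ t) cs) (ℕₚ.suc-injective len))) ⟩
    + suc d ∎
    where
    open ≤-Reasoning
    t = toℕ i
    Q = deflate (+ t) cs
    bound : ∀ k → k ℕ.< p → [ eval (c ∷ cs) (+ k) ≈[ p ]? 0ℤ ] ≤ [ k ℕₚ.≟ t ] * 1ℤ + [ eval Q (+ k) ≈[ p ]? 0ℤ ]
    bound k k<p with eval (c ∷ cs) (+ k) ≈[ p ]? 0ℤ
    ... | no _ = +-mono-≤ (subst (0ℤ ≤_) (sym (*-identityʳ [ k ℕₚ.≟ t ])) ([]-nonNeg (k ℕₚ.≟ t)))
                          ([]-nonNeg (eval Q (+ k) ≈[ p ]? 0ℤ))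
    ... | yes h with euclid {a = + k - + t} {b = eval Q (+ k)} p-prime
                      (≈-cancel-+ʳ (eval (c ∷ cs) (+ t)) (≈-trans
                        (≡⇒≈ (trans (+-comm _ (eval (c ∷ cs) (+ t))) (sym (eval-deflate (+ t) c cs (+ k)))))
                        (≈-trans h (≈-sym (≈-trans (≡⇒≈ (+-identityˡ _)) root)))))
    ... | inj₁ k-t = +-mono-≤ (≤-reflexive (sym (trans (*-identityʳ _)
                       ([]-true (k ℕₚ.≟ t) (≈⇒≡ k<p (Finₚ.toℕ<n i) (-≈0⇒≈ k-t))))))
                       ([]-nonNeg (eval Q (+ k) ≈[ p ]? 0ℤ))
    ... | inj₂ q = +-mono-≤ (subst (0ℤ ≤_) (sym (*-identityʳ [ k ℕₚ.≟ t ])) ([]-nonNeg (k ℕₚ.≟ t)))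
                     (≤-reflexive (sym ([]-true (eval Q (+ k) ≈[ p ]? 0ℤ) q)))

  eval-replicate : ∀ e x → eval (replicate e 0ℤ) x ≡ x ^ e
  eval-replicate zero    x = refl
  eval-replicate (suc e) x = trans (+-identityʳ _) (cong (x *_) (eval-replicate e x))

  power-roots≤ : ∀ {p} → Prime p → ∀ e .{{_ : NonZero e}} u → ∑ p (λ k → [ (+ k) ^ e ≈[ p ]? u ]) ≤ + e
  power-roots≤ {p} p-prime (suc e) u = subst (_≤ + suc e)
    (∑-cong p (λ k _ → []-cong (eval cs (+ k) ≈[ p ]? 0ℤ) ((+ k) ^ suc e ≈[ p ]? u)
      (λ h → -≈0⇒≈ (≈-trans (≡⇒≈ (sym (expand (+ k)))) h))
      (λ h → ≈-trans (≡⇒≈ (expand (+ k))) (≈⇒-≈0 h))))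
    (roots≤degree p-prime (suc e) cs (cong suc (Listₚ.length-replicate e)))
    where
    cs = - u ∷ replicate e 0ℤ
    expand : ∀ x → eval cs x ≡ x ^ suc e - u
    expand x = cong (λ z → x * z - u) (eval-replicate e x)

  module _ {p : ℕ} (p-prime : Prime p) where
    open ℤProduct using () renaming (sum to ∏)

    ∏-≈ : ∀ {n} {f g : Fin n → ℤ} → (∀ i → f i ≈[ p ] g i) → ∏ f ≈[ p ] ∏ g
    ∏-≈ {zero}  h = ≡⇒≈ refl
    ∏-≈ {suc n} h = ≈-* (h Fin.zero) (∏-≈ (λ i → h (Fin.suc i)))

    ∏-*ˡ : ∀ {n} a (f : Fin n → ℤ) → ∏ (λ i → a * f i) ≡ a ^ n * ∏ f
    ∏-*ˡ {zero}  a f = refl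
    ∏-*ˡ {suc n} a f = trans (cong (λ z → a * f Fin.zero * z) (∏-*ˡ a (λ i → f (Fin.suc i)))) (eq a (f Fin.zero) (a ^ n) _)
      where
      eq : ∀ a x b y → a * x * (b * y) ≡ a * b * (x * y)
      eq = solve-∀

    ∏-≉0 : ∀ {n} {f : Fin n → ℤ} → (∀ i → ¬ f i ≈[ p ] 0ℤ) → ¬ ∏ f ≈[ p ] 0ℤ
    ∏-≉0 {zero}  h = 1≉0 p-prime
    ∏-≉0 {suc n} {f} h = ≉0-* {a = f Fin.zero} p-prime (h Fin.zero) (∏-≉0 (λ i → h (Fin.suc i)))

  -- Multiplication by a permutes the nonzero residues. Their product thus acquires the factor a^n
  -- without changing, and being nonzero it cancels.
  fermat : ∀ {n a} → Prime (suc n) → ¬ a ≈[ suc n ] 0ℤ → a ^ n ≈[ suc n ] 1ℤ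
  fermat {n} {a} p-prime a≉0 = ≈-cancel-*ˡ {a = ∏ w} p-prime
    (∏-≉0 p-prime (λ i → 0<k<m⇒≉0 (s≤s z≤n) (s≤s (Finₚ.toℕ<n i))))
    (≈-trans (≡⇒≈ (trans (*-comm (∏ w) (a ^ n)) (sym (∏-*ˡ p-prime a w))))
    (≈-trans (∏-≈ p-prime (λ i → ≈-sym (shifted i)))
    (≡⇒≈ (sym (trans (*-identityʳ (∏ w)) (trans (sym (*-identityˡ (∏ w)))
      (trans (sum-injection *-1-commutativeMonoid π (residue-injective p {σ} inj) (unit ∘ toℕ))
        (trans (cong (_* ∏ (unit ∘ toℕ ∘ π ∘ Fin.suc)) first) (*-identityˡ _)))))))))
    where
    open ℤProduct using () renaming (sum to ∏)
    p = suc n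
    w : Fin n → ℤ
    w i = + suc (toℕ i)
    -- 0 is replaced by 1 so that multiplication by a permutes all of ℤ/p.
    unit : ℕ → ℤ
    unit zero    = 1ℤ
    unit (suc k) = + suc k
    σ : ℕ → ℤ
    σ k = a * + k
    inj : InjectiveMod p σ
    inj i<p j<p h = ≈⇒≡ i<p j<p (≈-cancel-*ˡ {a = a} p-prime a≉0 h)
    π = residue p {σ} inj
    unit-≉0 : ∀ k → ¬ + k ≈[ p ] 0ℤ → unit k ≡ + k
    unit-≉0 zero    h = contradiction (≡⇒≈ refl) h
    unit-≉0 (suc k) h = refl
    first : unit (toℕ (π Fin.zero)) ≡ 1ℤ
    first = cong unit (≈⇒≡ (Finₚ.toℕ<n (π Fin.zero)) (s≤s z≤n)
      (≈-trans (≈-sym (residue-≈ p {σ} inj Fin.zero)) (≡⇒≈ (*-zeroʳ a))))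
    shifted : ∀ i → unit (toℕ (π (Fin.suc i))) ≈[ p ] a * w i
    shifted i = ≈-trans (≡⇒≈ (unit-≉0 _ (λ h → ≉0-* {a = a} p-prime a≉0
        (0<k<m⇒≉0 (s≤s z≤n) (s≤s (Finₚ.toℕ<n i))) (≈-trans (residue-≈ p {σ} inj (Fin.suc i)) h))))
      (≈-sym (residue-≈ p {σ} inj (Fin.suc i)))

  inverse : ∀ {p a} → Prime p → ¬ a ≈[ p ] 0ℤ → ∃ λ b → a * b ≈[ p ] 1ℤ
  inverse {zero}     p-prime _ = contradiction (prime⇒2≤ p-prime) λ ()
  inverse {suc zero} p-prime _ = contradiction (prime⇒2≤ p-prime) λ { (s≤s ()) }
  inverse {suc (suc n)} {a} p-prime a≉0 = a ^ n , fermat p-prime a≉0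

  -- A choice of square roots for all residues would be injective, since squaring undoes it, hence
  -- surjective. Then 1 and -1 would both be chosen roots, and of the same residue, which forces 1 =
  -- -1.
  nonsquare : ∀ {p} → Prime p → 2 ℕ.< p → ∃ λ y → ∀ x → ¬ x * x ≈[ p ] y
  nonsquare {suc zero} _ (s≤s ())
  nonsquare {p@(suc (suc n))} p-prime 2<p = + toℕ t , λ x h → proj₂ found (fromℕ< (n%ℕd<d x p) ,
    subst (λ k → + k * + k ≈[ p ] + toℕ t) (sym (Finₚ.toℕ-fromℕ< (n%ℕd<d x p)))
      (≈-trans (≈-* (≈-sym (%ℕ-≈ x p)) (≈-sym (%ℕ-≈ x p))) h))
    where
    not-all : ¬ (∀ t → ∃ λ (x : Fin p) → + toℕ x * + toℕ x ≈[ p ] + toℕ t)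
    not-all sqrt = contradiction (trans (sym (proj₂ (at one)))
        (trans (cong root same) (proj₂ (at minus-one)))) distinct
      where
      root : Fin p → Fin p
      root t = proj₁ (sqrt t)
      root-injective : Injective _≡_ _≡_ root
      root-injective {s} {t} eq = Finₚ.toℕ-injective (≈⇒≡ (Finₚ.toℕ<n s) (Finₚ.toℕ<n t)
        (≈-trans (≈-sym (proj₂ (sqrt s))) (≈-trans (≡⇒≈ (cong (λ i → + toℕ i * + toℕ i) eq)) (proj₂ (sqrt t)))))
      at = injective⇒surjective root-injective
      one minus-one : Fin p
      one = Fin.suc Fin.zero
      minus-one = Fin.fromℕ (suc n)
      same : proj₁ (at one) ≡ proj₁ (at minus-one)
      same = Finₚ.toℕ-injective (≈⇒≡ (Finₚ.toℕ<n (proj₁ (at one))) (Finₚ.toℕ<n (proj₁ (at minus-one)))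
        (≈-trans (≈-sym (proj₂ (sqrt _))) (≈-trans (≡⇒≈ (cong (λ i → + toℕ i * + toℕ i) (proj₂ (at one))))
        (≈-trans (by (- (+ n)) squares)
        (≈-trans (≡⇒≈ (cong (λ i → + toℕ i * + toℕ i) (sym (proj₂ (at minus-one))))) (proj₂ (sqrt _)))))))
        where
        alg : ∀ n → 1ℤ ≡ (1ℤ + n) * (1ℤ + n) + - n * (1ℤ + (1ℤ + n))
        alg = solve-∀
        squares : 1ℤ ≡ + toℕ minus-one * + toℕ minus-one + - (+ n) * + p
        squares = trans (alg (+ n)) (cong (λ k → + k * + k + - (+ n) * + p) (sym (Finₚ.toℕ-fromℕ (suc n))))
      distinct : ¬ one ≡ minus-one
      distinct eq = ℕₚ.<⇒≢ (ℕₚ.≤-pred 2<p) (trans (cong toℕ eq) (Finₚ.toℕ-fromℕ (suc n)))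
    found = Finₚ.¬∀⟶∃¬ p (λ t → ∃ λ (x : Fin p) → + toℕ x * + toℕ x ≈[ p ] + toℕ t)
      (λ t → Finₚ.any? (λ x → + toℕ x * + toℕ x ≈[ p ]? + toℕ t)) not-all
    t = proj₁ found

  -- The second moment of a coset count over all affine maps.

  ∑-≥0-shrink : ∀ {m n f} → m ℕ.≤ n → (∀ k → k ℕ.< n → 0ℤ ≤ f k) → ∑ m f ≤ ∑ n f
  ∑-≥0-shrink {m} {n} {f} m≤n f≥0 = subst (∑ m f ≤_)
    (trans (sym (∑-split m (n ℕ.∸ m) f)) (cong (λ k → ∑ k f) (ℕₚ.m+[n∸m]≡n m≤n)))
    (subst (_≤ ∑ m f + ∑ (n ℕ.∸ m) (λ k → f (m ℕ.+ k))) (+-identityʳ _) (+-monoʳ-≤ (∑ m f)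
      (∑-nonNeg (n ℕ.∸ m) (λ k k< → f≥0 (m ℕ.+ k) (subst (m ℕ.+ k ℕ.<_) (ℕₚ.m+[n∸m]≡n m≤n) (ℕₚ.+-monoʳ-< m k<))))))

  ∑-*-∑ : ∀ m n f g → ∑ m f * ∑ n g ≡ ∑ m (λ i → ∑ n (λ j → f i * g j))
  ∑-*-∑ m n f g = trans (sym (*-distribʳ-∑ m (∑ n g) f)) (∑-cong m (λ i _ → sym (*-distribˡ-∑ n (f i) g)))

  square-nonNeg : ∀ i → 0ℤ ≤ i * i
  square-nonNeg (+ k)    = subst (0ℤ ≤_) (pos-* k k) (+≤+ z≤n)
  square-nonNeg -[1+ k ] = +≤+ z≤n

  *-mono-≤-nonNeg : ∀ {a b c d} → 0ℤ ≤ a → a ≤ b → 0ℤ ≤ c → c ≤ d → a * c ≤ b * d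
  *-mono-≤-nonNeg {a} {b} {c} {d} 0≤a a≤b 0≤c c≤d = ≤-trans
    (*-monoʳ-≤-nonNeg c {{nonNegative 0≤c}} a≤b)
    (*-monoˡ-≤-nonNeg b {{nonNegative (≤-trans 0≤a a≤b)}} c≤d)

  ∑-≈-select : ∀ p .{{_ : NonZero p}} u {g} → Periodic p g →
               ∑ p (λ t → [ u ≈[ p ]? + t ] * g (+ t)) ≡ g u
  ∑-≈-select p u {g} per = trans
    (∑-cong p (λ t t<p → cong (_* g (+ t)) ([]-cong (u ≈[ p ]? + t) (t ℕₚ.≟ u %ℕ p)
      (λ h → ≈⇒≡ t<p (n%ℕd<d u p) (≈-trans (≈-sym h) (%ℕ-≈ u p)))
      (λ eq → ≈-trans (%ℕ-≈ u p) (≡⇒≈ (cong +_ (sym eq)))))))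
    (trans (∑-δ p (u %ℕ p) (n%ℕd<d u p) (g ∘ +_)) (per (≈-sym (%ℕ-≈ u p))))

  module _ {p m : ℕ} (p-prime : Prime p) (m≤p : m ℕ.≤ p) where

    opaque
      -- The total F-weight of the image of the weighted set a under x ↦ u x + v. With a the
      -- indicator of X and F the `excess` below, it is p times the deviation of a count from its
      -- mean.
      dispersion : (ℕ → ℤ) → (ℤ → ℤ) → ℤ → ℤ → ℤ
      dispersion a F u v = ∑ m (λ x → a x * F (u * + x + v))

      dispersion-def : ∀ a F u v → dispersion a F u v ≡ ∑ m (λ x → a x * F (u * + x + v))
      dispersion-def a F u v = refl

    module _ (a : ℕ → ℤ) {F : ℤ → ℤ} (per : Periodic p F) (mean-zero : ∑ p (F ∘ +_) ≡ 0ℤ) where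
      open ≡-Reasoning

      energy : ℤ
      energy = ∑ p (λ t → F (+ t) * F (+ t))

      -- For x ≠ y the map (u, v) ↦ (u x + v, u y + v) is a bijection of (ℤ/p)².
      correlation : ∀ x y → x ℕ.< m → y ℕ.< m →
        ∑ p (λ u → ∑ p (λ v → F (+ u * + x + + v) * F (+ u * + y + + v))) ≡ [ y ℕₚ.≟ x ] * (+ p * energy)
      correlation x y x<m y<m with y ℕₚ.≟ x
      ... | yes refl = begin
        ∑ p (λ u → ∑ p (λ v → F (+ u * + x + + v) * F (+ u * + x + + v)))
          ≡⟨ ∑-cong p (λ u _ → trans
               (∑-cong p (λ v _ → cong (λ t → F t * F t) (+-comm (+ u * + x) (+ v))))
               (∑-translate {p} {λ t → F t * F t} (λ h → cong₂ _*_ (per h) (per h)) (+ u * + x))) ⟩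
        ∑ p (λ u → energy)     ≡⟨ ∑-const p energy ⟩
        + p * energy           ≡⟨ *-identityˡ (+ p * energy) ⟨
        1ℤ * (+ p * energy)    ∎
      ... | no y≢x = begin
        ∑ p (λ u → ∑ p (λ v → F (+ u * + x + + v) * F (+ u * + y + + v)))
          ≡⟨ ∑-cong p (λ u _ → trans
               (∑-cong p (λ v _ → cong₂ (λ s t → F s * F t) (+-comm (+ u * + x) (+ v)) (shear (+ u) (+ v) (+ x) (+ y))))
               (∑-translate {p} {λ t → F t * F (d * + u + t)}
                 (λ h → cong₂ _*_ (per h) (per (≈-+ˡ (d * + u) h))) (+ u * + x))) ⟩
        ∑ p (λ u → ∑ p (λ v → F (+ v) * F (d * + u + + v)))
          ≡⟨ ∑-comm p p _ ⟩
        ∑ p (λ v → ∑ p (λ u → F (+ v) * F (d * + u + + v)))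
          ≡⟨ ∑-cong p (λ v _ → trans (*-distribˡ-∑ p (F (+ v)) _) (trans
               (cong (F (+ v) *_) (trans (∑-affine {a = d} p-prime d≉0 per (+ v)) mean-zero))
               (*-zeroʳ (F (+ v))))) ⟩
        ∑ p (λ v → 0ℤ)
          ≡⟨ ∑-0 p ⟩
        0ℤ ∎
        where
        d = + y - + x
        d≉0 : ¬ d ≈[ p ] 0ℤ
        d≉0 h = y≢x (≈⇒≡ (ℕₚ.<-≤-trans y<m m≤p) (ℕₚ.<-≤-trans x<m m≤p) (-≈0⇒≈ h))
        shear : ∀ u v x y → u * y + v ≡ (y - x) * u + (v + u * x)
        shear = solve-∀

      -- Pairwise independence: expanding the square yields correlations over pairs (x, y), and
      -- those off the diagonal vanish because F has mean zero.
      variance : ∑ p (λ u → ∑ p (λ v → dispersion a F (+ u) (+ v) * dispersion a F (+ u) (+ v)))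
                 ≡ ∑ m (λ x → a x * a x) * (+ p * energy)
      variance = begin
        ∑ p (λ u → ∑ p (λ v → dispersion a F (+ u) (+ v) * dispersion a F (+ u) (+ v)))
          ≡⟨ ∑-cong p (λ u _ → ∑-cong p (λ v _ → trans
               (trans (cong (λ z → z * z) (dispersion-def a F (+ u) (+ v))) (∑-*-∑ m m _ _))
               (∑-cong m (λ x _ → ∑-cong m (λ y _ → regroup (a x) (F (+ u * + x + + v)) (a y) (F (+ u * + y + + v))))))) ⟩
        ∑ p (λ u → ∑ p (λ v → ∑ m (λ x → ∑ m (λ y → term x y u v))))
          ≡⟨ ∑-cong p (λ u _ → trans (∑-comm p m _) (∑-cong m (λ x _ → ∑-comm p m _))) ⟩
        ∑ p (λ u → ∑ m (λ x → ∑ m (λ y → ∑ p (λ v → term x y u v))))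
          ≡⟨ trans (∑-comm p m _) (∑-cong m (λ x _ → ∑-comm p m _)) ⟩
        ∑ m (λ x → ∑ m (λ y → ∑ p (λ u → ∑ p (λ v → term x y u v))))
          ≡⟨ ∑-cong m (λ x x<m → ∑-cong m (λ y y<m → trans
               (trans (∑-cong p (λ u _ → *-distribˡ-∑ p (a x * a y) _)) (*-distribˡ-∑ p (a x * a y) _))
               (trans (cong (a x * a y *_) (correlation x y x<m y<m))
                 (swap (a x * a y) [ y ℕₚ.≟ x ] (+ p * energy))))) ⟩
        ∑ m (λ x → ∑ m (λ y → [ y ℕₚ.≟ x ] * (a x * a y * (+ p * energy))))
          ≡⟨ ∑-cong m (λ x x<m → ∑-δ m x x<m (λ y → a x * a y * (+ p * energy))) ⟩
        ∑ m (λ x → a x * a x * (+ p * energy))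
          ≡⟨ *-distribʳ-∑ m (+ p * energy) _ ⟩
        ∑ m (λ x → a x * a x) * (+ p * energy) ∎
        where
        term : ℕ → ℕ → ℕ → ℕ → ℤ
        term x y u v = a x * a y * (F (+ u * + x + + v) * F (+ u * + y + + v))
        regroup : ∀ a s b t → (a * s) * (b * t) ≡ a * b * (s * t)
        regroup = solve-∀
        swap : ∀ a i e → a * (i * e) ≡ i * (a * e)
        swap = solve-∀

  module _ {n e : ℕ} .{{_ : NonZero e}} (p-prime : Prime (suc n)) where
    private
      p = suc n

    -- Each residue is an e-th power in at most e ways. The value of H at 0^e is added to complete
    -- the range of w, which is harmless as H is nonnegative.
    ∑-power≤ : ∀ {H} → Periodic p H → (∀ u → 0ℤ ≤ H u) → ∑ n (λ w → H ((+ suc w) ^ e)) ≤ + e * ∑ p (H ∘ +_)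
    ∑-power≤ {H} per H≥0 = begin
      ∑ n (λ w → H ((+ suc w) ^ e))
        ≡⟨ +-identityˡ _ ⟨
      0ℤ + ∑ n (λ w → H ((+ suc w) ^ e))
        ≤⟨ +-monoˡ-≤ _ (H≥0 (0ℤ ^ e)) ⟩
      H (0ℤ ^ e) + ∑ n (λ w → H ((+ suc w) ^ e))
        ≡⟨ ∑-suc n (λ w → H ((+ w) ^ e)) ⟨
      ∑ p (λ w → H ((+ w) ^ e))
        ≡⟨ ∑-cong p (λ w _ → sym (∑-≈-select p ((+ w) ^ e) per)) ⟩
      ∑ p (λ w → ∑ p (λ u → [ (+ w) ^ e ≈[ p ]? + u ] * H (+ u)))
        ≡⟨ ∑-comm p p _ ⟩
      ∑ p (λ u → ∑ p (λ w → [ (+ w) ^ e ≈[ p ]? + u ] * H (+ u)))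
        ≡⟨ ∑-cong p (λ u _ → *-distribʳ-∑ p (H (+ u)) _) ⟩
      ∑ p (λ u → ∑ p (λ w → [ (+ w) ^ e ≈[ p ]? + u ]) * H (+ u))
        ≤⟨ ∑-mono p (λ u _ → *-monoʳ-≤-nonNeg (H (+ u)) {{nonNegative (H≥0 (+ u))}} (power-roots≤ p-prime e (+ u))) ⟩
      ∑ p (λ u → + e * H (+ u))
        ≡⟨ *-distribˡ-∑ p (+ e) (H ∘ +_) ⟩
      + e * ∑ p (H ∘ +_) ∎
      where open ≤-Reasoning

    module _ (c : ℤ) (c≉0 : ¬ c ≈[ p ] 0ℤ) where

      opaque
        -- Solutions z are counted, instead of membership in the coset being tested, so that the
        -- total over t is exactly n whatever the number of e-th roots of unity.
        representations : ℤ → ℤ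
        representations t = ∑ n (λ z → [ c * (+ suc z) ^ e ≈[ p ]? t ])

        representations-def : ∀ t → representations t ≡ ∑ n (λ z → [ c * (+ suc z) ^ e ≈[ p ]? t ])
        representations-def t = refl

      representations-periodic : Periodic p representations
      representations-periodic {s} {t} h = trans (representations-def s) (trans
        (∑-cong n (λ z _ → []-cong (_ ≈[ p ]? s) (_ ≈[ p ]? t) (λ k → ≈-trans k h) (λ k → ≈-trans k (≈-sym h))))
        (sym (representations-def t)))

      ∑-representations : ∀ {g} → Periodic p g →
        ∑ p (λ t → representations (+ t) * g (+ t)) ≡ ∑ n (λ z → g (c * (+ suc z) ^ e))
      ∑-representations {g} per = begin
        ∑ p (λ t → representations (+ t) * g (+ t))
          ≡⟨ ∑-cong p (λ t _ → trans (cong (_* g (+ t)) (representations-def (+ t))) (sym (*-distribʳ-∑ n (g (+ t)) _))) ⟩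
        ∑ p (λ t → ∑ n (λ z → [ c * (+ suc z) ^ e ≈[ p ]? + t ] * g (+ t)))
          ≡⟨ ∑-comm p n _ ⟩
        ∑ n (λ z → ∑ p (λ t → [ c * (+ suc z) ^ e ≈[ p ]? + t ] * g (+ t)))
          ≡⟨ ∑-cong n (λ z _ → ∑-≈-select p (c * (+ suc z) ^ e) per) ⟩
        ∑ n (λ z → g (c * (+ suc z) ^ e)) ∎
        where open ≡-Reasoning

      ∑-representations-1 : ∑ p (representations ∘ +_) ≡ + n
      ∑-representations-1 = trans (∑-cong p (λ t _ → sym (*-identityʳ _)))
        (trans (∑-representations (λ _ → refl)) (trans (∑-const n 1ℤ) (*-identityʳ (+ n))))

      representations≤ : ∀ z → representations (c * (+ suc z) ^ e) ≤ + e
      representations≤ z = begin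
        representations (c * (+ suc z) ^ e)
          ≡⟨ representations-def _ ⟩
        ∑ n (λ y → [ c * (+ suc y) ^ e ≈[ p ]? c * (+ suc z) ^ e ])
          ≡⟨ ∑-cong n (λ y _ → []-cong (c * (+ suc y) ^ e ≈[ p ]? c * (+ suc z) ^ e) ((+ suc y) ^ e ≈[ p ]? (+ suc z) ^ e)
               (≈-cancel-*ˡ {a = c} p-prime c≉0) (≈-*ˡ c)) ⟩
        ∑ n (λ y → [ (+ suc y) ^ e ≈[ p ]? (+ suc z) ^ e ])
          ≡⟨ +-identityˡ _ ⟨
        0ℤ + ∑ n (λ y → [ (+ suc y) ^ e ≈[ p ]? (+ suc z) ^ e ])
          ≤⟨ +-monoˡ-≤ _ ([]-nonNeg ((+ 0) ^ e ≈[ p ]? (+ suc z) ^ e)) ⟩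
        [ (+ 0) ^ e ≈[ p ]? (+ suc z) ^ e ] + ∑ n (λ y → [ (+ suc y) ^ e ≈[ p ]? (+ suc z) ^ e ])
          ≡⟨ ∑-suc n _ ⟨
        ∑ p (λ y → [ (+ y) ^ e ≈[ p ]? (+ suc z) ^ e ])
          ≤⟨ power-roots≤ p-prime e ((+ suc z) ^ e) ⟩
        + e ∎
        where open ≤-Reasoning

      -- Read as a sum over z, the second moment adds up the numbers of representations of c z^e,
      -- each of which is at most e.
      ∑-representations² : ∑ p (λ t → representations (+ t) * representations (+ t)) ≤ + n * + e
      ∑-representations² = begin
        ∑ p (λ t → representations (+ t) * representations (+ t))
          ≡⟨ ∑-representations representations-periodic ⟩
        ∑ n (λ z → representations (c * (+ suc z) ^ e))
          ≤⟨ ∑-mono n (λ z _ → representations≤ z) ⟩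
        ∑ n (λ z → + e)
          ≡⟨ ∑-const n (+ e) ⟩
        + n * + e ∎
        where open ≤-Reasoning

      opaque
        -- The deviation of `representations` from its mean n / p, scaled by p to remain an integer.
        excess : ℤ → ℤ
        excess t = + p * representations t - + n

        excess-def : ∀ t → excess t ≡ + p * representations t - + n
        excess-def t = refl

      excess-periodic : Periodic p excess
      excess-periodic {s} {t} h = trans (excess-def s)
        (trans (cong (λ r → + p * r - + n) (representations-periodic h)) (sym (excess-def t)))

      excess-unrepresented : ∀ t → (∀ z → z ℕ.< n → ¬ c * (+ suc z) ^ e ≈[ p ] t) → excess t ≡ - + n
      excess-unrepresented t none = trans (excess-def t) (trans
        (cong (λ r → + p * r - + n) (trans (representations-def t)
          (trans (∑-cong n (λ z z<n → []-false (c * (+ suc z) ^ e ≈[ p ]? t) (none z z<n))) (∑-0 n))))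
        (trans (cong (_- + n) (*-zeroʳ (+ p))) (+-identityˡ (- + n))))

      ∑-excess : ∑ p (excess ∘ +_) ≡ 0ℤ
      ∑-excess = trans (trans (∑-cong p (λ t _ → excess-def (+ t))) (∑-distrib-+ p _ _)) (trans
        (cong₂ _+_ (trans (*-distribˡ-∑ p (+ p) _) (cong (+ p *_) ∑-representations-1)) (∑-const p (- + n)))
        (cancel (+ p) (+ n)))
        where
        cancel : ∀ p n → p * n + p * - n ≡ 0ℤ
        cancel = solve-∀

      -- A variance is at most the second moment: the cross term and the constant term together give
      -- - p n², which is dropped.
      ∑-excess² : ∑ p (λ t → excess (+ t) * excess (+ t)) ≤ + p * + p * (+ n * + e)
      ∑-excess² = begin
        ∑ p (λ t → excess (+ t) * excess (+ t))
          ≡⟨ ∑-cong p (λ t _ → trans (cong (λ z → z * z) (excess-def (+ t))) (expand (+ p) (+ n) (representations (+ t)))) ⟩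
        ∑ p (λ t → + p * + p * (representations (+ t) * representations (+ t))
                 + (- (+ 2 * + p * + n) * representations (+ t) + + n * + n))
          ≡⟨ trans (∑-distrib-+ p _ _) (cong₂ _+_ (*-distribˡ-∑ p (+ p * + p) _)
               (trans (∑-distrib-+ p _ _) (cong₂ _+_
                 (trans (*-distribˡ-∑ p (- (+ 2 * + p * + n)) _) (cong (- (+ 2 * + p * + n) *_) ∑-representations-1))
                 (∑-const p (+ n * + n))))) ⟩
        + p * + p * R + (- (+ 2 * + p * + n) * + n + + p * (+ n * + n))
          ≡⟨ collect (+ p) (+ n) (+ p * + p * R) ⟩
        + p * + p * R - + p * (+ n * + n)
          ≤⟨ minus-≤ (subst (0ℤ ≤_) (trans (pos-* p (n ℕ.* n)) (cong (+ p *_) (pos-* n n))) (+≤+ z≤n)) ⟩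
        + p * + p * R
          ≤⟨ *-monoˡ-≤-nonNeg (+ p * + p) {{nonNegative (square-nonNeg (+ p))}} ∑-representations² ⟩
        + p * + p * (+ n * + e) ∎
        where
        open ≤-Reasoning
        R = ∑ p (λ t → representations (+ t) * representations (+ t))
        minus-≤ : ∀ {i j} → 0ℤ ≤ j → i - j ≤ i
        minus-≤ {i} {j} 0≤j = subst (i - j ≤_) (+-identityʳ i) (+-monoʳ-≤ i (neg-mono-≤ 0≤j))
        expand : ∀ p n r → (p * r - n) * (p * r - n) ≡ p * p * (r * r) + (- (+ 2 * p * n) * r + n * n)
        expand = solve-∀
        collect : ∀ p n r → r + (- (+ 2 * p * n) * n + p * (n * n)) ≡ r - p * (n * n)
        collect = solve-∀

      module _ {m : ℕ} (m≤p : m ℕ.≤ p) {X : ℕ → Set} (X? : ∀ x → Dec (X x)) where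
        private
          a : ℕ → ℤ
          a x = [ X? x ]

          N : ℤ
          N = ∑ m a

          W : ℤ → ℤ → ℤ
          W = dispersion p-prime m≤p a excess

          W-periodicˡ : ∀ v → Periodic p (λ u → W u v)
          W-periodicˡ v {u} {u′} h = trans (dispersion-def p-prime m≤p a excess u v) (trans
            (∑-cong m (λ x _ → cong (a x *_) (excess-periodic (≈-+ʳ v (≈-*ʳ (+ x) h)))))
            (sym (dispersion-def p-prime m≤p a excess u′ v)))

          W-periodicʳ : ∀ u → Periodic p (W u)
          W-periodicʳ u {v} {v′} h = trans (dispersion-def p-prime m≤p a excess u v) (trans
            (∑-cong m (λ x _ → cong (a x *_) (excess-periodic (≈-+ˡ (u * + x) h))))
            (sym (dispersion-def p-prime m≤p a excess u v′)))

          []-square : ∀ {P : Set} (P? : Dec P) → [ P? ] * [ P? ] ≡ [ P? ]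
          []-square (yes _) = refl
          []-square (no _)  = refl

          total : ∑ p (λ u → ∑ p (λ v → W (+ u) (+ v) * W (+ u) (+ v))) ≤ N * (+ p * (+ p * + p * (+ n * + e)))
          total = begin
            ∑ p (λ u → ∑ p (λ v → W (+ u) (+ v) * W (+ u) (+ v)))
              ≡⟨ variance p-prime m≤p a excess-periodic ∑-excess ⟩
            ∑ m (λ x → a x * a x) * (+ p * ∑ p (λ t → excess (+ t) * excess (+ t)))
              ≡⟨ cong (_* _) (∑-cong m (λ x _ → []-square (X? x))) ⟩
            N * (+ p * ∑ p (λ t → excess (+ t) * excess (+ t)))
              ≤⟨ *-monoˡ-≤-nonNeg N {{nonNegative (∑-nonNeg m (λ x _ → []-nonNeg (X? x)))}}
                   (*-monoˡ-≤-nonNeg (+ p) ∑-excess²) ⟩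
            N * (+ p * (+ p * + p * (+ n * + e))) ∎
            where open ≤-Reasoning

        -- The right side is kept as the integer x + suc y, because its size and its divisors matter
        -- besides its class modulo p.
        Represented : Set
        Represented = ∃ λ x → ∃ λ y → ∃ λ z → x ℕ.< m × y ℕ.< m × X x × X y ×
                      ¬ z ≈[ p ] 0ℤ × c * z ^ e ≈[ p ] + x + + suc y

        private
          module _ (none : ¬ Represented) where
            -- Dilating by w ^ e permutes the values c z ^ e, so all these shifted dilates of X miss them.
            missed : ∀ w y → w ℕ.< n → y ℕ.< m → X y → W ((+ suc w) ^ e) ((+ suc w) ^ e * + y + (+ suc w) ^ e) ≡ - + n * N
            missed w y w<n y<m Xy = trans (trans (dispersion-def p-prime m≤p a excess ω _) (∑-cong m miss)) (trans (*-distribʳ-∑ m (- + n) a) (*-comm N (- + n)))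
              where
              ω = (+ suc w) ^ e
              w≉0 : ¬ + suc w ≈[ p ] 0ℤ
              w≉0 = 0<k<m⇒≉0 (s≤s z≤n) (s≤s w<n)
              ω≉0 : ¬ ω ≈[ p ] 0ℤ
              ω≉0 = ≉0-^ e p-prime w≉0
              miss : ∀ x → x ℕ.< m → a x * excess (ω * + x + (ω * + y + ω)) ≡ a x * - + n
              miss x x<m with X? x
              ... | no _   = trans (*-zeroˡ (excess (ω * + x + (ω * + y + ω)))) (sym (*-zeroˡ (- + n)))
              ... | yes Xx = cong (1ℤ *_) (excess-unrepresented (ω * + x + (ω * + y + ω)) (λ z z<n h → none (hit z z<n h)))
                where
                hit : ∀ z → z ℕ.< n → c * (+ suc z) ^ e ≈[ p ] ω * + x + (ω * + y + ω) → Represented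
                -- Dividing by ω = w^e undoes the dilation: if z represents ω (x + y + 1), then z /
                -- w represents x + y + 1.
                hit z z<n h = x , y , + suc z * w⁻¹ , x<m , y<m , Xx , Xy ,
                  ≉0-* {a = + suc z} p-prime (0<k<m⇒≉0 (s≤s z≤n) (s≤s z<n)) w⁻¹≉0 ,
                  ≈-cancel-*ˡ {a = ω} p-prime ω≉0 (≈-trans (≡⇒≈ (trans
                      (cong (λ k → ω * (c * k)) (*-^ (+ suc z) w⁻¹ e)) (shuffle ω c ((+ suc z) ^ e) (w⁻¹ ^ e))))
                    (≈-trans (≈-* {b = ω * + x + (ω * + y + ω)} {d = 1ℤ} h (≈-trans (≡⇒≈ (sym (*-^ (+ suc w) w⁻¹ e)))
                        (≈-trans (≈-^ e (proj₂ inv)) (≡⇒≈ (^-zeroˡ e)))))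
                      (≡⇒≈ (factor ω (+ x) (+ y)))))
                  where
                  inv = inverse {a = + suc w} p-prime w≉0
                  w⁻¹ = proj₁ inv
                  w⁻¹≉0 : ¬ w⁻¹ ≈[ p ] 0ℤ
                  w⁻¹≉0 h = 1≉0 p-prime (≈-trans (≈-sym (proj₂ inv))
                    (≈-trans (≈-*ˡ (+ suc w) h) (≡⇒≈ (*-zeroʳ (+ suc w)))))
                  *-^ : ∀ i j k → (i * j) ^ k ≡ i ^ k * j ^ k
                  *-^ i j zero    = refl
                  *-^ i j (suc k) = trans (cong (i * j *_) (*-^ i j k)) (medial i j (i ^ k) (j ^ k))
                    where
                    medial : ∀ i j k l → i * j * (k * l) ≡ i * k * (j * l)
                    medial = solve-∀
                  shuffle : ∀ ω c z v → ω * (c * (z * v)) ≡ c * z * (ω * v)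
                  shuffle = solve-∀
                  factor : ∀ ω x y → (ω * x + (ω * y + ω)) * 1ℤ ≡ ω * (x + (1ℤ + y))
                  factor = solve-∀

            -- Every w and every y in X give a pair at which W is - n N. For fixed w these pairs
            -- have distinct second coordinates, so enlarging to all v is allowed; passing from w to
            -- w^e costs the factor e.
            lower : + n * (N * (+ n * N * (+ n * N))) ≤ + e * ∑ p (λ u → ∑ p (λ v → W (+ u) (+ v) * W (+ u) (+ v)))
            lower = begin
              + n * (N * (+ n * N * (+ n * N)))
                ≡⟨ ∑-const n _ ⟨
              ∑ n (λ w → N * (+ n * N * (+ n * N)))
                ≡⟨ ∑-cong n (λ w _ → sym (*-distribʳ-∑ m (+ n * N * (+ n * N)) a)) ⟩
              ∑ n (λ w → ∑ m (λ y → a y * (+ n * N * (+ n * N))))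
                ≤⟨ ∑-mono n (λ w w<n → ∑-mono m (λ y y<m → pointwise w y w<n y<m)) ⟩
              ∑ n (λ w → ∑ m (λ y → V ((+ suc w) ^ e) ((+ suc w) ^ e * + y + (+ suc w) ^ e)))
                ≤⟨ ∑-mono n (λ w _ → ∑-≥0-shrink m≤p (λ y _ → V≥0 _ _)) ⟩
              ∑ n (λ w → ∑ p (λ y → V ((+ suc w) ^ e) ((+ suc w) ^ e * + y + (+ suc w) ^ e)))
                ≡⟨ ∑-cong n (λ w w<n → ∑-affine {a = (+ suc w) ^ e} p-prime
                     (≉0-^ e p-prime (0<k<m⇒≉0 (s≤s z≤n) (s≤s w<n)))
                     (λ h → cong₂ _*_ (W-periodicʳ _ h) (W-periodicʳ _ h)) ((+ suc w) ^ e)) ⟩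
              ∑ n (λ w → ∑ p (λ v → V ((+ suc w) ^ e) (+ v)))
                ≤⟨ ∑-power≤ (λ h → ∑-cong p (λ v _ → cong₂ _*_ (W-periodicˡ (+ v) h) (W-periodicˡ (+ v) h)))
                     (λ u → ∑-nonNeg p (λ v _ → V≥0 u (+ v))) ⟩
              + e * ∑ p (λ u → ∑ p (λ v → V (+ u) (+ v))) ∎
              where
              open ≤-Reasoning
              V : ℤ → ℤ → ℤ
              V u v = W u v * W u v
              V≥0 : ∀ u v → 0ℤ ≤ V u v
              V≥0 u v = square-nonNeg (W u v)
              pointwise : ∀ w y → w ℕ.< n → y ℕ.< m → a y * (+ n * N * (+ n * N))
                ≤ V ((+ suc w) ^ e) ((+ suc w) ^ e * + y + (+ suc w) ^ e)
              pointwise w y w<n y<m with X? y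
              ... | no _   = subst (_≤ V ω (ω * + y + ω)) (sym (*-zeroˡ (+ n * N * (+ n * N)))) (V≥0 ω (ω * + y + ω))
                where ω = (+ suc w) ^ e
              ... | yes Xy = ≤-reflexive (trans (sq (+ n) N) (sym (cong (λ z → z * z) eq)))
                where
                eq : W ((+ suc w) ^ e) ((+ suc w) ^ e * + y + (+ suc w) ^ e) ≡ - + n * N
                eq = missed w y w<n y<m Xy
                sq : ∀ n N → 1ℤ * (n * N * (n * N)) ≡ (- n * N) * (- n * N)
                sq = solve-∀

            bound : + n * + n * + n * (N * N * N) ≤ + n * + e * + e * (+ p * + p * + p) * N
            bound = begin
              + n * + n * + n * (N * N * N) ≡⟨ l (+ n) N ⟩
              + n * (N * (+ n * N * (+ n * N))) ≤⟨ lower ⟩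
              + e * ∑ p (λ u → ∑ p (λ v → W (+ u) (+ v) * W (+ u) (+ v))) ≤⟨ *-monoˡ-≤-nonNeg (+ e) total ⟩
              + e * (N * (+ p * (+ p * + p * (+ n * + e)))) ≡⟨ r (+ n) (+ e) (+ p) N ⟩
              + n * + e * + e * (+ p * + p * + p) * N ∎
              where
              open ≤-Reasoning
              l : ∀ n N → n * n * n * (N * N * N) ≡ n * (N * (n * N * (n * N)))
              l = solve-∀
              r : ∀ n e p N → e * (N * (p * (p * p * (n * e)))) ≡ n * e * e * (p * p * p) * N
              r = solve-∀

          bounded : ∀ x y → Dec (∃ λ (z : Fin p) → X x × X y × ¬ + toℕ z ≈[ p ] 0ℤ × c * (+ toℕ z) ^ e ≈[ p ] + x + + suc y)
          bounded x y = Finₚ.any? (λ z → X? x ×-dec X? y ×-dec ¬? (+ toℕ z ≈[ p ]? 0ℤ) ×-dec (_ ≈[ p ]? _))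

          -- The variance argument only refutes the absence of a representation. Reducing z modulo p
          -- makes the search finite, and decidability then removes the double negation.
          represented? : Dec Represented
          represented? with ℕₚ.anyUpTo? (λ x → ℕₚ.anyUpTo? (bounded x) m) m
          ... | yes (x , x<m , y , y<m , z , Xx , Xy , z≉0 , h) = yes (x , y , + toℕ z , x<m , y<m , Xx , Xy , z≉0 , h)
          ... | no ¬∃ = no λ (x , y , z , x<m , y<m , Xx , Xy , z≉0 , h) →
            let r≈z : + toℕ (fromℕ< (n%ℕd<d z p)) ≈[ p ] z
                r≈z = ≈-trans (≡⇒≈ (cong +_ (Finₚ.toℕ-fromℕ< (n%ℕd<d z p)))) (≈-sym (%ℕ-≈ z p))
            in ¬∃ (x , x<m , y , y<m , fromℕ< (n%ℕd<d z p) , Xx , Xy ,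
                   (λ r≈0 → z≉0 (≈-trans (≈-sym r≈z) r≈0)) , ≈-trans (≈-*ˡ c (≈-^ e r≈z)) h)

        -- Multiplied by n N, the hypothesis contradicts `bound`. That n N is not zero also comes
        -- from the hypothesis, whose right side would otherwise vanish.
        represented : + e * + e * (+ p * + p * + p) < + n * + n * (∑ m (λ x → [ X? x ]) * ∑ m (λ x → [ X? x ])) →
                      Represented
        represented large = decidable-stable represented? λ none →
          <⇒≱ (<-≤-trans (scaled large) (≤-reflexive (l (+ n) N))) (≤-trans (bound none) (≤-reflexive (r (+ n) (+ e) (+ p) N)))
          where
          l : ∀ n N → n * N * (n * n * (N * N)) ≡ n * n * n * (N * N * N)
          l = solve-∀
          r : ∀ n e p N → n * e * e * (p * p * p) * N ≡ n * N * (e * e * (p * p * p))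
          r = solve-∀
          0≤nN : 0ℤ ≤ + n * N
          0≤nN = subst (_≤ + n * N) (*-zeroʳ (+ n)) (*-monoˡ-≤-nonNeg (+ n) (∑-nonNeg m (λ x _ → []-nonNeg (X? x))))
          scaled : ∀ {i j} → i < j → + n * N * i < + n * N * j
          scaled {i} {j} i<j = *-monoˡ-<-pos (+ n * N) {{positive (≤∧≢⇒< 0≤nN nN≢0)}} i<j
            where
            nN≢0 : 0ℤ ≢ + n * N
            nN≢0 0≡nN = <⇒≱ large (subst (_≤ + e * + e * (+ p * + p * + p)) (sym (vanish 0≡nN))
              (*-mono-≤-nonNeg {0ℤ} {+ e * + e} {0ℤ} {+ p * + p * + p} ≤-refl (square-nonNeg (+ e)) ≤-refl
                (*-mono-≤-nonNeg {0ℤ} {+ p * + p} {0ℤ} {+ p} ≤-refl (square-nonNeg (+ p)) ≤-refl (+≤+ z≤n))))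
              where
              sq : ∀ n N → n * n * (N * N) ≡ (n * N) * (n * N)
              sq = solve-∀
              vanish : 0ℤ ≡ + n * N → + n * + n * (N * N) ≡ 0ℤ
              vanish 0≡ = trans (sq (+ n) N) (trans (cong (λ z → z * z) (sym 0≡)) refl)

  -- The sieve: residues whose sums plus one avoid every prime divisor.

  ≈-∣ : ∀ {m n a b} → m ℕ∣.∣ n → a ≈[ n ] b → a ≈[ m ] b
  ≈-∣ m∣n h = -≈0⇒≈ (∣ᵤ⇒≈0 (ℕ∣.∣-trans m∣n (≈0⇒∣ᵤ (≈⇒-≈0 h))))

  opaque
    unfolding ∑

    ∑-reverse : ∀ n (f : ℕ → ℤ) → ∑ n f ≡ ∑ n (λ k → f (n ℕ.∸ suc k))
    ∑-reverse n f = trans (ℤSum.sum-permute {n} {n} (λ i → f (toℕ i)) reverse)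
      (ℤSum.sum-cong-≗ {n} (λ i → cong f (Finₚ.opposite-prop i)))

  -- The cut-off ⌊ℓ/2⌋ keeps the sums x + y + 1 of low residues strictly between 0 and ℓ.
  Low : ℤ → ℕ → Set
  Low t ℓ = ∃ λ j → j ℕ.< ⌊ ℓ /2⌋ × t ≈[ ℓ ] + j

  low? : ∀ t ℓ → Dec (Low t ℓ)
  low? t ℓ = ℕₚ.anyUpTo? (λ j → t ≈[ ℓ ]? + j) ⌊ ℓ /2⌋

  ⌊n/2⌋+⌊n/2⌋≤n : ∀ n → ⌊ n /2⌋ ℕ.+ ⌊ n /2⌋ ℕ.≤ n
  ⌊n/2⌋+⌊n/2⌋≤n n = subst (⌊ n /2⌋ ℕ.+ ⌊ n /2⌋ ℕ.≤_) (ℕₚ.⌊n/2⌋+⌈n/2⌉≡n n) (ℕₚ.+-monoʳ-≤ ⌊ n /2⌋ (ℕₚ.⌊n/2⌋≤⌈n/2⌉ n))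

  low-+ : ∀ {s t ℓ} → Low s ℓ → Low t ℓ → ¬ s + t + 1ℤ ≈[ ℓ ] 0ℤ
  low-+ {s} {t} {ℓ} (i , i< , s≈i) (j , j< , t≈j) h = 0<k<m⇒≉0 {k = suc (i ℕ.+ j)} (s≤s z≤n) small
    (≈-trans (≡⇒≈ (cong +_ (ℕₚ.+-comm 1 (i ℕ.+ j)))) (≈-trans (≈-sym (≈-+ʳ 1ℤ (≈-+ s≈i t≈j))) h))
    where
    small : suc (i ℕ.+ j) ℕ.< ℓ
    small = ℕₚ.≤-trans (ℕₚ.≤-reflexive (cong suc (sym (ℕₚ.+-suc i j)))) (ℕₚ.≤-trans (ℕₚ.+-mono-≤ i< j<) (⌊n/2⌋+⌊n/2⌋≤n ℓ))

  low-≈ : ∀ {s t ℓ} → s ≈[ ℓ ] t → Low s ℓ → Low t ℓ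
  low-≈ s≈t (j , j< , s≈j) = j , j< , ≈-trans (≈-sym s≈t) s≈j

  ∑-low : ∀ ℓ → ∑ ℓ (λ k → [ low? (+ k) ℓ ]) ≡ + ⌊ ℓ /2⌋
  ∑-low ℓ = begin
    ∑ ℓ (λ k → [ low? (+ k) ℓ ])
      ≡⟨ cong (λ k → ∑ k (λ k → [ low? (+ k) ℓ ])) (sym (ℕₚ.⌊n/2⌋+⌈n/2⌉≡n ℓ)) ⟩
    ∑ (⌊ ℓ /2⌋ ℕ.+ ⌈ ℓ /2⌉) (λ k → [ low? (+ k) ℓ ])
      ≡⟨ ∑-split ⌊ ℓ /2⌋ ⌈ ℓ /2⌉ _ ⟩
    ∑ ⌊ ℓ /2⌋ (λ k → [ low? (+ k) ℓ ]) + ∑ ⌈ ℓ /2⌉ (λ k → [ low? (+ (⌊ ℓ /2⌋ ℕ.+ k)) ℓ ])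
      ≡⟨ cong₂ _+_
           (∑-cong ⌊ ℓ /2⌋ (λ k k< → []-true (low? (+ k) ℓ) (k , k< , ≡⇒≈ refl)))
           (∑-cong ⌈ ℓ /2⌉ (λ k k< → []-false (low? (+ (⌊ ℓ /2⌋ ℕ.+ k)) ℓ) (high k k<))) ⟩
    ∑ ⌊ ℓ /2⌋ (λ k → 1ℤ) + ∑ ⌈ ℓ /2⌉ (λ k → 0ℤ)
      ≡⟨ cong₂ _+_ (trans (∑-const ⌊ ℓ /2⌋ 1ℤ) (*-identityʳ (+ ⌊ ℓ /2⌋))) (∑-0 ⌈ ℓ /2⌉) ⟩
    + ⌊ ℓ /2⌋ + 0ℤ
      ≡⟨ +-identityʳ _ ⟩
    + ⌊ ℓ /2⌋ ∎
    where
    open ≡-Reasoning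
    high : ∀ k → k ℕ.< ⌈ ℓ /2⌉ → ¬ Low (+ (⌊ ℓ /2⌋ ℕ.+ k)) ℓ
    high k k< (j , j< , h) = ℕₚ.<⇒≱ j< (subst (⌊ ℓ /2⌋ ℕ.≤_)
      (≈⇒≡ (subst (⌊ ℓ /2⌋ ℕ.+ k ℕ.<_) (ℕₚ.⌊n/2⌋+⌈n/2⌉≡n ℓ) (ℕₚ.+-monoʳ-< ⌊ ℓ /2⌋ k<))
        (ℕₚ.<-≤-trans j< (ℕₚ.⌊n/2⌋≤n ℓ)) h) (ℕₚ.m≤m+n ⌊ ℓ /2⌋ k))

  []-×-dec : ∀ {P Q : Set} (P? : Dec P) (Q? : Dec Q) {R : Set} (R? : Dec R) →
             (R → P × Q) → (P → Q → R) → [ R? ] ≡ [ P? ] * [ Q? ]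
  []-×-dec (yes p) (yes q) (yes r) f g = refl
  []-×-dec (yes p) (yes q) (no ¬r) f g = contradiction (g p q) ¬r
  []-×-dec (yes p) (no ¬q) (yes r) f g = contradiction (proj₂ (f r)) ¬q
  []-×-dec (yes p) (no ¬q) (no ¬r) f g = refl
  []-×-dec (no ¬p) Q?      (yes r) f g = contradiction (proj₁ (f r)) ¬p
  []-×-dec (no ¬p) Q?      (no ¬r) f g = sym (*-zeroˡ [ Q? ])

  -- Distinctness is expressed by strict increase, the form that also feeds the comparison of the
  -- product with a factorial.
  DistinctPrimes : List ℕ → Set
  DistinctPrimes ls = AllPairs ℕ._<_ ls × All Prime ls

  prime∤product : ∀ {ℓ ls} → DistinctPrimes (ℓ ∷ ls) → ¬ ℓ ℕ∣.∣ product ls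
  prime∤product (ℓ< ∷ _ , ℓ-prime ∷ primes) h =
    ℕₚ.<-irrefl refl (All.lookup ℓ< (factorisationHasAllPrimeFactors ℓ-prime h primes))

  product-∣ : ∀ {n ls} → DistinctPrimes ls → All (ℕ∣._∣ n) ls → product ls ℕ∣.∣ n
  product-∣ {n} ([] , []) [] = ℕ∣.1∣ n
  product-∣ {n} {ℓ ∷ ls} distinct@(_ ∷ sorted , ℓ-prime ∷ primes) (ℓ∣n ∷ ls∣n)
    with product-∣ (sorted , primes) ls∣n
  ... | ℕ∣.divides q refl with euclidsLemma q (product ls) ℓ-prime ℓ∣n
  ... | inj₁ ℓ∣q = ℕ∣.*-monoˡ-∣ (product ls) ℓ∣q
  ... | inj₂ ℓ∣R = contradiction ℓ∣R (prime∤product distinct)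

  Survives : List ℕ → ℤ → Set
  Survives ls t = All (Low t) ls

  survives? : ∀ ls t → Dec (Survives ls t)
  survives? ls t = All.all? (low? t) ls

  survives-periodic : ∀ {ls m} → All (ℕ∣._∣ m) ls → Periodic m (λ t → [ survives? ls t ])
  survives-periodic ls∣m {s} {t} s≈t = []-cong (survives? _ s) (survives? _ t)
    (transport s≈t) (transport (≈-sym s≈t))
    where
    transport : ∀ {s t} → s ≈[ _ ] t → Survives _ s → Survives _ t
    transport s≈t low = All.zipWith (λ (ℓ∣m , l) → low-≈ (≈-∣ ℓ∣m s≈t) l) (ls∣m , low)

  all-∣-product : ∀ ls → All (ℕ∣._∣ product ls) ls
  all-∣-product ls = All.tabulate ∈⇒∣product

  -- The Chinese remainder theorem, in counting form.
  ∑-survives : ∀ {ls} → DistinctPrimes ls →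
               ∑ (product ls) (λ k → [ survives? ls (+ k) ]) ≡ + product (map ⌊_/2⌋ ls)
  ∑-survives {[]} _ = trans (∑-suc 0 _) (trans (cong (λ z → 1ℤ + z) (∑-zero _)) refl)
  ∑-survives {ℓ ∷ ls} distinct@(_ ∷ sorted , ℓ-prime ∷ primes) = begin
    ∑ (ℓ ℕ.* R) (λ k → [ survives? (ℓ ∷ ls) (+ k) ])
      ≡⟨ ∑-blocks ℓ R _ ⟩
    ∑ ℓ (λ i → ∑ R (λ j → [ survives? (ℓ ∷ ls) (+ (i ℕ.* R ℕ.+ j)) ]))
      ≡⟨ ∑-cong ℓ (λ i _ → ∑-cong R (λ j _ → split i j)) ⟩
    ∑ ℓ (λ i → ∑ R (λ j → [ low? (+ R * + i + + j) ℓ ] * [ survives? ls (+ j) ]))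
      ≡⟨ ∑-comm ℓ R _ ⟩
    ∑ R (λ j → ∑ ℓ (λ i → [ low? (+ R * + i + + j) ℓ ] * [ survives? ls (+ j) ]))
      -- For fixed j the map i ↦ R i + j permutes the residues modulo ℓ, since ℓ does not divide R;
      -- the condition at ℓ is therefore independent of those at the other primes.
      ≡⟨ ∑-cong R (λ j _ → trans (*-distribʳ-∑ ℓ [ survives? ls (+ j) ] _) (cong (_* [ survives? ls (+ j) ])
           (trans (∑-affine {a = + R} {f = λ t → [ low? t ℓ ]} ℓ-prime R≉0
             (λ {s} {t} h → []-cong (low? s ℓ) (low? t ℓ) (low-≈ h) (low-≈ (≈-sym h))) (+ j)) (∑-low ℓ)))) ⟩
    ∑ R (λ j → + ⌊ ℓ /2⌋ * [ survives? ls (+ j) ])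
      ≡⟨ *-distribˡ-∑ R (+ ⌊ ℓ /2⌋) _ ⟩
    + ⌊ ℓ /2⌋ * ∑ R (λ j → [ survives? ls (+ j) ])
      ≡⟨ cong (+ ⌊ ℓ /2⌋ *_) (∑-survives (sorted , primes)) ⟩
    + ⌊ ℓ /2⌋ * + product (map ⌊_/2⌋ ls)
      ≡⟨ pos-* ⌊ ℓ /2⌋ _ ⟨
    + product (map ⌊_/2⌋ (ℓ ∷ ls)) ∎
    where
    open ≡-Reasoning
    R = product ls
    R≉0 : ¬ + R ≈[ ℓ ] 0ℤ
    R≉0 h = prime∤product distinct (≈0⇒∣ᵤ h)
    position : ∀ i j → + (i ℕ.* R ℕ.+ j) ≡ + R * + i + + j
    position i j = cong (_+ + j) (trans (pos-* i R) (*-comm (+ i) (+ R)))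
    split : ∀ i j → [ survives? (ℓ ∷ ls) (+ (i ℕ.* R ℕ.+ j)) ] ≡ [ low? (+ R * + i + + j) ℓ ] * [ survives? ls (+ j) ]
    split i j = trans (cong (λ t → [ survives? (ℓ ∷ ls) t ]) (position i j)) (trans
      ([]-×-dec (low? t ℓ) (survives? ls t) (survives? (ℓ ∷ ls) t) (λ { (l ∷ s) → l , s }) _∷_)
      (cong ([ low? t ℓ ] *_) (survives-periodic (all-∣-product ls) (by (+ i)
        (trans (+-comm (+ R * + i) (+ j)) (cong (λ z → + j + z) (*-comm (+ R) (+ i))))))))
      where t = + R * + i + + j

  ∑-survives-multiple : ∀ {ls} → DistinctPrimes ls → ∀ k →
    ∑ (k ℕ.* product ls) (λ x → [ survives? ls (+ x) ]) ≡ + (k ℕ.* product (map ⌊_/2⌋ ls))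
  ∑-survives-multiple {ls} distinct k = trans (∑-+-periodic (survives-periodic (all-∣-product ls)) k)
    (trans (cong (+ k *_) (∑-survives distinct)) (sym (pos-* k _)))

  module _ {ls : List ℕ} {m : ℕ} (ls∣2m : All (ℕ∣._∣ m ℕ.+ m) ls) where

    private
      lower upper : ℤ
      lower = ∑ m (λ x → [ survives? ls (+ x) ])
      upper = ∑ m (λ x → [ survives? ls (-1ℤ - + x) ])

      -- The upper half is read backwards, its entry 2m - 1 - k being congruent to -1 - k modulo 2m.
      halves : ∑ (m ℕ.+ m) (λ x → [ survives? ls (+ x) ]) ≡ lower + upper
      halves = trans (∑-split m m _) (cong (λ z → lower + z) (trans (∑-reverse m _)
        (∑-cong m (λ k k<m → survives-periodic ls∣2m (by 1ℤ (reflect k k<m))))))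
        where
        reflect : ∀ k → k ℕ.< m → + (m ℕ.+ (m ℕ.∸ suc k)) ≡ (-1ℤ - + k) + 1ℤ * + (m ℕ.+ m)
        reflect k k<m = trans (cong (λ i → + (i ℕ.+ j)) m≡) (trans (eq (+ k) (+ j))
          (cong (λ i → (-1ℤ - + k) + 1ℤ * + (i ℕ.+ i)) (sym m≡)))
          where
          j = m ℕ.∸ suc k
          m≡ : m ≡ suc k ℕ.+ j
          m≡ = sym (ℕₚ.m+[n∸m]≡n k<m)
          eq : ∀ k j → (1ℤ + k + j) + j ≡ (-1ℤ - k) + 1ℤ * ((1ℤ + k + j) + (1ℤ + k + j))
          eq = solve-∀

      double : ∀ i → + 2 * i ≡ i + i
      double = solve-∀

    -- Either the lower half of the survivors is large, or the reflection of the upper half is.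
    half-sieve : Σ (ℕ → Set) λ X → Σ (∀ x → Dec (X x)) λ X? →
      (∀ x y → X x → X y → All (λ ℓ → ¬ + x + + suc y ≈[ ℓ ] 0ℤ) ls) ×
      ∑ (m ℕ.+ m) (λ x → [ survives? ls (+ x) ]) ≤ + 2 * ∑ m (λ x → [ X? x ])
    half-sieve with ≤-total lower upper
    ... | inj₂ upper≤lower = (λ x → Survives ls (+ x)) , (λ x → survives? ls (+ x)) ,
      (λ x y low-x low-y → All.zipWith (λ (lx , ly) h → low-+ lx ly
        (≈-trans (≡⇒≈ (eq (+ x) (+ y))) h)) (low-x , low-y)) ,
      subst₂ _≤_ (sym halves) (sym (double lower)) (+-monoʳ-≤ lower upper≤lower)
      where
      eq : ∀ x y → x + y + 1ℤ ≡ x + (1ℤ + y)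
      eq = solve-∀
    -- The reflection x ↦ -1 - x is compatible with the shifted sum: (-1 - x) + (-1 - y) + 1 = -(x +
    -- y + 1).
    ... | inj₁ lower≤upper = (λ x → Survives ls (-1ℤ - + x)) , (λ x → survives? ls (-1ℤ - + x)) ,
      (λ x y low-x low-y → All.zipWith (λ (lx , ly) h → low-+ lx ly
        (≈-trans (≡⇒≈ (eq (+ x) (+ y))) (≈-*ˡ -1ℤ h))) (low-x , low-y)) ,
      subst₂ _≤_ (sym halves) (sym (double upper)) (+-monoˡ-≤ upper lower≤upper)
      where
      eq : ∀ x y → (-1ℤ - x) + (-1ℤ - y) + 1ℤ ≡ -1ℤ * (x + (1ℤ + y))
      eq = solve-∀

  -- The extreme case is n = 3, which is the origin of the factor 3^w in the sieve loss.
  n≤3⌊n/2⌋ : ∀ n → 2 ℕ.≤ n → n ℕ.≤ 3 ℕ.* ⌊ n /2⌋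
  n≤3⌊n/2⌋ n 2≤n = begin
    n                             ≡⟨ ℕₚ.⌊n/2⌋+⌈n/2⌉≡n n ⟨
    h ℕ.+ ⌈ n /2⌉                 ≤⟨ ℕₚ.+-monoʳ-≤ h (ℕₚ.⌊n/2⌋-mono (ℕₚ.n≤1+n (suc n))) ⟩
    h ℕ.+ suc h                   ≤⟨ ℕₚ.+-monoʳ-≤ h (ℕₚ.+-monoˡ-≤ h (ℕₚ.⌊n/2⌋-mono 2≤n)) ⟩
    h ℕ.+ (h ℕ.+ h)               ≡⟨ cong (λ k → h ℕ.+ (h ℕ.+ k)) (ℕₚ.+-identityʳ h) ⟨
    3 ℕ.* h ∎
    where
    open ℕₚ.≤-Reasoning
    h = ⌊ n /2⌋

  product≤ : ∀ {ls} → All (2 ℕ.≤_) ls → product ls ℕ.≤ 3 ℕ.^ length ls ℕ.* product (map ⌊_/2⌋ ls)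
  product≤ [] = s≤s z≤n
  product≤ {ℓ ∷ ls} (2≤ℓ ∷ 2≤ls) = ℕₚ.≤-trans (ℕₚ.*-mono-≤ (n≤3⌊n/2⌋ ℓ 2≤ℓ) (product≤ 2≤ls))
    (ℕₚ.≤-reflexive (medial 3 ⌊ ℓ /2⌋ (3 ℕ.^ length ls) (product (map ⌊_/2⌋ ls))))
    where
    medial : ∀ a b c d → (a ℕ.* b) ℕ.* (c ℕ.* d) ≡ (a ℕ.* c) ℕ.* (b ℕ.* d)
    medial = ℕ-solve-∀

  -- In an increasing list above b the i-th entry is at least b + i.
  !*product≥ : ∀ b {ls} → AllPairs ℕ._<_ ls → All (b ℕ.<_) ls → (b ℕ.+ length ls) ! ℕ.≤ b ! ℕ.* product ls
  !*product≥ b {[]} _ _ = ℕₚ.≤-reflexive (trans (cong _! (ℕₚ.+-identityʳ b)) (sym (ℕₚ.*-identityʳ (b !))))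
  !*product≥ b {ℓ ∷ ls} (ℓ< ∷ sorted) (b<ℓ ∷ _) = begin
    (b ℕ.+ suc (length ls)) !           ≡⟨ cong _! (ℕₚ.+-suc b (length ls)) ⟩
    (suc b ℕ.+ length ls) !             ≤⟨ !*product≥ (suc b) sorted (All.map (ℕₚ.≤-<-trans b<ℓ) ℓ<) ⟩
    suc b ℕ.* b ! ℕ.* product ls        ≤⟨ ℕₚ.*-monoˡ-≤ (product ls) (ℕₚ.*-monoˡ-≤ (b !) b<ℓ) ⟩
    ℓ ℕ.* b ! ℕ.* product ls            ≡⟨ cong (ℕ._* product ls) (ℕₚ.*-comm ℓ (b !)) ⟩
    b ! ℕ.* ℓ ℕ.* product ls            ≡⟨ ℕₚ.*-assoc (b !) ℓ (product ls) ⟩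
    b ! ℕ.* (ℓ ℕ.* product ls)          ∎
    where open ℕₚ.≤-Reasoning

  -- Prime divisors of n and the totient.

  oddPrimeDivisors : ℕ → List ℕ
  oddPrimeDivisors n = filter (λ ℓ → prime? ℓ ×-dec ℓ ℕ∣.∣? n) (applyUpTo (3 ℕ.+_) n)

  module _ (n : ℕ) where
    private
      ls = oddPrimeDivisors n

    oddPrimeDivisors-sorted : AllPairs ℕ._<_ ls
    oddPrimeDivisors-sorted = AllPairsₚ.filter⁺ _ (AllPairsₚ.applyUpTo⁺₁ (3 ℕ.+_) n (λ i<j _ → ℕₚ.+-monoʳ-< 3 i<j))

    oddPrimeDivisors-all : All (λ ℓ → Prime ℓ × ℓ ℕ∣.∣ n) ls
    oddPrimeDivisors-all = Allₚ.all-filter (λ ℓ → prime? ℓ ×-dec ℓ ℕ∣.∣? n) (applyUpTo (3 ℕ.+_) n)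

    oddPrimeDivisors->2 : All (2 ℕ.<_) ls
    oddPrimeDivisors->2 = Allₚ.filter⁺ _ (Allₚ.applyUpTo⁺₂ (3 ℕ.+_) n (λ i → ℕₚ.m≤m+n 3 i))

    ∈-oddPrimeDivisors : .{{_ : NonZero n}} → ∀ {ℓ} → Prime ℓ → ℓ ℕ∣.∣ n → 2 ℕ.< ℓ → ℓ ∈ ls
    ∈-oddPrimeDivisors {ℓ} ℓ-prime ℓ∣n 2<ℓ = ∈ₚ.∈-filter⁺ _
      (subst (_∈ applyUpTo (3 ℕ.+_) n) (ℕₚ.m+[n∸m]≡n 2<ℓ)
        (∈ₚ.∈-applyUpTo⁺ (3 ℕ.+_) (ℕₚ.<-≤-trans (ℕₚ.∸-monoʳ-< {o = 0} (s≤s z≤n) 2<ℓ) (ℕ∣.∣⇒≤ ℓ∣n))))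
      (ℓ-prime , ℓ∣n)

  prime-divisor : ∀ d → 1 ℕ.< d → ∃ λ ℓ → Prime ℓ × ℓ ℕ∣.∣ d
  prime-divisor d@(suc _) 1<d with factorise d
  ... | record { factors = [] ; isFactorisation = eq } = contradiction (sym eq) (ℕₚ.<⇒≢ 1<d)
  ... | record { factors = ℓ ∷ ls ; isFactorisation = eq ; factorsPrime = ℓ-prime ∷ _ } =
    ℓ , ℓ-prime , subst (ℓ ℕ∣.∣_) (sym eq) (ℕ∣.m∣m*n (product ls))

  ¬coprime⇒common-prime : ∀ g n .{{_ : NonZero n}} → ¬ Coprime g n → ∃ λ ℓ → Prime ℓ × ℓ ℕ∣.∣ g × ℓ ℕ∣.∣ n
  ¬coprime⇒common-prime g n ¬coprime = ℓ , ℓ-prime , ℕ∣.∣-trans ℓ∣d (ℕGCD.gcd[m,n]∣m g n) , ℕ∣.∣-trans ℓ∣d (ℕGCD.gcd[m,n]∣n g n)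
    where
    d = ℕGCD.gcd g n
    1<d : 1 ℕ.< d
    1<d = ℕₚ.≤∧≢⇒< (ℕₚ.n≢0⇒n>0 (ℕGCD.gcd[m,n]≢0 g n (inj₂ (ℕ.≢-nonZero⁻¹ n)))) (λ 1≡d → ¬coprime (gcd≡1⇒coprime (sym 1≡d)))
    found = prime-divisor d 1<d
    ℓ = proj₁ found
    ℓ-prime = proj₁ (proj₂ found)
    ℓ∣d = proj₂ (proj₂ found)

  prime-2-or-odd : ∀ {ℓ} → Prime ℓ → ℓ ≡ 2 ⊎ 2 ℕ.< ℓ
  prime-2-or-odd ℓ-prime with ℕₚ.m≤n⇒m<n∨m≡n (prime⇒2≤ ℓ-prime)
  ... | inj₁ 2<ℓ = inj₂ 2<ℓ
  ... | inj₂ 2≡ℓ = inj₁ (sym 2≡ℓ)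

  common-prime∈ : ∀ g n .{{_ : NonZero n}} → ¬ Coprime g n → Any (ℕ∣._∣ g) (2 ∷ oddPrimeDivisors n)
  common-prime∈ g n ¬coprime = locate (¬coprime⇒common-prime g n ¬coprime)
    where
    locate : (∃ λ ℓ → Prime ℓ × ℓ ℕ∣.∣ g × ℓ ℕ∣.∣ n) → Any (ℕ∣._∣ g) (2 ∷ oddPrimeDivisors n)
    locate (ℓ , ℓ-prime , ℓ∣g , ℓ∣n) with prime-2-or-odd ℓ-prime
    ... | inj₁ refl = here ℓ∣g
    ... | inj₂ 2<ℓ  = there (lose (∈-oddPrimeDivisors n ℓ-prime ℓ∣n 2<ℓ) ℓ∣g)

  sumOver : List ℕ → (ℕ → ℤ) → ℤ
  sumOver []       f = 0ℤ
  sumOver (ℓ ∷ ls) f = f ℓ + sumOver ls f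

  ∑-sumOver : ∀ n ls (f : ℕ → ℕ → ℤ) → ∑ n (λ k → sumOver ls (f k)) ≡ sumOver ls (λ ℓ → ∑ n (λ k → f k ℓ))
  ∑-sumOver n []       f = ∑-0 n
  ∑-sumOver n (ℓ ∷ ls) f = trans (∑-distrib-+ n _ _) (cong (λ z → ∑ n (λ k → f k ℓ) + z) (∑-sumOver n ls f))

  sumOver-nonNeg : ∀ ls {f} → (∀ ℓ → 0ℤ ≤ f ℓ) → 0ℤ ≤ sumOver ls f
  sumOver-nonNeg []       f≥0 = ≤-refl
  sumOver-nonNeg (ℓ ∷ ls) f≥0 = +-mono-≤ (f≥0 ℓ) (sumOver-nonNeg ls f≥0)

  sumOver-≥1 : ∀ {ls} {P : ℕ → Set} (P? : ∀ ℓ → Dec (P ℓ)) → Any P ls → 1ℤ ≤ sumOver ls (λ ℓ → [ P? ℓ ])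
  sumOver-≥1 {ℓ ∷ ls} P? (here p)  = +-mono-≤ (≤-reflexive (sym ([]-true (P? ℓ) p))) (sumOver-nonNeg ls (λ k → []-nonNeg (P? k)))
  sumOver-≥1 {ℓ ∷ ls} P? (there a) = +-mono-≤ ([]-nonNeg (P? ℓ)) (sumOver-≥1 P? a)

  sumOver-≤ : ∀ B {C f ls} → All (λ ℓ → B * f ℓ ≤ C) ls → B * sumOver ls f ≤ + length ls * C
  sumOver-≤ B {C} [] = ≤-reflexive (trans (*-zeroʳ B) (sym (*-zeroˡ C)))
  sumOver-≤ B {C} {f} {ℓ ∷ ls} (b ∷ bs) = ≤-trans (≤-reflexive (*-distribˡ-+ B (f ℓ) (sumOver ls f)))
    (≤-trans (+-mono-≤ b (sumOver-≤ B bs)) (≤-reflexive (sym (suc-* (+ length ls) C))))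

  length-filter-applyUpTo : ∀ {P : ℕ → Set} (P? : ∀ k → Dec (P k)) g n →
    + length (filter P? (applyUpTo g n)) ≡ ∑ n (λ k → [ P? (g k) ])
  length-filter-applyUpTo P? g zero = sym (∑-zero _)
  length-filter-applyUpTo P? g (suc n) with P? (g 0) in eq
  ... | yes _ = trans (cong (λ z → 1ℤ + z) (length-filter-applyUpTo P? (g ∘ suc) n))
                  (trans (cong (λ d → [ d ] + ∑ n (λ k → [ P? (g (suc k)) ])) (sym eq)) (sym (∑-suc n _)))
  ... | no _  = trans (length-filter-applyUpTo P? (g ∘ suc) n) (trans (sym (+-identityˡ _))
                  (trans (cong (λ d → [ d ] + ∑ n (λ k → [ P? (g (suc k)) ])) (sym eq)) (sym (∑-suc n _))))

  φ-∑ : ∀ n → + φ n ≡ ∑ n (λ k → [ coprime? (suc k) n ])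
  φ-∑ n = trans (cong (λ ks → + length (filter (λ k → coprime? k n) ks)) (Listₚ.map-upTo suc n))
    (length-filter-applyUpTo (λ k → coprime? k n) suc n)

  multiples : ℕ → ℕ → ℤ
  multiples n ℓ = ∑ n (λ k → [ ℓ ℕ∣.∣? suc k ])

  multiples-* : ∀ {n ℓ} → .{{_ : NonZero ℓ}} → ℓ ℕ∣.∣ n → + ℓ * multiples n ℓ ≡ + n
  multiples-* {ℓ = ℓ} (ℕ∣.divides q refl) = begin
    + ℓ * multiples (q ℕ.* ℓ) ℓ
      ≡⟨ cong (+ ℓ *_) (∑-cong (q ℕ.* ℓ) (λ k _ → []-cong (ℓ ℕ∣.∣? suc k) (+ k + 1ℤ ≈[ ℓ ]? 0ℤ)
           (λ h → ∣ᵤ⇒≈0 (subst (ℓ ℕ∣.∣_) (ℕₚ.+-comm 1 k) h)) (λ h → subst (ℓ ℕ∣.∣_) (ℕₚ.+-comm k 1) (≈0⇒∣ᵤ h)))) ⟩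
    + ℓ * ∑ (q ℕ.* ℓ) (λ k → [ + k + 1ℤ ≈[ ℓ ]? 0ℤ ])
      ≡⟨ cong (+ ℓ *_) (∑-+-periodic {f = λ t → [ t + 1ℤ ≈[ ℓ ]? 0ℤ ]} (λ h → periodic (≈-+ʳ 1ℤ h)) q) ⟩
    + ℓ * (+ q * ∑ ℓ (λ k → [ + k + 1ℤ ≈[ ℓ ]? 0ℤ ]))
      ≡⟨ cong (λ z → + ℓ * (+ q * z)) (trans (∑-translate {f = λ t → [ t ≈[ ℓ ]? 0ℤ ]} periodic 1ℤ) one) ⟩
    + ℓ * (+ q * 1ℤ)
      ≡⟨ trans (cong (+ ℓ *_) (*-identityʳ (+ q))) (trans (*-comm (+ ℓ) (+ q)) (sym (pos-* q ℓ))) ⟩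
    + (q ℕ.* ℓ) ∎
    where
    open ≡-Reasoning
    periodic : Periodic ℓ (λ t → [ t ≈[ ℓ ]? 0ℤ ])
    periodic {s} {t} h = []-cong (s ≈[ ℓ ]? 0ℤ) (t ≈[ ℓ ]? 0ℤ) (≈-trans (≈-sym h)) (≈-trans h)
    one : ∑ ℓ (λ k → [ + k ≈[ ℓ ]? 0ℤ ]) ≡ 1ℤ
    one = trans (∑-cong ℓ (λ k _ → trans ([]-cong (+ k ≈[ ℓ ]? 0ℤ) (0ℤ ≈[ ℓ ]? + k) ≈-sym ≈-sym) (sym (*-identityʳ _))))
      (∑-≈-select ℓ 0ℤ {λ _ → 1ℤ} (λ _ → refl))

  -- Union bound: a number up to n that is not coprime to n is a multiple of 2 or of an odd prime
  -- divisor of n.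
  n≤φ+multiples : ∀ n .{{_ : NonZero n}} → + n ≤ + φ n + (multiples n 2 + sumOver (oddPrimeDivisors n) (multiples n))
  n≤φ+multiples n = begin
    + n
      ≡⟨ trans (∑-const n 1ℤ) (*-identityʳ (+ n)) ⟨
    ∑ n (λ k → 1ℤ)
      ≤⟨ ∑-mono n (λ k _ → covered (suc k)) ⟩
    ∑ n (λ k → [ coprime? (suc k) n ] + sumOver (2 ∷ ls) (λ ℓ → [ ℓ ℕ∣.∣? suc k ]))
      ≡⟨ ∑-distrib-+ n _ _ ⟩
    ∑ n (λ k → [ coprime? (suc k) n ]) + ∑ n (λ k → sumOver (2 ∷ ls) (λ ℓ → [ ℓ ℕ∣.∣? suc k ]))
      ≡⟨ cong₂ _+_ (sym (φ-∑ n)) (∑-sumOver n (2 ∷ ls) (λ k ℓ → [ ℓ ℕ∣.∣? suc k ])) ⟩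
    + φ n + (multiples n 2 + sumOver ls (multiples n)) ∎
    where
    open ≤-Reasoning
    ls = oddPrimeDivisors n
    covered : ∀ k → 1ℤ ≤ [ coprime? k n ] + sumOver (2 ∷ ls) (λ ℓ → [ ℓ ℕ∣.∣? k ])
    covered k with coprime? k n
    ... | yes _ = +-mono-≤ (≤-refl {1ℤ}) (sumOver-nonNeg (2 ∷ ls) (λ ℓ → []-nonNeg (ℓ ℕ∣.∣? k)))
    ... | no ¬coprime = +-mono-≤ (≤-refl {0ℤ}) (sumOver-≥1 {2 ∷ ls} (ℕ∣._∣? k) (common-prime∈ k n ¬coprime))

  -- If all w odd prime divisors exceeded 12 w, their multiples up to n would number at most w · n /
  -- (12 w) = n / 12. Together with the n / 2 even numbers this would leave φ(n) ≥ 5 n / 12.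
  small-odd-prime-divisor : ∀ n .{{_ : NonZero n}} → 2 ℕ∣.∣ n → 12 ℕ.* φ n ℕ.< 5 ℕ.* n →
    ∃ λ r → r ∈ oddPrimeDivisors n × r ℕ.≤ 12 ℕ.* length (oddPrimeDivisors n)
  small-odd-prime-divisor n 2∣n 12φ<5n with Any.any? (ℕₚ._≤? 12 ℕ.* length (oddPrimeDivisors n)) (oddPrimeDivisors n)
  ... | yes found = find found
  ... | no none = contradiction (+<+ 12φ<5n) (≤⇒≯ 5n≤12φ)
    where
    ls = oddPrimeDivisors n
    w = length ls
    S = sumOver ls (multiples n)
    12wS≤wn : + 12 * + w * S ≤ + w * + n
    12wS≤wn = sumOver-≤ (+ 12 * + w) (All.zipWith
      (λ {ℓ} (large , ℓ-prime , ℓ∣n) → let instance _ = prime⇒nonZero ℓ-prime in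
        ≤-trans (*-monoʳ-≤-nonNeg (multiples n ℓ) {{nonNegative (∑-nonNeg n (λ k _ → []-nonNeg (ℓ ℕ∣.∣? suc k)))}}
          (subst (_≤ + ℓ) (pos-* 12 w) (+≤+ (ℕₚ.<⇒≤ (ℕₚ.≰⇒> large)))))
        (≤-reflexive (multiples-* ℓ∣n)))
      (Allₚ.¬Any⇒All¬ ls none , oddPrimeDivisors-all n))
    12S≤n : + 12 * S ≤ + n
    12S≤n = cancel ls refl
      where
      -- The factor w can be cancelled only when it is nonzero; for w = 0 the sum S is empty.
      cancel : ∀ ks → ls ≡ ks → + 12 * S ≤ + n
      cancel [] eq = subst (_≤ + n) (sym (cong (λ ks → + 12 * sumOver ks (multiples n)) eq)) (+≤+ z≤n)
      cancel (k ∷ ks) eq = *-cancelˡ-≤-pos (+ 12 * S) (+ n) (+ w) {{subst (λ ks → Positive (+ length ks)) (sym eq) _}}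
        (subst (_≤ + w * + n) (assoc (+ w) S) 12wS≤wn)
        where
        assoc : ∀ w S → + 12 * w * S ≡ w * (+ 12 * S)
        assoc = solve-∀
    5n≤12φ : + (5 ℕ.* n) ≤ + (12 ℕ.* φ n)
    5n≤12φ = 0≤i-j⇒j≤i (subst (0ℤ ≤_) identity (+-mono-≤ (*-monoˡ-≤-nonNeg (+ 12) (i≤j⇒0≤j-i (n≤φ+multiples n))) (i≤j⇒0≤j-i 12S≤n)))
      where
      eq : ∀ n φ h S → + 12 * (φ + (h + S) - n) + (n - + 12 * S) ≡ + 12 * φ - + 5 * n + + 6 * (+ 2 * h - n)
      eq = solve-∀
      identity : + 12 * (+ φ n + (multiples n 2 + S) - + n) + (+ n - + 12 * S) ≡ + (12 ℕ.* φ n) - + (5 ℕ.* n)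
      identity = trans (eq (+ n) (+ φ n) (multiples n 2) S) (trans
        (cong (λ z → + 12 * + φ n - + 5 * + n + + 6 * z) (trans (cong (_- + n) (multiples-* 2∣n)) (+-inverseʳ (+ n))))
        (trans (+-identityʳ _) (sym (cong₂ _-_ (pos-* 12 (φ n)) (pos-* 5 n)))))

  -- Powers, parity and the numerical margins.

  ^-distribʳ-* : ∀ i j k → (i * j) ^ k ≡ i ^ k * j ^ k
  ^-distribʳ-* i j zero    = refl
  ^-distribʳ-* i j (suc k) = trans (cong (i * j *_) (^-distribʳ-* i j k)) (medial i j (i ^ k) (j ^ k))
    where
    medial : ∀ i j k l → i * j * (k * l) ≡ i * k * (j * l)
    medial = solve-∀

  parity : ∀ n → (∃ λ m → n ≡ m ℕ.+ m) ⊎ (∃ λ m → n ≡ suc (m ℕ.+ m))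
  parity zero = inj₁ (0 , refl)
  parity (suc n) with parity n
  ... | inj₁ (m , refl) = inj₂ (m , refl)
  ... | inj₂ (m , refl) = inj₁ (suc m , cong suc (sym (ℕₚ.+-suc m m)))

  odd-prime : ∀ {p} → Prime p → 2 ℕ.< p → ∃ λ m → p ≡ suc (m ℕ.+ m)
  odd-prime {p} p-prime 2<p with parity p
  ... | inj₂ odd = odd
  ... | inj₁ (m , refl) with prime⇒irreducible p-prime (ℕ∣.divides {2} m (double m))
    where
    double : ∀ m → m ℕ.+ m ≡ m ℕ.* 2
    double = ℕ-solve-∀
  ... | inj₁ ()
  ... | inj₂ 2≡p = contradiction 2≡p (ℕₚ.<⇒≢ 2<p)

  -- With w = j + 32, raising w by one multiplies the left side by 9 ((w + 1) / w)² ≤ 18 and the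
  -- right side by w + 3 ≥ 35.
  factorial-growth : ∀ K j → K ℕ.* (32 ℕ.* 32) ℕ.* (3 ℕ.^ 32 ℕ.* 3 ℕ.^ 32) ℕ.< 34 ! →
    K ℕ.* ((j ℕ.+ 32) ℕ.* (j ℕ.+ 32)) ℕ.* (3 ℕ.^ (j ℕ.+ 32) ℕ.* 3 ℕ.^ (j ℕ.+ 32)) ℕ.< (2 ℕ.+ (j ℕ.+ 32)) !
  factorial-growth K zero    base = base
  factorial-growth K (suc j) base = begin-strict
    K ℕ.* (suc w ℕ.* suc w) ℕ.* (3 ℕ.* t ℕ.* (3 ℕ.* t)) ≡⟨ regroup K w t ⟩
    9 ℕ.* (suc w ℕ.* suc w) ℕ.* (K ℕ.* (t ℕ.* t))       ≤⟨ ℕₚ.*-monoˡ-≤ (K ℕ.* (t ℕ.* t)) squares ⟩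
    (3 ℕ.+ w) ℕ.* (w ℕ.* w) ℕ.* (K ℕ.* (t ℕ.* t))       ≡⟨ regroup′ (3 ℕ.+ w) (w ℕ.* w) K (t ℕ.* t) ⟩
    (3 ℕ.+ w) ℕ.* (K ℕ.* (w ℕ.* w) ℕ.* (t ℕ.* t))       <⟨ ℕₚ.*-monoʳ-< (3 ℕ.+ w) (factorial-growth K j base) ⟩
    (3 ℕ.+ w) !                                         ∎
    where
    open ℕₚ.≤-Reasoning
    w = j ℕ.+ 32
    t = 3 ℕ.^ w
    32≤w : 32 ℕ.≤ w
    32≤w = ℕₚ.m≤n+m 32 j
    regroup : ∀ K w t → K ℕ.* (suc w ℕ.* suc w) ℕ.* (3 ℕ.* t ℕ.* (3 ℕ.* t)) ≡ 9 ℕ.* (suc w ℕ.* suc w) ℕ.* (K ℕ.* (t ℕ.* t))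
    regroup = ℕ-solve-∀
    regroup′ : ∀ a b c d → a ℕ.* b ℕ.* (c ℕ.* d) ≡ a ℕ.* (c ℕ.* b ℕ.* d)
    regroup′ = ℕ-solve-∀
    squares : 9 ℕ.* (suc w ℕ.* suc w) ℕ.≤ (3 ℕ.+ w) ℕ.* (w ℕ.* w)
    squares = begin
      9 ℕ.* (suc w ℕ.* suc w)                   ≡⟨ expand w ⟩
      9 ℕ.* (w ℕ.* w ℕ.+ (w ℕ.+ w ℕ.+ 1))       ≤⟨ ℕₚ.*-monoʳ-≤ 9 (ℕₚ.+-monoʳ-≤ (w ℕ.* w) (ℕₚ.+-monoʳ-≤ (w ℕ.+ w) (ℕₚ.≤-trans (s≤s z≤n) 32≤w))) ⟩
      9 ℕ.* (w ℕ.* w ℕ.+ (w ℕ.+ w ℕ.+ w))       ≡⟨ cong (λ z → 9 ℕ.* (w ℕ.* w ℕ.+ z)) (triple w) ⟩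
      9 ℕ.* (w ℕ.* w ℕ.+ 3 ℕ.* w)               ≤⟨ ℕₚ.*-monoʳ-≤ 9 (ℕₚ.+-monoʳ-≤ (w ℕ.* w) (ℕₚ.*-monoˡ-≤ w (ℕₚ.≤-trans (ℕₚ.m≤m+n 3 29) 32≤w))) ⟩
      9 ℕ.* (w ℕ.* w ℕ.+ w ℕ.* w)               ≡⟨ collect (w ℕ.* w) ⟩
      18 ℕ.* (w ℕ.* w)                          ≤⟨ ℕₚ.*-monoˡ-≤ (w ℕ.* w) (ℕₚ.≤-trans (ℕₚ.m≤m+n 18 14) (ℕₚ.≤-trans 32≤w (ℕₚ.m≤n+m w 3))) ⟩
      (3 ℕ.+ w) ℕ.* (w ℕ.* w)                   ∎
      where
      expand : ∀ w → 9 ℕ.* (suc w ℕ.* suc w) ≡ 9 ℕ.* (w ℕ.* w ℕ.+ (w ℕ.+ w ℕ.+ 1))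
      expand = ℕ-solve-∀
      triple : ∀ w → w ℕ.+ w ℕ.+ w ≡ 3 ℕ.* w
      triple = ℕ-solve-∀
      collect : ∀ s → 9 ℕ.* (s ℕ.+ s) ≡ 18 ℕ.* s
      collect = ℕ-solve-∀

  -- 73728 = 4² · 24² · 8 collects the constants of the sieve, of the exponent and of p ≤ 2 (p - 1).
  sieve-margin : ∀ {n w} → 2 ℕ.^ 128 ℕ.≤ n → (2 ℕ.+ w) ! ℕ.≤ n → 73728 ℕ.* (w ℕ.* w) ℕ.* (3 ℕ.^ w ℕ.* 3 ℕ.^ w) ℕ.< n
  -- Up to w = 31 the left side stays below 2^128; at w = 31 the factorial 33! would still be too
  -- small. From w = 32 on the factorial wins.
  sieve-margin {n} {w} 2^128≤n [2+w]!≤n with ℕₚ.≤-total w 31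
  ... | inj₁ w≤31 = ℕₚ.≤-<-trans
    (ℕₚ.*-mono-≤ (ℕₚ.*-monoʳ-≤ 73728 (ℕₚ.*-mono-≤ w≤31 w≤31)) (ℕₚ.*-mono-≤ t≤ t≤))
    (ℕₚ.<-≤-trans (toWitness {a? = 73728 ℕ.* (31 ℕ.* 31) ℕ.* (3 ℕ.^ 31 ℕ.* 3 ℕ.^ 31) ℕₚ.<? 2 ℕ.^ 128} _) 2^128≤n)
    where
    t≤ : 3 ℕ.^ w ℕ.≤ 3 ℕ.^ 31
    t≤ = ℕₚ.^-monoʳ-≤ 3 w≤31
  ... | inj₂ 31≤w with ℕₚ.m≤n⇒m<n∨m≡n 31≤w
  ... | inj₂ refl = ℕₚ.<-≤-trans (toWitness {a? = 73728 ℕ.* (31 ℕ.* 31) ℕ.* (3 ℕ.^ 31 ℕ.* 3 ℕ.^ 31) ℕₚ.<? 2 ℕ.^ 128} _) 2^128≤n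
  ... | inj₁ 32≤w = ℕₚ.<-≤-trans (subst
      (λ v → 73728 ℕ.* (v ℕ.* v) ℕ.* (3 ℕ.^ v ℕ.* 3 ℕ.^ v) ℕ.< (2 ℕ.+ v) !) (ℕₚ.m∸n+n≡m 32≤w)
      (factorial-growth 73728 (w ℕ.∸ 32) (toWitness {a? = 73728 ℕ.* (32 ℕ.* 32) ℕ.* (3 ℕ.^ 32 ℕ.* 3 ℕ.^ 32) ℕₚ.<? 34 !} _))) [2+w]!≤n

  -- Multiplying the goal by (a t)² allows the lower bound n / (a t) for N to be inserted without
  -- division; after that a factor n³ is common to both sides. Here a is the constant of the sieve,
  -- b that of the exponent and c that of p³.
  second-moment-margin : ∀ a b c {w t n N e q} → e ℕ.≤ b ℕ.* w → n ℕ.≤ a ℕ.* t ℕ.* N → q ℕ.≤ c ℕ.* (n ℕ.* n ℕ.* n) →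
    (a ℕ.* a) ℕ.* (b ℕ.* b) ℕ.* c ℕ.* (w ℕ.* w) ℕ.* (t ℕ.* t) ℕ.< n → e ℕ.* e ℕ.* q ℕ.< n ℕ.* n ℕ.* (N ℕ.* N)
  second-moment-margin a b c {w} {t} {n} {N} {e} {q} e≤ n≤ q≤ margin =
    ℕₚ.*-cancelˡ-< (a ℕ.* t ℕ.* (a ℕ.* t)) _ _ (begin-strict
      a ℕ.* t ℕ.* (a ℕ.* t) ℕ.* (e ℕ.* e ℕ.* q)
        ≤⟨ ℕₚ.*-monoʳ-≤ (a ℕ.* t ℕ.* (a ℕ.* t)) (ℕₚ.*-mono-≤ (ℕₚ.*-mono-≤ e≤ e≤) q≤) ⟩
      a ℕ.* t ℕ.* (a ℕ.* t) ℕ.* (b ℕ.* w ℕ.* (b ℕ.* w) ℕ.* (c ℕ.* (n ℕ.* n ℕ.* n)))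
        ≡⟨ regroup a b c w t (n ℕ.* n ℕ.* n) ⟩
      (a ℕ.* a) ℕ.* (b ℕ.* b) ℕ.* c ℕ.* (w ℕ.* w) ℕ.* (t ℕ.* t) ℕ.* (n ℕ.* n ℕ.* n)
        <⟨ ℕₚ.*-monoˡ-< (n ℕ.* n ℕ.* n) {{n³≢0}} margin ⟩
      n ℕ.* (n ℕ.* n ℕ.* n)
        ≡⟨ regroup′ n ⟩
      n ℕ.* n ℕ.* (n ℕ.* n)
        ≤⟨ ℕₚ.*-monoʳ-≤ (n ℕ.* n) (ℕₚ.*-mono-≤ n≤ n≤) ⟩
      n ℕ.* n ℕ.* (a ℕ.* t ℕ.* N ℕ.* (a ℕ.* t ℕ.* N))
        ≡⟨ regroup″ (n ℕ.* n) (a ℕ.* t) N ⟩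
      a ℕ.* t ℕ.* (a ℕ.* t) ℕ.* (n ℕ.* n ℕ.* (N ℕ.* N)) ∎)
    where
    open ℕₚ.≤-Reasoning
    n³≢0 : NonZero (n ℕ.* n ℕ.* n)
    n³≢0 = let instance _ = ℕ.>-nonZero (ℕₚ.≤-<-trans z≤n margin) in ℕₚ.m*n≢0 (n ℕ.* n) n {{ℕₚ.m*n≢0 n n}}
    regroup : ∀ a b c w t m → a ℕ.* t ℕ.* (a ℕ.* t) ℕ.* (b ℕ.* w ℕ.* (b ℕ.* w) ℕ.* (c ℕ.* m))
              ≡ (a ℕ.* a) ℕ.* (b ℕ.* b) ℕ.* c ℕ.* (w ℕ.* w) ℕ.* (t ℕ.* t) ℕ.* m
    regroup = ℕ-solve-∀
    regroup′ : ∀ n → n ℕ.* (n ℕ.* n ℕ.* n) ≡ n ℕ.* n ℕ.* (n ℕ.* n)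
    regroup′ = ℕ-solve-∀
    regroup″ : ∀ m s N → m ℕ.* (s ℕ.* N ℕ.* (s ℕ.* N)) ≡ s ℕ.* s ℕ.* (m ℕ.* (N ℕ.* N))
    regroup″ = ℕ-solve-∀

  -- Odd powers of non-residues as QNRNPs, and one that is coprime to p - 1.

  module _ {n : ℕ} (p-prime : Prime (suc n)) where
    private
      p = suc n

    ≈⇒≡mod : ∀ {a b} → a ≈[ p ] b → p ℕ∣.∣ ∣ a - b ∣
    ≈⇒≡mod h = ≈0⇒∣ᵤ (≈⇒-≈0 h)

    ≡mod⇒≈ : ∀ {a b} → p ℕ∣.∣ ∣ a - b ∣ → a ≈[ p ] b
    ≡mod⇒≈ h = -≈0⇒≈ (∣ᵤ⇒≈0 h)

    unit-<p : ∀ {k} → 0 ℕ.< k → k ℕ.< p → IsUnitMod p (+ k)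
    unit-<p 0<k k<p = cong +_ (coprime⇒gcd≡1 (Coprimality.sym
      (prime⇒coprime p-prime {{ℕ.>-nonZero 0<k}} k<p)))

    -- The q classes of powers of a primitive root would have to exhaust the n units.
    ¬primitive : ∀ {g q} .{{_ : NonZero q}} → q ℕ.< n → g ^ q ≈[ p ] 1ℤ → ¬ IsPrimitiveRoot p g
    ¬primitive {g} {q} q<n g^q≈1 (_ , generates) =
      contradiction (Finₚ.injective⇒≤ log-injective) (ℕₚ.<⇒≱ q<n)
      where
      unit : (i : Fin n) → IsUnitMod p (+ suc (toℕ i))
      unit i = unit-<p (s≤s z≤n) (s≤s (Finₚ.toℕ<n i))
      exponent : Fin n → ℕ
      exponent i = proj₁ (generates (+ suc (toℕ i)) (unit i))
      log : Fin n → Fin q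
      log i = fromℕ< (m%n<n (exponent i) q)
      g^k≈g^k%q : ∀ k → g ^ k ≈[ p ] g ^ (k ℕ.% q)
      g^k≈g^k%q k = ≈-trans (≡⇒≈ (trans (cong (g ^_) (m≡m%n+[m/n]*n k q)) (^-distribˡ-+-* g (k ℕ.% q) (k ℕ./ q ℕ.* q))))
        (≈-trans (≈-*ˡ (g ^ (k ℕ.% q)) (≈-trans (≡⇒≈ (trans (cong (g ^_) (ℕₚ.*-comm (k ℕ./ q) q)) (sym (^-*-assoc g q (k ℕ./ q)))))
          (≈-trans (≈-^ (k ℕ./ q) g^q≈1) (≡⇒≈ (^-zeroˡ (k ℕ./ q)))))) (≡⇒≈ (*-identityʳ (g ^ (k ℕ.% q)))))
      log-≈ : ∀ i → g ^ toℕ (log i) ≈[ p ] + suc (toℕ i)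
      log-≈ i = ≈-trans (≡⇒≈ (cong (g ^_) (Finₚ.toℕ-fromℕ< (m%n<n (exponent i) q))))
        (≈-trans (≈-sym (g^k≈g^k%q (exponent i))) (≡mod⇒≈ (proj₂ (generates (+ suc (toℕ i)) (unit i)))))
      log-injective : Injective _≡_ _≡_ log
      log-injective {i} {j} eq = Finₚ.toℕ-injective (ℕₚ.suc-injective (≈⇒≡ (s≤s (Finₚ.toℕ<n i)) (s≤s (Finₚ.toℕ<n j))
        (≈-trans (≈-sym (log-≈ i)) (≈-trans (≡⇒≈ (cong (λ k → g ^ toℕ k) eq)) (log-≈ j)))))

    module _ {y : ℤ} {r : ℕ} (nonsquare-y : ∀ x → ¬ x * x ≈[ p ] y) (r-prime : Prime r) (2<r : 2 ℕ.< r) (r∣n : r ℕ∣.∣ n)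
             (0<n : 0 ℕ.< n) where

      private
        y≉0 : ¬ y ≈[ p ] 0ℤ
        y≉0 h = nonsquare-y 0ℤ (≈-sym h)

      odd-power-QNRNP : ∀ {k z} → 0 ℕ.< k → k ℕ.< p → ¬ z ≈[ p ] 0ℤ → y ^ r * z ^ (r ℕ.+ r) ≈[ p ] + k → IsQNRNP p (+ k)
      odd-power-QNRNP {k} {z} 0<k k<p z≉0 h = (unit-<p 0<k k<p , nonresidue) , nonprimitive
        where
        half = odd-prime r-prime 2<r
        s = proj₁ half
        -- With r = 2 s + 1 the element equals y u², so a square root x of it would make x / u a
        -- square root of y.
        u = y ^ s * z ^ r
        inv = inverse {a = u} p-prime (≉0-* {a = y ^ s} p-prime (≉0-^ s p-prime y≉0) (≉0-^ r p-prime z≉0))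
        v = proj₁ inv
        nonresidue : ¬ (∃ λ x → p ℕ∣.∣ ∣ x * x - + k ∣)
        nonresidue (x , x²≡k) = nonsquare-y (x * v) (≈-trans (≡⇒≈ (square x v)) (≈-trans
          (≈-*ʳ (v * v) (≈-trans (≡mod⇒≈ {x * x} {+ k} x²≡k) (≈-trans (≈-sym h) (≡⇒≈ as-square))))
          (≈-trans (≡⇒≈ (regroup y u v)) (≈-trans (≈-*ˡ y (≈-* (proj₂ inv) (proj₂ inv))) (≡⇒≈ (*-identityʳ y))))))
          where
          square : ∀ x v → x * v * (x * v) ≡ x * x * (v * v)
          square = solve-∀
          regroup : ∀ y u v → y * (u * u) * (v * v) ≡ y * (u * v * (u * v))
          regroup = solve-∀
          shuffle : ∀ y a b → (y * (a * a)) * (b * b) ≡ y * ((a * b) * (a * b))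
          shuffle = solve-∀
          as-square : y ^ r * z ^ (r ℕ.+ r) ≡ y * (u * u)
          as-square = trans (cong₂ _*_
              (trans (cong (y ^_) (proj₂ half)) (cong (y *_) (^-distribˡ-+-* y s s))) (^-distribˡ-+-* z r r))
            (shuffle y (y ^ s) (z ^ r))
        nonprimitive : ¬ IsPrimitiveRoot p (+ k)
        nonprimitive = ¬primitive {{q≢0}} q<n
          (≈-trans (≈-^ q (≈-trans (≈-sym h) (≡⇒≈ as-power)))
          (≈-trans (≡⇒≈ (trans (^-*-assoc (y * (z * z)) r q) (cong (λ k → (y * (z * z)) ^ k) (trans (ℕₚ.*-comm r q) (sym n≡qr)))))
            (fermat p-prime (≉0-* {a = y} p-prime y≉0 (≉0-* {a = z} p-prime z≉0 z≉0)))))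
          where
          q = ℕ∣.quotient r∣n
          n≡qr : n ≡ q ℕ.* r
          n≡qr = ℕ∣._∣_.equality r∣n
          q≢0 : NonZero q
          q≢0 = ℕₚ.m*n≢0⇒m≢0 q {r} {{ℕ.>-nonZero (subst (0 ℕ.<_) n≡qr 0<n)}}
          q<n : q ℕ.< n
          q<n = subst₂ ℕ._<_ (ℕₚ.*-identityʳ q) (sym n≡qr) (ℕₚ.*-monoʳ-< q {{q≢0}} (ℕₚ.<-trans (s≤s (s≤s z≤n)) 2<r))
          as-power : y ^ r * z ^ (r ℕ.+ r) ≡ (y * (z * z)) ^ r
          as-power = trans (cong (y ^ r *_) (trans (^-distribˡ-+-* z r r) (sym (^-distribʳ-* z z r))))
            (sym (^-distribʳ-* y (z * z) r))

  QNRNP-exists : ∀ {n} → Prime (suc n) → 2 ℕ.^ 128 ℕ.≤ n → 12 ℕ.* φ n ℕ.< 5 ℕ.* n →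
    ∃ λ g → 1 ℕ.< g × g ℕ.< n × Coprime g n × IsQNRNP (suc n) (+ g)
  QNRNP-exists {n} p-prime 2^128≤n 12φ<5n = conclude (represented {n} {e} p-prime c c≉0 m≤p X? large)
    where
    p = suc n
    4≤n : 4 ℕ.≤ n
    4≤n = ℕₚ.≤-trans (toWitness {a? = 4 ℕₚ.≤? 2 ℕ.^ 128} _) 2^128≤n
    2≤n : 2 ℕ.≤ n
    2≤n = ℕₚ.≤-trans (ℕₚ.m≤m+n 2 2) 4≤n
    0<n : 0 ℕ.< n
    0<n = ℕₚ.<-trans (s≤s z≤n) 2≤n
    instance
      n≢0 : NonZero n
      n≢0 = ℕ.>-nonZero 0<n
    odd-p = odd-prime p-prime (s≤s 2≤n)
    m = proj₁ odd-p
    n≡m+m : n ≡ m ℕ.+ m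
    n≡m+m = ℕₚ.suc-injective (proj₂ odd-p)
    double : ∀ m → m ℕ.+ m ≡ m ℕ.* 2
    double = ℕ-solve-∀
    2∣n : 2 ℕ∣.∣ n
    2∣n = ℕ∣.divides m (trans n≡m+m (double m))
    m≤p : m ℕ.≤ p
    m≤p = ℕₚ.≤-trans (ℕₚ.m≤m+n m m) (ℕₚ.≤-trans (ℕₚ.≤-reflexive (sym n≡m+m)) (ℕₚ.n≤1+n n))

    odds ls : List ℕ
    odds = oddPrimeDivisors n
    ls = 2 ∷ odds
    w = length odds
    distinct : DistinctPrimes ls
    distinct = (oddPrimeDivisors->2 n ∷ oddPrimeDivisors-sorted n) , (prime[2] ∷ All.map proj₁ (oddPrimeDivisors-all n))
    ls∣n : All (ℕ∣._∣ n) ls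
    ls∣n = 2∣n ∷ All.map proj₂ (oddPrimeDivisors-all n)
    product∣n : product ls ℕ∣.∣ n
    product∣n = product-∣ distinct ls∣n
    -- The sieve is periodic modulo the product of the primes, and [0, n) consists of k full
    -- periods.
    k = ℕ∣.quotient product∣n
    H = product (map ⌊_/2⌋ ls)
    -- In the comparison based at 2, the factor 2! stands for the prime 2 at the head of `ls`.
    factorial≤n : (2 ℕ.+ w) ! ℕ.≤ n
    factorial≤n = ℕₚ.≤-trans (!*product≥ 2 (oddPrimeDivisors-sorted n) (oddPrimeDivisors->2 n)) (ℕ∣.∣⇒≤ product∣n)

    sieved = half-sieve {ls} {m} (subst (λ n → All (ℕ∣._∣ n) ls) n≡m+m ls∣n)
    X = proj₁ sieved
    X? = proj₁ (proj₂ sieved)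
    N = ∣ ∑ m (λ x → [ X? x ]) ∣
    +N≡ : + N ≡ ∑ m (λ x → [ X? x ])
    +N≡ = 0≤i⇒+∣i∣≡i (∑-nonNeg m (λ x _ → []-nonNeg (X? x)))
    kH≤2N : k ℕ.* H ℕ.≤ 2 ℕ.* N
    kH≤2N = drop‿+≤+ (subst₂ _≤_
      (trans (cong (λ n → ∑ n (λ x → [ survives? ls (+ x) ])) (trans (sym n≡m+m) (ℕ∣._∣_.equality product∣n)))
        (∑-survives-multiple distinct k))
      (trans (cong (+ 2 *_) (sym +N≡)) (sym (pos-* 2 N)))
      (proj₂ (proj₂ (proj₂ sieved))))
    n≤4tN : n ℕ.≤ 4 ℕ.* 3 ℕ.^ w ℕ.* N
    n≤4tN = begin
      n                                     ≡⟨ ℕ∣._∣_.equality product∣n ⟩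
      k ℕ.* (2 ℕ.* product odds)            ≤⟨ ℕₚ.*-monoʳ-≤ k (ℕₚ.*-monoʳ-≤ 2 (product≤ (All.map ℕₚ.<⇒≤ (oddPrimeDivisors->2 n)))) ⟩
      k ℕ.* (2 ℕ.* (3 ℕ.^ w ℕ.* product (map ⌊_/2⌋ odds))) ≡⟨ regroup k (3 ℕ.^ w) (product (map ⌊_/2⌋ odds)) ⟩
      2 ℕ.* 3 ℕ.^ w ℕ.* (k ℕ.* H)           ≤⟨ ℕₚ.*-monoʳ-≤ (2 ℕ.* 3 ℕ.^ w) kH≤2N ⟩
      2 ℕ.* 3 ℕ.^ w ℕ.* (2 ℕ.* N)           ≡⟨ regroup′ (3 ℕ.^ w) N ⟩
      4 ℕ.* 3 ℕ.^ w ℕ.* N ∎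
      where
      open ℕₚ.≤-Reasoning
      regroup : ∀ k t h → k ℕ.* (2 ℕ.* (t ℕ.* h)) ≡ 2 ℕ.* t ℕ.* (k ℕ.* (1 ℕ.* h))
      regroup = ℕ-solve-∀
      regroup′ : ∀ t N → 2 ℕ.* t ℕ.* (2 ℕ.* N) ≡ 4 ℕ.* t ℕ.* N
      regroup′ = ℕ-solve-∀

    small = small-odd-prime-divisor n 2∣n 12φ<5n
    r = proj₁ small
    r∈ = proj₁ (proj₂ small)
    r-prime : Prime r
    r-prime = proj₁ (All.lookup (oddPrimeDivisors-all n) r∈)
    r∣n : r ℕ∣.∣ n
    r∣n = proj₂ (All.lookup (oddPrimeDivisors-all n) r∈)
    2<r : 2 ℕ.< r
    2<r = All.lookup (oddPrimeDivisors->2 n) r∈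
    e = r ℕ.+ r
    instance
      e≢0 : NonZero e
      e≢0 = ℕ.>-nonZero (ℕₚ.<-≤-trans (ℕₚ.<-trans (s≤s z≤n) 2<r) (ℕₚ.m≤m+n r r))
    e≤24w : e ℕ.≤ 24 ℕ.* w
    e≤24w = ℕₚ.≤-trans (ℕₚ.+-mono-≤ (proj₂ (proj₂ small)) (proj₂ (proj₂ small))) (ℕₚ.≤-reflexive (collect w))
      where
      collect : ∀ w → 12 ℕ.* w ℕ.+ 12 ℕ.* w ≡ 24 ℕ.* w
      collect = ℕ-solve-∀

    p³≤8n³ : p ℕ.* p ℕ.* p ℕ.≤ 8 ℕ.* (n ℕ.* n ℕ.* n)
    p³≤8n³ = ℕₚ.≤-trans (ℕₚ.*-mono-≤ (ℕₚ.*-mono-≤ p≤2n p≤2n) p≤2n) (ℕₚ.≤-reflexive (cube n))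
      where
      p≤2n : p ℕ.≤ n ℕ.+ n
      p≤2n = ℕₚ.+-monoˡ-≤ n 0<n
      cube : ∀ n → (n ℕ.+ n) ℕ.* (n ℕ.+ n) ℕ.* (n ℕ.+ n) ≡ 8 ℕ.* (n ℕ.* n ℕ.* n)
      cube = ℕ-solve-∀

    large : + e * + e * (+ p * + p * + p) < + n * + n * (∑ m (λ x → [ X? x ]) * ∑ m (λ x → [ X? x ]))
    large = subst₂ _<_
      (trans (pos-* (e ℕ.* e) (p ℕ.* p ℕ.* p)) (cong₂ _*_ (pos-* e e) (trans (pos-* (p ℕ.* p) p) (cong (_* + p) (pos-* p p)))))
      (trans (pos-* (n ℕ.* n) (N ℕ.* N)) (cong₂ _*_ (pos-* n n) (trans (pos-* N N) (cong₂ _*_ +N≡ +N≡))))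
      (+<+ (second-moment-margin 4 24 8 {w} {3 ℕ.^ w} e≤24w n≤4tN p³≤8n³ (sieve-margin {n} {w} 2^128≤n factorial≤n)))

    nonsquare-p = nonsquare p-prime (s≤s 2≤n)
    y = proj₁ nonsquare-p
    c = y ^ r
    c≉0 : ¬ c ≈[ p ] 0ℤ
    c≉0 = ≉0-^ r p-prime (λ h → proj₂ nonsquare-p 0ℤ (≈-sym h))

    conclude : Represented {n} {e} p-prime c c≉0 m≤p X? → ∃ λ g → 1 ℕ.< g × g ℕ.< n × Coprime g n × IsQNRNP p (+ g)
    conclude (a , b , z , a<m , b<m , Xa , Xb , z≉0 , h) = g , 1<g , g<n , coprime , qnrnp
      where
      g = a ℕ.+ suc b
      0<g : 0 ℕ.< g
      0<g = ℕₚ.<-≤-trans (s≤s z≤n) (ℕₚ.m≤n+m (suc b) a)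
      g<n : g ℕ.< n
      g<n = subst (g ℕ.<_) (sym n≡m+m) (ℕₚ.+-mono-<-≤ a<m b<m)
      qnrnp : IsQNRNP p (+ g)
      qnrnp = odd-power-QNRNP p-prime {y} {r} (proj₂ nonsquare-p) r-prime 2<r r∣n 0<n {g} {z} 0<g (ℕₚ.m<n⇒m<1+n g<n) z≉0 h
      -- The value 1 is ruled out as a square.
      1<g : 1 ℕ.< g
      1<g = ℕₚ.≤∧≢⇒< 0<g (λ 1≡g → proj₂ (proj₁ qnrnp)
        (1ℤ , ≈⇒≡mod p-prime {1ℤ * 1ℤ} {+ g} (≡⇒≈ (cong +_ 1≡g))))
      coprime : Coprime g n
      coprime = decidable-stable (coprime? g n) (λ ¬coprime → Allₚ.All¬⇒¬Any
        (All.map (λ ℓ∤g ℓ∣g → ℓ∤g (∣ᵤ⇒≈0 ℓ∣g)) (proj₁ (proj₂ (proj₂ sieved)) a b Xa Xb)) (common-prime∈ g n ¬coprime))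

-- Numerical bounds for the logarithm as a limit of Riemann sums.

module Logarithms where

  open import Defs
  open import Data.Empty using (⊥)
  open import Data.Integer.Base as ℤ using (+_)
  import Data.Integer.Properties as ℤₚ
  open import Data.Rational.Base hiding (NonZero)
  open import Data.Rational.Properties
  import Data.Rational.Unnormalised.Base as ℚᵘᵇ
  import Data.Rational.Unnormalised.Properties as ℚᵘ
  open import Level using (0ℓ)
  open import Relation.Nullary.Decidable.Core using (dec⇒maybe)
  open import Tactic.RingSolver using (solve-∀)
  open import Tactic.RingSolver.Core.AlmostCommutativeRing using (AlmostCommutativeRing; fromCommutativeRing)

  ℚ-ring : AlmostCommutativeRing 0ℓ 0ℓ
  ℚ-ring = fromCommutativeRing +-*-commutativeRing (λ x → dec⇒maybe (0ℚ ≟ x))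

  Eventually : (ℕ → Set) → Set
  Eventually P = ∃ λ N → ∀ n → N ℕ.≤ n → P n

  eventually-zip : ∀ {P Q R : ℕ → Set} → (∀ n → P n → Q n → R n) → Eventually P → Eventually Q → Eventually R
  eventually-zip f (M , p) (N , q) = M ℕ.⊔ N , λ n n≥ →
    f n (p n (ℕₚ.m⊔n≤o⇒m≤o M N n≥)) (q n (ℕₚ.m⊔n≤o⇒n≤o M N n≥))

  eventually-map : ∀ {P Q : ℕ → Set} → (∀ n → P n → Q n) → Eventually P → Eventually Q
  eventually-map f (N , p) = N , λ n n≥ → f n (p n n≥)

  eventually-small : ∀ K {η} → 0ℚ < η → Eventually (λ n → (+ 1 / suc n) * K ≤ η)
  eventually-small K {η} 0<η = N , λ n N≤n →
    1/n*K≤ {K} {η} n 0<η (≤-trans K/η≤N (fromℕ-mono (ℕₚ.m≤n⇒m≤1+n N≤n)))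
    where
    N = proj₁ (archimedean (K * inv η))
    K/η≤N = proj₂ (archimedean (K * inv η))

  fromℕ-< : ∀ {m n} → m ℕ.< n → fromℕ m < fromℕ n
  fromℕ-< {m} m<n = <-≤-trans
    (subst₂ _<_ (+-identityʳ (fromℕ m)) (sym (fromℕ-suc m)) (+-monoʳ-< (fromℕ m) 0<1)) (fromℕ-mono m<n)

  fromℕ-cancel-≤ : ∀ {m n} → fromℕ m ≤ fromℕ n → m ℕ.≤ n
  fromℕ-cancel-≤ m≤n = ℕₚ.≮⇒≥ λ n<m → <-irrefl refl (<-≤-trans (fromℕ-< n<m) m≤n)

  /-*-fromℕ : ∀ k m → (+ k / suc m) * fromℕ (suc m) ≡ fromℕ k
  /-*-fromℕ k m = toℚᵘ-injective
    (ℚᵘ.≃-trans (toℚᵘ-homo-* (+ k / suc m) (fromℕ (suc m)))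
    (ℚᵘ.≃-trans (ℚᵘ.*-cong (toℚᵘ-fromℚᵘ (ℚᵘᵇ.mkℚᵘ (+ k) m)) (toℚᵘ-fromℚᵘ (ℚᵘᵇ.mkℚᵘ (+ suc m) 0)))
    (ℚᵘ.≃-trans (ℚᵘᵇ.*≡* (trans (ℤₚ.*-identityʳ _) (cong (λ d → + k ℤ.* + d) (sym (ℕₚ.*-identityʳ (suc m))))))
      (ℚᵘ.≃-sym (toℚᵘ-fromℚᵘ (ℚᵘᵇ.mkℚᵘ (+ k) 0))))))

  infixr 8 _^_

  _^_ : ℚ → ℕ → ℚ
  c ^ zero  = 1ℚ
  c ^ suc k = c * c ^ k

  -- A fraction c = u / v enters as c v = u, so that large powers are compared as natural numbers
  -- and never as normalised rationals.
  ^-fraction : ∀ {c u v} → c * fromℕ v ≡ fromℕ u → ∀ k → c ^ k * fromℕ (v ℕ.^ k) ≡ fromℕ (u ℕ.^ k)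
  ^-fraction eq zero = refl
  ^-fraction {c} {u} {v} eq (suc k) = trans (cong (c * c ^ k *_) (fromℕ-* v (v ℕ.^ k)))
    (trans (medial c (c ^ k) (fromℕ v) (fromℕ (v ℕ.^ k)))
    (trans (cong₂ _*_ eq (^-fraction {c} {u} {v} eq k)) (sym (fromℕ-* u (u ℕ.^ k)))))
    where
    medial : ∀ a b x y → a * b * (x * y) ≡ a * x * (b * y)
    medial = solve-∀ ℚ-ring

  fraction-≤ : ∀ {x y a b c d} → 0 ℕ.< b → 0 ℕ.< d → x * fromℕ b ≡ fromℕ a → y * fromℕ d ≡ fromℕ c →
               a ℕ.* d ℕ.≤ c ℕ.* b → x ≤ y
  fraction-≤ {x} {y} {a} {b} {c} {d} 0<b 0<d x≡ y≡ ad≤cb =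
    *-cancelʳ-≤-pos (fromℕ b * fromℕ d) {{positive (0<* (fromℕ-< 0<b) (fromℕ-< 0<d))}}
      (subst₂ _≤_
        (trans (fromℕ-* a d) (trans (cong (_* fromℕ d) (sym x≡)) (*-assoc x (fromℕ b) (fromℕ d))))
        (trans (fromℕ-* c b) (trans (cong (_* fromℕ b) (sym y≡)) (swap y (fromℕ d) (fromℕ b))))
        (fromℕ-mono ad≤cb))
    where
    swap : ∀ y d b → y * d * b ≡ y * (b * d)
    swap = solve-∀ ℚ-ring

  -- A piecewise linear substitute for log: its slope is c⁻ⁱ between cⁱ and cⁱ⁺¹
  -- (b = 1/c, and fuel bounds the number of pieces).
  module PiecewiseLog {c b : ℚ} (1≤c : 1ℚ ≤ c) (cb≡1 : c * b ≡ 1ℚ) where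

    0<c : 0ℚ < c
    0<c = <-≤-trans 0<1 1≤c

    private
      instance
        c-pos : Positive c
        c-pos = positive 0<c

        c-nonNeg : NonNegative c
        c-nonNeg = nonNegative (<⇒≤ 0<c)

    c*tb≡t : ∀ t → c * (t * b) ≡ t
    c*tb≡t t = trans (swap c t b) (trans (cong (t *_) cb≡1) (*-identityʳ t))
      where
      swap : ∀ c t b → c * (t * b) ≡ t * (c * b)
      swap = solve-∀ ℚ-ring

    scale-≤ : ∀ {s t} → c * s ≤ t → s ≤ t * b
    scale-≤ {s} {t} h = *-cancelˡ-≤-pos c (subst (c * s ≤_) (sym (c*tb≡t t)) h)

    ≤-scale : ∀ {s t} → s ≤ c * t → s * b ≤ t
    ≤-scale {s} {t} h = *-cancelˡ-≤-pos c (subst (_≤ c * t) (sym (c*tb≡t s)) h)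

    θ : ℕ → ℚ → ℚ
    θ zero    t = t - 1ℚ
    θ (suc i) t with t ≤? c
    ... | yes _ = t - 1ℚ
    -- Every complete piece contributes slope times length, c⁻ⁱ (cⁱ⁺¹ - cⁱ) = c - 1; rescaling by b
    -- shifts the remaining pieces by one.
    ... | no  _ = (c - 1ℚ) + θ i (t * b)

    θ-1 : ∀ i → θ i 1ℚ ≡ 0ℚ
    θ-1 zero = refl
    θ-1 (suc i) with 1ℚ ≤? c
    ... | yes _   = refl
    ... | no  1≰c = contradiction 1≤c 1≰c

    private
      1≤tb : ∀ {t} → ¬ t ≤ c → 1ℚ ≤ t * b
      1≤tb {t} t≰c = scale-≤ (subst (_≤ t) (sym (*-identityʳ c)) (<⇒≤ (≰⇒> t≰c)))

      *-≥ : ∀ {t d} → 1ℚ ≤ t → 0ℚ ≤ d → d ≤ t * d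
      *-≥ {t} {d} 1≤t 0≤d = subst (_≤ t * d) (*-identityˡ d) (*-monoʳ-≤-nonNeg d {{nonNegative 0≤d}} 1≤t)

      tb-sb : ∀ t s → c * (t * b - s * b) ≡ t - s
      tb-sb t s = trans (distrib c b t s) (cong₂ _-_ (c*tb≡t t) (c*tb≡t s))
        where
        distrib : ∀ c b t s → c * (t * b - s * b) ≡ c * (t * b) - c * (s * b)
        distrib = solve-∀ ℚ-ring

      tb-1 : ∀ t → c * (t * b - 1ℚ) ≡ t - c
      tb-1 t = trans (distrib c (t * b)) (cong (_- c) (c*tb≡t t))
        where
        distrib : ∀ c u → c * (u - 1ℚ) ≡ c * u - c
        distrib = solve-∀ ℚ-ring

      shift : ∀ t s → t - s ≡ (t - 1ℚ) - (s - 1ℚ)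
      shift = solve-∀ ℚ-ring

      θ-from-1 : ∀ i t → θ i t - θ i 1ℚ ≡ θ i t
      θ-from-1 i t = trans (cong (λ z → θ i t - z) (θ-1 i)) (+-identityʳ (θ i t))

    -- The slope of θ at u is at least 1/u, hence at least 1/t on [s, t]. Exhausted fuel only keeps
    -- the slope larger, so t is unrestricted.
    θ-lower : ∀ i {s t} → 1ℚ ≤ s → s ≤ t → t - s ≤ t * (θ i t - θ i s)
    θ-lower zero {s} {t} 1≤s s≤t = subst (λ z → t - s ≤ t * z) (shift t s) (*-≥ (≤-trans 1≤s s≤t) (≤⇒0≤- s≤t))
    θ-lower (suc i) {s} {t} 1≤s s≤t with t ≤? c | s ≤? c
    ... | yes t≤c | yes s≤c = subst (λ z → t - s ≤ t * z) (shift t s) (*-≥ (≤-trans 1≤s s≤t) (≤⇒0≤- s≤t))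
    ... | yes t≤c | no  s≰c = contradiction (≤-trans s≤t t≤c) s≰c
    ... | no  t≰c | no  s≰c = begin
      t - s                                   ≡⟨ tb-sb t s ⟨
      c * (t * b - s * b)                     ≤⟨ *-monoˡ-≤-nonNeg c (θ-lower i (1≤tb s≰c) (≤-scale (subst (s ≤_) (sym (c*tb≡t t)) s≤t))) ⟩
      c * (t * b * (θ i (t * b) - θ i (s * b))) ≡⟨ *-assoc c (t * b) _ ⟨
      c * (t * b) * (θ i (t * b) - θ i (s * b)) ≡⟨ cong₂ _*_ (c*tb≡t t) (regroup (c - 1ℚ) (θ i (t * b)) (θ i (s * b))) ⟩
      t * (((c - 1ℚ) + θ i (t * b)) - ((c - 1ℚ) + θ i (s * b))) ∎
      where
      open ≤-Reasoning
      regroup : ∀ d x y → x - y ≡ (d + x) - (d + y)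
      regroup = solve-∀ ℚ-ring
    -- The breakpoint c separates s from t, and the increment is split there.
    ... | no  t≰c | yes s≤c = begin
      t - s                                   ≡⟨ split t s c ⟩
      (c - s) + (t - c)                       ≤⟨ +-mono-≤ (*-≥ (≤-trans 1≤s s≤t) (≤⇒0≤- s≤c)) piece ⟩
      t * (c - s) + t * θ i (t * b)           ≡⟨ regroup t c s (θ i (t * b)) ⟩
      t * (((c - 1ℚ) + θ i (t * b)) - (s - 1ℚ)) ∎
      where
      open ≤-Reasoning
      split : ∀ t s c → t - s ≡ (c - s) + (t - c)
      split = solve-∀ ℚ-ring
      regroup : ∀ t c s x → t * (c - s) + t * x ≡ t * (((c - 1ℚ) + x) - (s - 1ℚ))
      regroup = solve-∀ ℚ-ring
      piece : t - c ≤ t * θ i (t * b)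
      piece = begin
        t - c                           ≡⟨ tb-1 t ⟨
        c * (t * b - 1ℚ)                ≤⟨ *-monoˡ-≤-nonNeg c (θ-lower i ≤-refl (1≤tb t≰c)) ⟩
        c * (t * b * (θ i (t * b) - θ i 1ℚ)) ≡⟨ cong (λ z → c * (t * b * z)) (θ-from-1 i (t * b)) ⟩
        c * (t * b * θ i (t * b))       ≡⟨ *-assoc c (t * b) _ ⟨
        c * (t * b) * θ i (t * b)       ≡⟨ cong (_* θ i (t * b)) (c*tb≡t t) ⟩
        t * θ i (t * b)                 ∎

    -- The slope of θ at u is at most c/u, hence at most c/s on [s, t]. This needs t within reach of
    -- the fuel, beyond which the slope no longer decreases.
    θ-upper : ∀ i {s t} → 1ℚ ≤ s → s ≤ t → t ≤ c ^ suc i → s * (θ i t - θ i s) ≤ c * (t - s)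
    θ-upper zero {s} {t} 1≤s s≤t t≤ = subst (λ z → s * z ≤ c * (t - s)) (shift t s)
      (*-monoʳ-≤-nonNeg (t - s) {{nonNegative (≤⇒0≤- s≤t)}} (≤-trans s≤t (subst (t ≤_) (*-identityʳ c) t≤)))
    θ-upper (suc i) {s} {t} 1≤s s≤t t≤ with t ≤? c | s ≤? c
    ... | yes t≤c | yes s≤c = subst (λ z → s * z ≤ c * (t - s)) (shift t s)
      (*-monoʳ-≤-nonNeg (t - s) {{nonNegative (≤⇒0≤- s≤t)}} s≤c)
    ... | yes t≤c | no  s≰c = contradiction (≤-trans s≤t t≤c) s≰c
    ... | no  t≰c | no  s≰c = begin
      s * (((c - 1ℚ) + θ i (t * b)) - ((c - 1ℚ) + θ i (s * b))) ≡⟨ cong₂ _*_ (sym (c*tb≡t s)) (regroup (c - 1ℚ) (θ i (t * b)) (θ i (s * b))) ⟩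
      c * (s * b) * (θ i (t * b) - θ i (s * b)) ≡⟨ *-assoc c (s * b) _ ⟩
      c * (s * b * (θ i (t * b) - θ i (s * b))) ≤⟨ *-monoˡ-≤-nonNeg c (θ-upper i (1≤tb s≰c) (≤-scale (subst (s ≤_) (sym (c*tb≡t t)) s≤t)) (≤-scale t≤)) ⟩
      c * (c * (t * b - s * b))               ≡⟨ cong (c *_) (tb-sb t s) ⟩
      c * (t - s)                             ∎
      where
      open ≤-Reasoning
      regroup : ∀ d x y → (d + x) - (d + y) ≡ x - y
      regroup = solve-∀ ℚ-ring
    ... | no  t≰c | yes s≤c = begin
      s * (((c - 1ℚ) + θ i (t * b)) - (s - 1ℚ)) ≡⟨ regroup s c (θ i (t * b)) ⟩
      s * (c - s) + s * θ i (t * b)           ≤⟨ +-mono-≤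
        (*-monoʳ-≤-nonNeg (c - s) {{nonNegative (≤⇒0≤- s≤c)}} s≤c)
        (≤-trans (*-monoˡ-≤-nonNeg s {{nonNegative (≤-trans (<⇒≤ 0<1) 1≤s)}} piece)
          (*-monoʳ-≤-nonNeg (t - c) {{nonNegative (≤⇒0≤- (<⇒≤ (≰⇒> t≰c)))}} s≤c)) ⟩
      c * (c - s) + c * (t - c)               ≡⟨ collect t s c ⟩
      c * (t - s)                             ∎
      where
      open ≤-Reasoning
      regroup : ∀ s c x → s * (((c - 1ℚ) + x) - (s - 1ℚ)) ≡ s * (c - s) + s * x
      regroup = solve-∀ ℚ-ring
      collect : ∀ t s c → c * (c - s) + c * (t - c) ≡ c * (t - s)
      collect = solve-∀ ℚ-ring
      piece : θ i (t * b) ≤ t - c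
      piece = begin
        θ i (t * b)                 ≡⟨ trans (*-identityˡ _) (θ-from-1 i (t * b)) ⟨
        1ℚ * (θ i (t * b) - θ i 1ℚ) ≤⟨ θ-upper i ≤-refl (1≤tb t≰c) (≤-scale t≤) ⟩
        c * (t * b - 1ℚ)            ≡⟨ tb-1 t ⟩
        t - c                       ∎

    private
      suc-* : ∀ i d → fromℕ (suc i) * d ≡ d + fromℕ i * d
      suc-* i d = trans (cong (_* d) (fromℕ-suc i)) (distrib (fromℕ i) d)
        where
        distrib : ∀ i d → (i + 1ℚ) * d ≡ d + i * d
        distrib = solve-∀ ℚ-ring

      0≤c-1 : 0ℚ ≤ c - 1ℚ
      0≤c-1 = ≤⇒0≤- 1≤c

      0≤i[c-1] : ∀ i → 0ℚ ≤ fromℕ i * (c - 1ℚ)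
      0≤i[c-1] i = 0≤* (0≤fromℕ i) 0≤c-1

    θ≤ : ∀ i {t} → t ≤ c ^ suc i → θ i t ≤ fromℕ (suc i) * (c - 1ℚ)
    θ≤ zero {t} t≤ = ≤-trans (+-monoˡ-≤ (- 1ℚ) (subst (t ≤_) (*-identityʳ c) t≤)) (≤-reflexive (sym (*-identityˡ (c - 1ℚ))))
    θ≤ (suc i) {t} t≤ with t ≤? c
    ... | yes t≤c = ≤-trans (+-monoˡ-≤ (- 1ℚ) t≤c) (≤-trans (≤-reflexive (sym (+-identityʳ (c - 1ℚ))))
      (≤-trans (+-monoʳ-≤ (c - 1ℚ) (0≤i[c-1] (suc i))) (≤-reflexive (sym (suc-* (suc i) (c - 1ℚ))))))
    ... | no  t≰c = ≤-trans (+-monoʳ-≤ (c - 1ℚ) (θ≤ i (≤-scale t≤))) (≤-reflexive (sym (suc-* (suc i) (c - 1ℚ))))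

    bernoulli : ∀ i → fromℕ i * (c - 1ℚ) ≤ c ^ i - 1ℚ
    bernoulli zero = ≤-reflexive (*-zeroˡ (c - 1ℚ))
    bernoulli (suc i) = begin
      fromℕ (suc i) * (c - 1ℚ)           ≡⟨ suc-* i (c - 1ℚ) ⟩
      (c - 1ℚ) + fromℕ i * (c - 1ℚ)      ≤⟨ +-monoʳ-≤ (c - 1ℚ) (*-≥ 1≤c (0≤i[c-1] i)) ⟩
      (c - 1ℚ) + c * (fromℕ i * (c - 1ℚ)) ≤⟨ +-monoʳ-≤ (c - 1ℚ) (*-monoˡ-≤-nonNeg c (bernoulli i)) ⟩
      (c - 1ℚ) + c * (c ^ i - 1ℚ)        ≡⟨ regroup c (c ^ i) ⟩
      c * c ^ i - 1ℚ                     ∎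
      where
      open ≤-Reasoning
      regroup : ∀ c x → (c - 1ℚ) + c * (x - 1ℚ) ≡ c * x - 1ℚ
      regroup = solve-∀ ℚ-ring

    ≤θ : ∀ i {t} → c ^ i ≤ t → fromℕ i * (c - 1ℚ) ≤ θ i t
    ≤θ zero {t} 1≤t = ≤-trans (≤-reflexive (*-zeroˡ (c - 1ℚ))) (≤⇒0≤- 1≤t)
    ≤θ (suc i) {t} ≤t with t ≤? c
    -- Here cⁱ⁺¹ ≤ t ≤ c, so θ is still t - 1, and Bernoulli's inequality gives the bound.
    ... | yes _ = ≤-trans (bernoulli (suc i)) (+-monoˡ-≤ (- 1ℚ) ≤t)
    ... | no  _ = ≤-trans (≤-reflexive (suc-* i (c - 1ℚ))) (+-monoʳ-≤ (c - 1ℚ) (≤θ i (scale-≤ ≤t)))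

    module _ {x : ℚ} (1≤x : 1ℚ ≤ x) (n : ℕ) where
      private
        r h : ℚ
        r = + 1 / suc n
        h = (x - 1ℚ) * r

        t : ℕ → ℚ
        t = node x r

        0≤h : 0ℚ ≤ h
        0≤h = 0≤* (≤⇒0≤- 1≤x) (<⇒≤ (0<1/ n))

        t-suc : ∀ k → t (suc k) ≡ t k + h
        t-suc k = trans (cong (λ z → 1ℚ + z * h) (fromℕ-suc k)) (step (fromℕ k) h)
          where
          step : ∀ k h → 1ℚ + (k + 1ℚ) * h ≡ (1ℚ + k * h) + h
          step = solve-∀ ℚ-ring

        t-last : t (suc n) ≡ x
        t-last = trans (regroup (fromℕ (suc n)) x r) (trans (cong (λ z → 1ℚ + z * (x - 1ℚ)) (fromℕ*1/ n)) (final x))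
          where
          regroup : ∀ n x r → 1ℚ + n * ((x - 1ℚ) * r) ≡ 1ℚ + (n * r) * (x - 1ℚ)
          regroup = solve-∀ ℚ-ring
          final : ∀ x → 1ℚ + 1ℚ * (x - 1ℚ) ≡ x
          final = solve-∀ ℚ-ring

        1≤t : ∀ k → 1ℚ ≤ t k
        1≤t k = subst (_≤ t k) (+-identityʳ 1ℚ) (+-monoʳ-≤ 1ℚ (0≤* (0≤fromℕ k) 0≤h))

        t≤t : ∀ k → t k ≤ t (suc k)
        t≤t k = subst₂ _≤_ (+-identityʳ (t k)) (sym (t-suc k)) (+-monoʳ-≤ (t k) 0≤h)

        t≤x : ∀ k → k ℕ.≤ suc n → t k ≤ x
        t≤x k k≤ = subst (t k ≤_) t-last (+-monoʳ-≤ 1ℚ (*-monoʳ-≤-nonNeg h {{nonNegative 0≤h}} (fromℕ-mono k≤)))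

        step : ∀ k → t (suc k) - t k ≡ h
        step k = trans (cong (_- t k) (t-suc k)) (cancel (t k) h)
          where
          cancel : ∀ t h → (t + h) - t ≡ h
          cancel = solve-∀ ℚ-ring

        inv-≤ : ∀ {s u v} → 1ℚ ≤ s → u ≤ s * v → inv s * u ≤ v
        inv-≤ {s} {u} {v} 1≤s u≤ = subst (inv s * u ≤_)
          (trans (sym (*-assoc (inv s) s v)) (trans (cong (_* v) (trans (*-comm (inv s) s) (inv-* 0<s))) (*-identityˡ v)))
          (*-monoˡ-≤-nonNeg (inv s) {{nonNegative (<⇒≤ (inv-pos 0<s))}} u≤)
          where 0<s = <-≤-trans 0<1 1≤s

      -- The summand h / t k is at most the increment of θ over the step that ends at t k, and these
      -- increments telescope. The summand at t 0 = 1 has no such step and contributes h, which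
      -- tends to zero.
      riemannSum≤ : ∀ i → x ≤ c ^ suc i →
        riemannSum inv 1ℚ x (suc n) ≤ (+ 1 / suc n) * (x - 1ℚ) + fromℕ (suc i) * (c - 1ℚ)
      riemannSum≤ i x≤ = ≤-trans (telescope n) (+-mono-≤ (≤-reflexive (*-comm (x - 1ℚ) r))
          (θ≤ i (≤-trans (t≤x n (ℕₚ.n≤1+n n)) x≤)))
        where
        telescope : ∀ k → Σ[< suc k ] (λ k → inv (t k) * h) ≤ h + θ i (t k)
        telescope zero = ≤-trans (≤-reflexive (+-identityˡ _)) (≤-trans (inv-≤ (1≤t 0) (*-≥ (1≤t 0) 0≤h))
          (subst (λ z → h ≤ h + z) (sym (trans (cong (λ z → θ i (1ℚ + z)) (*-zeroˡ h)) (θ-1 i))) (≤-reflexive (sym (+-identityʳ h)))))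
        telescope (suc k) = ≤-trans (+-mono-≤ (telescope k)
            (inv-≤ (1≤t (suc k)) (subst (_≤ t (suc k) * (θ i (t (suc k)) - θ i (t k))) (step k) (θ-lower i (1≤t k) (t≤t k)))))
          (≤-reflexive (collapse h (θ i (t k)) (θ i (t (suc k)))))
          where
          collapse : ∀ h x y → (h + x) + (y - x) ≡ h + y
          collapse = solve-∀ ℚ-ring

      -- The increment of θ over the step that starts at t k is at most c times the summand h / t k.
      ≤riemannSum : ∀ i → c ^ i ≤ x → x ≤ c ^ suc i → fromℕ i * (c - 1ℚ) ≤ c * riemannSum inv 1ℚ x (suc n)
      ≤riemannSum i ≤x x≤ = ≤-trans (≤θ i ≤x) (subst (λ z → θ i z ≤ c * riemannSum inv 1ℚ x (suc n)) t-last
          (telescope (suc n) ℕₚ.≤-refl))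
        where
        telescope : ∀ k → k ℕ.≤ suc n → θ i (t k) ≤ c * Σ[< k ] (λ k → inv (t k) * h)
        telescope zero _ = ≤-reflexive (trans (trans (cong (λ z → θ i (1ℚ + z)) (*-zeroˡ h)) (θ-1 i)) (sym (*-zeroʳ c)))
        telescope (suc k) k< = begin
          θ i (t (suc k))
            ≡⟨ split (θ i (t k)) (θ i (t (suc k))) ⟩
          θ i (t k) + (θ i (t (suc k)) - θ i (t k))
            ≤⟨ +-mono-≤ (telescope k (ℕₚ.<⇒≤ k<)) increment ⟩
          c * Σ[< k ] (λ k → inv (t k) * h) + c * (inv (t k) * h)
            ≡⟨ *-distribˡ-+ c _ _ ⟨
          c * (Σ[< k ] (λ k → inv (t k) * h) + inv (t k) * h) ∎
          where
          open ≤-Reasoning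
          split : ∀ x y → y ≡ x + (y - x)
          split = solve-∀ ℚ-ring
          Δ = θ i (t (suc k)) - θ i (t k)
          0<t : 0ℚ < t k
          0<t = <-≤-trans 0<1 (1≤t k)
          increment : Δ ≤ c * (inv (t k) * h)
          increment = *-cancelˡ-≤-pos (t k) {{positive 0<t}} (begin
            t k * Δ                     ≤⟨ θ-upper i (1≤t k) (t≤t k) (≤-trans (t≤x (suc k) k<) x≤) ⟩
            c * (t (suc k) - t k)       ≡⟨ cong (c *_) (step k) ⟩
            c * h                       ≡⟨ cong (c *_) (trans (cong (_* h) (inv-* 0<t)) (*-identityˡ h)) ⟨
            c * (t k * inv (t k) * h)   ≡⟨ regroup c (t k) (inv (t k)) h ⟩
            t k * (c * (inv (t k) * h)) ∎)
            where
            regroup : ∀ c t i h → c * (t * i * h) ≡ t * (c * (i * h))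
            regroup = solve-∀ ℚ-ring

  -- The steps are nonpositive and the values of 1/t positive. This covers arguments below 1, where
  -- the comparison with θ does not apply.
  riemannSum≤0 : ∀ {x} n → 0ℚ < x → x ≤ 1ℚ → riemannSum inv 1ℚ x (suc n) ≤ 0ℚ
  riemannSum≤0 {x} n 0<x x≤1 = go (suc n) ℕₚ.≤-refl
    where
    r = + 1 / suc n
    go : ∀ k → k ℕ.≤ suc n → Σ[< k ] (λ k → inv (node x r k) * ((x - 1ℚ) * r)) ≤ 0ℚ
    go zero    _  = ≤-refl
    go (suc k) k< = +-mono-≤ (go k (ℕₚ.<⇒≤ k<)) (subst (_≤ 0ℚ) (flip (inv (node x r k)) x r)
      (neg-antimono-≤ (0≤* (<⇒≤ (inv-pos 0<t)) (0≤* (≤⇒0≤- x≤1) (<⇒≤ (0<1/ n))))))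
      where
      flip : ∀ i x r → - (i * ((1ℚ - x) * r)) ≡ i * ((x - 1ℚ) * r)
      flip = solve-∀ ℚ-ring
      0<t = <-≤-trans 0<x (node-≥ {x} {x} {r} (suc n) k (<⇒≤ (0<1/ n)) (fromℕ*1/ n) (ℕₚ.<⇒≤ k<) x≤1 ≤-refl)

  ≤-fraction : ∀ {x y a b c d} → x * fromℕ b ≡ fromℕ a → y * fromℕ d ≡ fromℕ c →
               x ≤ y → a ℕ.* d ℕ.≤ c ℕ.* b
  ≤-fraction {x} {y} {a} {b} {c} {d} x≡ y≡ x≤y = fromℕ-cancel-≤ (subst₂ _≤_
    (sym (trans (fromℕ-* a d) (trans (cong (_* fromℕ d) (sym x≡)) (*-assoc x (fromℕ b) (fromℕ d)))))
    (sym (trans (fromℕ-* c b) (trans (cong (_* fromℕ b) (sym y≡)) (swap y (fromℕ d) (fromℕ b)))))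
    (*-monoʳ-≤-nonNeg (fromℕ b * fromℕ d) {{nonNegative (0≤* (0≤fromℕ b) (0≤fromℕ d))}} x≤y))
    where
    swap : ∀ y d b → y * d * b ≡ y * (b * d)
    swap = solve-∀ ℚ-ring

  -- Each piece of θ has height `base` - 1 = 1/128. The relative error 1/128 of the slope is what
  -- `margin` has to absorb.
  base : ℚ
  base = + 129 / 128

  base-fraction : base * fromℕ 128 ≡ fromℕ 129
  base-fraction = /-*-fromℕ 129 127

  1≤base : 1ℚ ≤ base
  1≤base = toWitness {a? = 1ℚ ≤? base} _

  open PiecewiseLog {base} {+ 128 / 129} 1≤base refl

  0<128^ : ∀ k → 0 ℕ.< 128 ℕ.^ k
  0<128^ k = ℕₚ.m^n>0 128 k

  ≤base^ : ∀ {x a b} → 0 ℕ.< b → x * fromℕ b ≡ fromℕ a → ∀ k → a ℕ.* 128 ℕ.^ k ℕ.≤ 129 ℕ.^ k ℕ.* b → x ≤ base ^ k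
  ≤base^ {x} {a} {b} 0<b x≡ k = fraction-≤ {x} {base ^ k} {a} {b} {129 ℕ.^ k} {128 ℕ.^ k} 0<b (0<128^ k) x≡ (^-fraction {base} {129} {128} base-fraction k)

  base^≤ : ∀ {x a b} → 0 ℕ.< b → x * fromℕ b ≡ fromℕ a → ∀ k → 129 ℕ.^ k ℕ.* b ℕ.≤ a ℕ.* 128 ℕ.^ k → base ^ k ≤ x
  base^≤ {x} {a} {b} 0<b x≡ k = fraction-≤ {base ^ k} {x} {129 ℕ.^ k} {128 ℕ.^ k} {a} {b} (0<128^ k) 0<b (^-fraction {base} {129} {128} base-fraction k) x≡

  ≤ℕ⇒≤base^ : ∀ {x} a → x ≤ fromℕ a → ∀ k → a ℕ.* 128 ℕ.^ k ℕ.≤ 129 ℕ.^ k → x ≤ base ^ k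
  ≤ℕ⇒≤base^ a x≤a k h = ≤-trans x≤a (≤base^ {a = a} {b = 1} (ℕ.s≤s ℕ.z≤n) (*-identityʳ (fromℕ a)) k
    (ℕₚ.≤-trans h (ℕₚ.≤-reflexive (sym (ℕₚ.*-identityʳ (129 ℕ.^ k))))))

  -- The argument is a sequence, so that the bound serves both `log p`, whose argument is constant,
  -- and `log log p`, whose argument is itself approximated. The slack η covers the extra first
  -- summand of the Riemann sum.
  log-bound : ∀ (y : ℕ → ℚ) Y i → Y ℕ.* 128 ℕ.^ suc i ℕ.≤ 129 ℕ.^ suc i → ∀ {η} → 0ℚ < η →
    Eventually (λ n → 0ℚ < y n × y n ≤ fromℕ Y) →
    Eventually (λ n → riemannSum inv 1ℚ (y n) (suc n) ≤ η + fromℕ (suc i) * (base - 1ℚ))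
  log-bound y Y i Y≤ {η} 0<η = eventually-zip bound (eventually-small (fromℕ Y) 0<η)
    where
    bound : ∀ n → (+ 1 / suc n) * fromℕ Y ≤ η → 0ℚ < y n × y n ≤ fromℕ Y →
            riemannSum inv 1ℚ (y n) (suc n) ≤ η + fromℕ (suc i) * (base - 1ℚ)
    bound n small (0<y , y≤Y) with ≤-total 1ℚ (y n)
    ... | inj₁ 1≤y = ≤-trans (riemannSum≤ 1≤y n i (≤ℕ⇒≤base^ Y y≤Y (suc i) Y≤)) (+-monoˡ-≤ _
      (≤-trans (*-monoˡ-≤-nonNeg (+ 1 / suc n) {{nonNegative (<⇒≤ (0<1/ n))}}
        (≤-trans (subst (y n - 1ℚ ≤_) (+-identityʳ (y n)) (+-monoʳ-≤ (y n) (<⇒≤ (neg-antimono-< 0<1)))) y≤Y)) small))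
    ... | inj₂ y≤1 = ≤-trans (riemannSum≤0 n 0<y y≤1)
      (+-mono-≤ (<⇒≤ 0<η) (0≤* (0≤fromℕ (suc i)) (≤⇒0≤- 1≤base)))

  128*k*[base-1] : ∀ k → fromℕ (k ℕ.* 128) * (base - 1ℚ) ≡ fromℕ k
  128*k*[base-1] k = trans (cong (_* (base - 1ℚ)) (fromℕ-* k 128))
    (trans (*-assoc (fromℕ k) (fromℕ 128) (base - 1ℚ)) (*-identityʳ (fromℕ k)))

  -- 128 pieces of height 1/128 add up to 1, so p ≤ base^(128 k) accounts for k; the remaining 1 is
  -- the slack.
  seq-logPrime≤ : ∀ p (p-prime : Prime p) k i → suc i ≡ k ℕ.* 128 → p ℕ.* 128 ℕ.^ suc i ℕ.≤ 129 ℕ.^ suc i →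
    Eventually (λ n → seq (logPrime p p-prime) n ≤ fromℕ (suc k))
  seq-logPrime≤ p p-prime k i i≡ p≤ = eventually-map
    (λ n h → ≤-trans h (≤-reflexive (trans (cong (λ z → 1ℚ + z)
      (trans (cong (λ j → fromℕ j * (base - 1ℚ)) i≡) (128*k*[base-1] k)))
      (trans (+-comm 1ℚ (fromℕ k)) (sym (fromℕ-suc k))))))
    (log-bound (λ _ → fromℕ p) p i p≤ 0<1
      (0 , λ _ _ → fromℕ-< (ℕₚ.<-trans (ℕ.s≤s ℕ.z≤n) (prime⇒2≤ p-prime)) , ≤-refl))

  seq-loglogPrime≤ : ∀ p (p-prime : Prime p) Y j → Eventually (λ n → seq (logPrime p p-prime) n ≤ fromℕ Y) →
    Y ℕ.* 128 ℕ.^ suc j ℕ.≤ 129 ℕ.^ suc j → ∀ {η} → 0ℚ < η →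
    Eventually (λ n → seq (loglogPrime p p-prime) n ≤ η + fromℕ (suc j) * (base - 1ℚ))
  seq-loglogPrime≤ p p-prime Y j logp≤Y Y≤ 0<η = log-bound (seq (logPrime p p-prime)) Y j Y≤ 0<η
    (eventually-zip (λ n 0<y y≤Y → 0<y , y≤Y)
      (eventually-map (λ n → <-≤-trans (proj₁ (proj₂ positive-log))) (proj₂ (proj₂ positive-log))) logp≤Y)
    where
    positive-log = 0<seq {logPrime p p-prime} (0<log (fromℚ (fromℕ p)) (0<fromℕ-prime p p-prime) (1<fromℕ-prime p p-prime))

  -- 6.83 is enclosed between consecutive powers of `base`. The factor `base` on the right is the
  -- largest ratio of the slope of θ to 1/t.
  ≤seq-log-6·83 : ∀ i → 129 ℕ.^ i ℕ.* 100 ℕ.≤ 683 ℕ.* 128 ℕ.^ i → 683 ℕ.* 128 ℕ.^ suc i ℕ.≤ 129 ℕ.^ suc i ℕ.* 100 →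
    ∀ n → fromℕ i * (base - 1ℚ) ≤ base * seq log-6·83 n
  ≤seq-log-6·83 i ≤683 683≤ n = ≤riemannSum {+ 683 / 100} (toWitness {a? = 1ℚ ≤? + 683 / 100} _) n i
    (base^≤ {a = 683} {b = 100} (ℕ.s≤s ℕ.z≤n) (/-*-fromℕ 683 99) i ≤683)
    (≤base^ {a = 683} {b = 100} (ℕ.s≤s ℕ.z≤n) (/-*-fromℕ 683 99) (suc i) 683≤)

  2^128≤base^11520 : 2 ℕ.^ 128 ℕ.* 128 ℕ.^ 11520 ℕ.≤ 129 ℕ.^ 11520
  2^128≤base^11520 = toWitness {a? = 2 ℕ.^ 128 ℕ.* 128 ℕ.^ 11520 ℕₚ.≤? 129 ℕ.^ 11520} _

  91≤base^580 : 91 ℕ.* 128 ℕ.^ 580 ℕ.≤ 129 ℕ.^ 580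
  91≤base^580 = toWitness {a? = 91 ℕ.* 128 ℕ.^ 580 ℕₚ.≤? 129 ℕ.^ 580} _

  base^246≤6·83 : 129 ℕ.^ 246 ℕ.* 100 ℕ.≤ 683 ℕ.* 128 ℕ.^ 246
  base^246≤6·83 = toWitness {a? = 129 ℕ.^ 246 ℕ.* 100 ℕₚ.≤? 683 ℕ.* 128 ℕ.^ 246} _

  6·83≤base^247 : 683 ℕ.* 128 ℕ.^ 247 ℕ.≤ 129 ℕ.^ 247 ℕ.* 100
  6·83≤base^247 = toWitness {a? = 683 ℕ.* 128 ℕ.^ 247 ℕₚ.≤? 129 ℕ.^ 247 ℕ.* 100} _

  -- With 2^128 ≤ base^11520, log p ≤ 90 + 1 and log 91 ≤ 580/128, against (12/5)(246/129) ≤ log 6.83 / (1/2 - ε).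
  margin : base * (+ 1 / 100 + fromℕ 580 * (base - 1ℚ)) ≤ fromℕ 246 * (base - 1ℚ) * (+ 12 / 5)
  margin = toWitness {a? = base * (+ 1 / 100 + fromℕ 580 * (base - 1ℚ)) ≤? fromℕ 246 * (base - 1ℚ) * (+ 12 / 5)} _

  module _ {ε : ℝ} (1/11≤ε : fromℚ (+ 1 / 11) ≤ℝ ε) (ε<½ : ε <ℝ fromℚ ½) where

    private
      d : ℕ → ℚ
      d n = ½ - seq ε n

    0<½-ε : Eventually (λ n → 0ℚ < d n)
    0<½-ε = eventually-map (λ n h → <-≤-trans (proj₁ (proj₂ ε<½))
      (0≤-⇒≤ (subst (0ℚ ≤_) (regroup (seq ε n) (proj₁ ε<½) ½) (≤⇒0≤- h)))) (proj₂ (proj₂ ε<½))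
      where
      regroup : ∀ e δ h → h - (e + δ) ≡ (h - e) - δ
      regroup = solve-∀ ℚ-ring

    -- 1/2 - 1/11 = 108/264, and the order on reals leaves a slack of 1/264. The result is still
    -- below 5/12 = 110/264.
    ½-ε≤ : Eventually (λ n → d n ≤ + 109 / 264)
    ½-ε≤ = eventually-map (λ n h → 0≤-⇒≤ (subst (0ℚ ≤_) (regroup (seq ε n) (+ 1 / 264) (+ 1 / 11) ½) (≤⇒0≤- h)))
      (1/11≤ε (+ 1 / 264) (positive⁻¹ (+ 1 / 264)))
      where
      regroup : ∀ e δ l h → (e + δ) - l ≡ ((h - l) + δ) - (h - e)
      regroup = solve-∀ ℚ-ring

    12/5≤1/[½-ε] : Eventually (λ n → + 12 / 5 ≤ inv (d n))
    12/5≤1/[½-ε] = eventually-zip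
      (λ n 0<d d≤ → inv-anti 0<d (≤-trans d≤ (toWitness {a? = + 109 / 264 ≤? + 5 / 12} _))) 0<½-ε ½-ε≤

    -- A bound on p by a power of `base` bounds `log p`, hence `log log p`, and puts it below the
    -- value that the hypothesis forces. The exponents are variables, so the powers remain symbolic
    -- until `prime-large`.
    loglog-large : ∀ p (p-prime : Prime p) i Y j k →
      suc i ≡ Y ℕ.* 128 → p ℕ.* 128 ℕ.^ suc i ℕ.≤ 129 ℕ.^ suc i →
      suc Y ℕ.* 128 ℕ.^ suc j ℕ.≤ 129 ℕ.^ suc j →
      129 ℕ.^ k ℕ.* 100 ℕ.≤ 683 ℕ.* 128 ℕ.^ k → 683 ℕ.* 128 ℕ.^ suc k ℕ.≤ 129 ℕ.^ suc k ℕ.* 100 →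
      base * (+ 1 / 100 + fromℕ (suc j) * (base - 1ℚ)) ≤ fromℕ k * (base - 1ℚ) * (+ 12 / 5) →
      ¬ (log-6·83 ÷ℝ (fromℚ ½ -ℝ ε) [ <⇒0<- {ε} {fromℚ ½} ε<½ ] <ℝ loglogPrime p p-prime)
    loglog-large p p-prime i Y j k i≡ p≤ Y≤ ≤683 683≤ numeric (δ , 0<δ , hyp) =
      proj₂ absurd (proj₁ absurd) ℕₚ.≤-refl
      where
      refute : ∀ n → + 12 / 5 ≤ inv (d n) → seq log-6·83 n * inv (d n) + δ ≤ seq (loglogPrime p p-prime) n ×
        seq (loglogPrime p p-prime) n ≤ + 1 / 100 + fromℕ (suc j) * (base - 1ℚ) → ⊥
      refute n 12/5≤ (lower , upper) = <-irrefl refl (begin-strict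
        fromℕ k * (base - 1ℚ) * (+ 12 / 5)
          ≤⟨ *-mono {fromℕ k * (base - 1ℚ)} (0≤* (0≤fromℕ k) (≤⇒0≤- 1≤base)) (≤seq-log-6·83 k ≤683 683≤ n) (<⇒≤ (positive⁻¹ (+ 12 / 5))) 12/5≤ ⟩
        base * seq log-6·83 n * inv (d n)
          ≡⟨ *-assoc base (seq log-6·83 n) (inv (d n)) ⟩
        base * (seq log-6·83 n * inv (d n))
          <⟨ *-monoʳ-<-pos base (<-≤-trans (subst (_< v + δ) (+-identityʳ v) (+-monoʳ-< v 0<δ)) (≤-trans lower upper)) ⟩
        base * (+ 1 / 100 + fromℕ (suc j) * (base - 1ℚ))
          ≤⟨ numeric ⟩
        fromℕ k * (base - 1ℚ) * (+ 12 / 5) ∎)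
        where
        open ≤-Reasoning
        v = seq log-6·83 n * inv (d n)
      absurd : Eventually (λ _ → ⊥)
      absurd = eventually-zip refute 12/5≤1/[½-ε] (eventually-zip (λ n l u → l , u) hyp
        (seq-loglogPrime≤ p p-prime (suc Y) j (seq-logPrime≤ p p-prime Y i i≡ p≤) Y≤ (positive⁻¹ (+ 1 / 100))))

    prime-large : ∀ p (p-prime : Prime p) →
      log-6·83 ÷ℝ (fromℚ ½ -ℝ ε) [ <⇒0<- {ε} {fromℚ ½} ε<½ ] <ℝ loglogPrime p p-prime → 2 ℕ.^ 128 ℕ.< p
    prime-large p p-prime hyp = ℕₚ.≰⇒> λ p≤ → loglog-large p p-prime 11519 90 579 246 refl
      (ℕₚ.≤-trans {p ℕ.* 128 ℕ.^ 11520} {2 ℕ.^ 128 ℕ.* 128 ℕ.^ 11520} {129 ℕ.^ 11520}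
        (ℕₚ.*-mono-≤ {p} {2 ℕ.^ 128} {128 ℕ.^ 11520} {128 ℕ.^ 11520} p≤ ℕₚ.≤-refl) 2^128≤base^11520)
      91≤base^580 base^246≤6·83 6·83≤base^247 margin hyp

    φ-small : ∀ n (p-prime : Prime (suc n)) → fromℚ (φ[p-1]/[p-1] (suc n) p-prime) ≤ℝ fromℚ ½ -ℝ ε → 12 ℕ.* φ n ℕ.< 5 ℕ.* n
    φ-small zero p-prime _ = contradiction (prime⇒2≤ p-prime) λ { (s≤s ()) }
    φ-small n@(suc n′) p-prime hyp = ℕₚ.*-cancelˡ-< 176 _ _ (begin-strict
      176 ℕ.* (12 ℕ.* φ n)  ≡⟨ left (φ n) ⟩
      12 ℕ.* (φ n ℕ.* 176)  ≤⟨ ℕₚ.*-monoʳ-≤ 12 φ*176≤73*n ⟩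
      12 ℕ.* (73 ℕ.* n)     ≡⟨ right n ⟩
      876 ℕ.* n             <⟨ ℕₚ.*-monoˡ-< n (ℕₚ.m<m+n 876 {4} (s≤s z≤n)) ⟩
      880 ℕ.* n             ≡⟨ ℕₚ.*-assoc 176 5 n ⟩
      176 ℕ.* (5 ℕ.* n)     ∎)
      where
      open ℕₚ.≤-Reasoning
      left : ∀ k → 176 ℕ.* (12 ℕ.* k) ≡ 12 ℕ.* (k ℕ.* 176)
      left = ℕ-solve-∀
      right : ∀ k → 12 ℕ.* (73 ℕ.* k) ≡ 876 ℕ.* k
      right k = sym (ℕₚ.*-assoc 12 73 k)
      -- 109/264 + 1/528 = 219/528 = 73/176, and 12 · 73 = 876 < 880 = 5 · 176.
      bounded : Eventually (λ _ → + φ n / n ≤ + 73 / 176)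
      bounded = eventually-zip (λ k φ≤ d≤ → ≤-trans φ≤ (+-monoˡ-≤ (+ 1 / 528) d≤))
        (hyp (+ 1 / 528) (positive⁻¹ (+ 1 / 528))) ½-ε≤
      φ*176≤73*n : φ n ℕ.* 176 ℕ.≤ 73 ℕ.* n
      φ*176≤73*n = ≤-fraction {+ φ n / n} {+ 73 / 176} {φ n} {n} {73} {176} (/-*-fromℕ (φ n) n′) (/-*-fromℕ 73 175) (proj₂ bounded (proj₁ bounded) ℕₚ.≤-refl)

-- From coprimality with p - 1 to coprimality with (p - 1)/q.

open import Defs
open import Data.Nat.Base using (ℕ; NonZero)
open import Data.Nat.Primality using (Prime)
open import Data.Integer.Base using (ℤ; +_; 1ℤ; _-_; _<_)
open import Data.Integer.DivMod using (_/ℕ_)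
open import Data.Integer.GCD using (gcd)
open import Data.Rational.Base using (½) renaming (_/_ to _/ℚ_)
open import Data.Product.Base using (∃; _×_)
open import Relation.Binary.PropositionalEquality using (_≡_)
open import Data.Integer.Base using (+<+)
open import Data.Nat.Coprimality using (Coprime; coprime⇒gcd≡1)
open import Data.Nat.DivMod using (m/n*n≡m)
open NumberTheory using (QNRNP-exists)
open Logarithms using (prime-large; φ-small)

coprime-quotient : ∀ {g n q} .{{_ : NonZero q}} → q ℕ∣.∣ n → Coprime g n → Coprime g (n ℕ./ q)
coprime-quotient {n = n} {q} q∣n coprime (d∣g , d∣n/q) = coprime
  (d∣g , ℕ∣.∣-trans d∣n/q (ℕ∣.divides q (sym (trans (ℕₚ.*-comm q (n ℕ./ q)) (m/n*n≡m q∣n)))))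

theorem2 :
    (q : ℕ) .{{_ : NonZero q}}
    (ε : ℝ) → fromℚ (+ 1 /ℚ 11) ≤ℝ ε → (ε<½ : ε <ℝ fromℚ ½) →
    (p : ℕ) (p-prime : Prime p) →
    (+ p) ≡ 1ℤ [mod + q ] →
    log-6·83 ÷ℝ (fromℚ ½ -ℝ ε) [ <⇒0<- {ε} {fromℚ ½} ε<½ ] <ℝ loglogPrime p p-prime →
    fromℚ (φ[p-1]/[p-1] p p-prime) ≤ℝ fromℚ ½ -ℝ ε →
    (∃ λ (g : ℤ) → 1ℤ < g × g < + p - 1ℤ ×
       gcd g ((+ p - 1ℤ) /ℕ q) ≡ 1ℤ × IsQNRNP p g) ×
    (q ≡ 1 →
     ∃ λ (g : ℤ) → 1ℤ < g × g < + p - 1ℤ ×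
       gcd g (+ p - 1ℤ) ≡ 1ℤ × IsQNRNP p g)
theorem2 q ε 1/11≤ε ε<½ zero p-prime p≡1 loglog-p φ≤ = contradiction (prime⇒2≤ p-prime) λ ()
theorem2 q ε 1/11≤ε ε<½ (suc n) p-prime p≡1 loglog-p φ≤ =
  (+ g , +<+ 1<g , +<+ g<n , cong +_ (coprime⇒gcd≡1 (coprime-quotient p≡1 coprime)) , qnrnp) ,
  λ _ → + g , +<+ 1<g , +<+ g<n , cong +_ (coprime⇒gcd≡1 coprime) , qnrnp
  where
  found = QNRNP-exists p-prime (ℕₚ.≤-pred (prime-large {ε} 1/11≤ε ε<½ (suc n) p-prime loglog-p))
    (φ-small {ε} 1/11≤ε ε<½ n p-prime φ≤)
  g = proj₁ found
  1<g = proj₁ (proj₂ found)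
  g<n = proj₁ (proj₂ (proj₂ found))
  coprime = proj₁ (proj₂ (proj₂ (proj₂ found)))
  qnrnp = proj₂ (proj₂ (proj₂ (proj₂ found)))
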